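{- Let $\mathcal{S}_n$ be the number of triangles (ears) having at least two sides on the perimeter of $P_n$ in a uniformly random triangulation $\mathcal{T}_n$ of a convex $n$-gon $P_n$, and let $g_n(z)=\mathbb{E}(z^{\mathcal{S}_n})$. Then: (I) For all $n\ge 4$, $$g_n(z)=1+\frac{1}{C_{n-2}}\sum_{j=0}^{n-3}C_j\left(\binom{j+1}{n-2-j}+2\binom{j+1}{n-3-j}\right)(z-1)^{n-2-j}.$$ (II) For all $n\ge 4$, $\mathbb{E}(\mathcal{S}_n)=\dfrac{n(n-1)}{2(2n-5)}$. (III) For all $n\ge 6$, $\mathrm{Var}(\mathcal{S}_n)=\dfrac{n(n-1)(n-4)(n-5)}{2(2n-5)^2(2n-7)}$.
   Context: $P_n$ has vertices $v_{n,1},\dots,v_{n,n}$ in clockwise order. A triangulation of $P_n$ is a set of $n-3$ noncrossing diagonals partitioning $P_n$ into $n-2$ triangles; there are $C_{n-2}$ of them, where $C_k=\frac{1}{k+1}\binom{2k}{k}$, and $\mathcal{T}_n$ is chosen uniformly among them. Equivalently $\mathcal{S}_n=\sum_{\Delta\in\mathcal{T}_n}f_n(\Delta)$, where for $1\le l<j<r\le n$ the weight $f_{n,l,j,r}$ of the triangle with vertices $v_{n,l},v_{n,j},v_{n,r}$ is $1$ if $(j,r)=(l+1,l+2)$ with $r\le n$, or $(l,j,r)=(1,n-1,n)$, or $(l,j,r)=(1,2,n)$, and is $0$ otherwise. Here $z$ is a complex variable and $\binom{a}{b}=0$ when $b>a\ge 0$. -}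

module Defs where

open import Algebra.Bundles using (CommutativeRing)
import Algebra.Morphism.Construct.Identity as Identity
open import Algebra.Morphism.Structures using (module RingMorphisms)
import Algebra.Properties.Semiring.Exp as Exp
open import Data.Fin using (Fin; toℕ; _<_; _<?_)
import Data.Fin.Properties as Fin
open import Data.Integer using (+_)
open import Data.List using (List; []; _∷_; _++_; map; filter; foldr; length; upTo; allFin; cartesianProduct)
open import Data.List.Relation.Unary.All using (All; all?)
open import Data.List.Relation.Unary.AllPairs using (AllPairs; allPairs?)
import Data.List.Membership.DecPropositional as DecMembership
open import Data.Nat as ℕ using (ℕ; zero; suc; z≤n; s≤s)
open import Data.Nat.Combinatorics using (_C_; nCk+nC[k+1]≡[n+1]C[k+1])
import Data.Nat.Properties as ℕ
open import Data.Product using (_×_; _,_)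
open import Data.Product.Properties using (≡-dec)
open import Data.Rational using (ℚ; 0ℚ; _/_; NonZero; Positive)
import Data.Rational.Properties as ℚ
open import Data.Sum using (_⊎_)
open import Level using (0ℓ; _⊔_) renaming (suc to lsuc)
open import Relation.Binary.Definitions using (DecidableEquality)
open import Relation.Binary.PropositionalEquality using (_≡_; refl; subst)
open import Relation.Nullary using (Dec; ¬_; ¬?; _×-dec_; _⊎-dec_)

------------------------------------------------------------------------
-- The convex polygon

-- The vertex v_{n,i+1} of the convex n-gon is i : Fin n.  A segment
-- joining two vertices is listed with its smaller endpoint first.

Segment : ℕ → Set
Segment n = Fin n × Fin n

_≟ˢ_ : ∀ {n} → DecidableEquality (Segment n)
_≟ˢ_ = ≡-dec Fin._≟_ Fin._≟_

module _ {n : ℕ} where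
  open DecMembership (_≟ˢ_ {n}) public using (_∈_; _∈?_)

segments : ∀ n → List (Segment n)
segments n = filter (λ (i , j) → i <? j) (cartesianProduct (allFin n) (allFin n))

Side : ∀ {n} → Segment n → Set
Side {n} (i , j) = (toℕ j ≡ suc (toℕ i)) ⊎ (toℕ i ≡ 0 × suc (toℕ j) ≡ n)

side? : ∀ {n} (e : Segment n) → Dec (Side e)
side? {n} (i , j) =
  (toℕ j ℕ.≟ suc (toℕ i)) ⊎-dec ((toℕ i ℕ.≟ 0) ×-dec (suc (toℕ j) ℕ.≟ n))

diagonals : ∀ n → List (Segment n)
diagonals n = filter (λ e → ¬? (side? e)) (segments n)

-- Since the vertices are in convex position, two segments meet in their
-- interiors, without coinciding, exactly when their endpoints strictly
-- alternate around the polygon.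

Crossing : ∀ {n} → Segment n → Segment n → Set
Crossing (a , b) (c , d) = (a < c × c < b × b < d) ⊎ (c < a × a < d × d < b)

crossing? : ∀ {n} (e f : Segment n) → Dec (Crossing e f)
crossing? (a , b) (c , d) =
  ((a <? c) ×-dec ((c <? b) ×-dec (b <? d))) ⊎-dec
  ((c <? a) ×-dec ((a <? d) ×-dec (d <? b)))

------------------------------------------------------------------------
-- Triangles and triangulations

Triangle : ℕ → Set
Triangle n = Fin n × Fin n × Fin n

allTriangles : ∀ n → List (Triangle n)
allTriangles n =
  filter (λ (l , j , r) → (l <? j) ×-dec (j <? r))
         (cartesianProduct (allFin n) (cartesianProduct (allFin n) (allFin n)))

edges : ∀ {n} → Triangle n → List (Segment n)
edges (l , j , r) = (l , j) ∷ (j , r) ∷ (l , r) ∷ []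

-- The triangles whose three edges are sides of the polygon or belong to
-- D.  When D is noncrossing these are exactly the triangular regions
-- into which D cuts the polygon, since a diagonal that enters the
-- interior of a triangle crosses one of its edges.

triangles : ∀ {n} → List (Segment n) → List (Triangle n)
triangles {n} D =
  filter (λ Δ → all? (λ e → side? e ⊎-dec (e ∈? D)) (edges Δ)) (allTriangles n)

IsTriangulation : ∀ n → List (Segment n) → Set
IsTriangulation n D =
  AllPairs (λ e f → ¬ Crossing e f) D ×
  length D ≡ n ℕ.∸ 3 ×
  length (triangles D) ≡ n ℕ.∸ 2

isTriangulation? : ∀ n (D : List (Segment n)) → Dec (IsTriangulation n D)
isTriangulation? n D =
  allPairs? (λ e f → ¬? (crossing? e f)) D ×-dec
  (length D ℕ.≟ n ℕ.∸ 3) ×-dec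
  (length (triangles D) ℕ.≟ n ℕ.∸ 2)

sublists : ∀ {A : Set} → List A → List (List A)
sublists []       = [] ∷ []
sublists (x ∷ xs) = map (x ∷_) (sublists xs) ++ sublists xs

-- As diagonals n has no repetitions, its sublists represent each set of
-- diagonals exactly once.

triangulations : ∀ n → List (List (Segment n))
triangulations n = filter (isTriangulation? n) (sublists (diagonals n))

Ear : ∀ {n} → Triangle n → Set
Ear Δ = 2 ℕ.≤ length (filter side? (edges Δ))

ear? : ∀ {n} (Δ : Triangle n) → Dec (Ear Δ)
ear? Δ = 2 ℕ.≤? length (filter side? (edges Δ))

𝒮 : ∀ {n} → List (Segment n) → ℕ
𝒮 D = length (filter ear? (triangles D))

------------------------------------------------------------------------
-- Expectation

-- Random variables take values in a commutative ℚ-algebra, such as ℚ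
-- itself or the complex numbers.

record ℚ-Algebra c ℓ : Set (lsuc (c ⊔ ℓ)) where
  field
    commutativeRing : CommutativeRing c ℓ
  open CommutativeRing commutativeRing public
  open RingMorphisms ℚ.+-*-rawRing rawRing
  field
    ι                  : ℚ → Carrier
    isRingHomomorphism : IsRingHomomorphism ι
  open Exp semiring public using (_^_)

ℚ-algebra : ℚ-Algebra 0ℓ 0ℓ
ℚ-algebra = record
  { commutativeRing    = ℚ.+-*-commutativeRing
  ; ι                  = λ q → q
  ; isRingHomomorphism = Identity.isRingHomomorphism ℚ.+-*-rawRing refl
  }

-- The convention for 0 is immaterial: it is applied only to the number
-- of triangulations, which is nonzero for n ≥ 3.

reciprocal : ℕ → ℚ
reciprocal zero    = 0ℚ
reciprocal (suc k) = + 1 / suc k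

module _ {c ℓ} (A : ℚ-Algebra c ℓ) where
  open ℚ-Algebra A

  sum : List Carrier → Carrier
  sum = foldr _+_ 0#

  𝔼 : ∀ n → (List (Segment n) → Carrier) → Carrier
  𝔼 n X = ι (reciprocal (length (triangulations n))) * sum (map X (triangulations n))

  Var : ∀ n → (List (Segment n) → Carrier) → Carrier
  Var n X = 𝔼 n (λ T → (X T - 𝔼 n X) ^ 2)

  g : ∀ n → Carrier → Carrier
  g n z = 𝔼 n (λ T → z ^ 𝒮 T)

fromℕ : ℕ → ℚ
fromℕ k = + k / 1

------------------------------------------------------------------------
-- Catalan numbers and nonvanishing denominators

catalan : ℕ → ℚ
catalan k = + ((2 ℕ.* k) C k) / suc k

private
  nCk>0 : ∀ {n k} → k ℕ.≤ n → 0 ℕ.< n C k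
  nCk>0 {n}     {zero}  z≤n       = s≤s z≤n
  nCk>0 {suc n} {suc k} (s≤s k≤n) =
    subst (0 ℕ.<_) (nCk+nC[k+1]≡[n+1]C[k+1] n k)
      (ℕ.≤-trans (nCk>0 k≤n) (ℕ.m≤m+n (n C k) (n C suc k)))

  catalan>0 : ∀ k → Positive (catalan k)
  catalan>0 k = ℚ.normalize-pos ((2 ℕ.* k) C k) (suc k)
    where instance _ = ℕ.>-nonZero (nCk>0 (ℕ.m≤m+n k (k ℕ.+ 0)))

catalan≢0 : ∀ k → NonZero (catalan k)
catalan≢0 k = ℚ.pos⇒nonZero (catalan k) {{catalan>0 k}}

2n-5≢0 : ∀ {n} → 4 ℕ.≤ n → ℕ.NonZero (2 ℕ.* n ℕ.∸ 5)
2n-5≢0 4≤n = ℕ.>-nonZero (ℕ.m<n⇒0<n∸m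
  (ℕ.≤-trans (ℕ.m≤n+m 6 2) (ℕ.*-monoʳ-≤ 2 4≤n)))

2n-7≢0 : ∀ {n} → 6 ℕ.≤ n → ℕ.NonZero (2 ℕ.* n ℕ.∸ 7)
2n-7≢0 6≤n = ℕ.>-nonZero (ℕ.m<n⇒0<n∸m
  (ℕ.≤-trans (ℕ.m≤n+m 8 4) (ℕ.*-monoʳ-≤ 2 6≤n)))

mean-denominator≢0 : ∀ {n} → 4 ℕ.≤ n → ℕ.NonZero (2 ℕ.* (2 ℕ.* n ℕ.∸ 5))
mean-denominator≢0 {n} 4≤n = ℕ.m*n≢0 2 (2 ℕ.* n ℕ.∸ 5)
  where instance _ = 2n-5≢0 4≤n

variance-denominator≢0 : ∀ {n} → 6 ℕ.≤ n →
  ℕ.NonZero (2 ℕ.* (2 ℕ.* n ℕ.∸ 5) ℕ.^ 2 ℕ.* (2 ℕ.* n ℕ.∸ 7))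
variance-denominator≢0 {n} 6≤n =
  ℕ.m*n≢0 (2 ℕ.* (2 ℕ.* n ℕ.∸ 5) ℕ.^ 2) (2 ℕ.* n ℕ.∸ 7)
  where instance
    2n-5 = 2n-5≢0 (ℕ.≤-trans (ℕ.m≤n+m 4 2) 6≤n)
    sq   = ℕ.m^n≢0 (2 ℕ.* n ℕ.∸ 5) 2
    2sq  = ℕ.m*n≢0 2 ((2 ℕ.* n ℕ.∸ 5) ℕ.^ 2)
    2n-7 = 2n-7≢0 6≤n

{-# OPTIONS --safe #-}
module Submission where

-- In a triangulation every vertex other than the first and the last is the
-- middle vertex of exactly one triangle.  Hence triangulations are binary trees,
-- and for n ≥ 4 the ears are the nodes with two leaf children, plus the root when
-- one of its children is a leaf.  With x = z − 1, the generating function F of the trees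
-- with weight z ^ (number of nodes with two leaf children) satisfies
-- F = 1 + x t + t F², so F = Σⱼ Cⱼ tʲ (1 + x t)ʲ⁺¹, where C is the Catalan sequence,
-- and n-gons with n ≥ 4 are counted by the coefficient of tⁿ⁻² in (1 + 2 x t) F.
-- The mean and the variance are read off at z = 1 + ε in ℚ[ε] / (ε³).

open import Defs hiding (_∈_)

-- A triangulation comes only as a list of diagonals with prescribed counts: no triangle to split at
-- is given, and no plane geometry provides one. Counting does: noncrossing allows at most one
-- triangle per middle vertex, and n - 2 triangles leave none of the n - 2 possible middle vertices
-- free. The third vertex over any edge is then found by enlarging triangles until one spans that
-- edge. The formula for F comes from a substitution. If C(s) = 1 + s C(s)² is the Catalan series
-- and u = 1 + x t, multiplying C(t u) = 1 + t u C(t u)² by u shows that u C(t u) solves F = u + t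
-- F². Part (I) is proved over an arbitrary ℚ-algebra so that it can be applied to itself: over ℚ[ε]
-- / (ε³) the moments are coefficients of ε and ε², nothing is differentiated, and of the summands
-- only those with exponents 1 and 2 survive.

module Polygon where

  open import Data.Empty using (⊥-elim)
  open import Data.Fin as Fin using (Fin; toℕ; fromℕ<)
  import Data.Fin.Properties as Fin
  open import Data.List using (List; []; _∷_; _++_; map; length; filter; allFin; cartesianProduct; applyUpTo)
  open import Data.List.Membership.Propositional using (_∈_)
  open import Data.List.Membership.Propositional.Properties
    using (∈-++⁺ˡ; ∈-++⁺ʳ; ∈-++⁻; ∈-∃++; ∈-map⁺; ∈-map⁻; ∈-filter⁺; ∈-filter⁻;
           ∈-cartesianProduct⁺; ∈-allFin; ∈-AllPairs₂; ∈-applyUpTo⁺)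
  open import Data.List.Membership.Propositional.Properties.WithK using (unique∧set⇒bag)
  import Data.List.Properties as List
  open import Data.List.Relation.Binary.BagAndSetEquality using (∼bag⇒↭)
  open import Data.List.Relation.Binary.Permutation.Propositional using (_↭_)
  open import Data.List.Relation.Binary.Permutation.Propositional.Properties
    using (shift; ∈-resp-↭; ↭-length; filter-↭)
  open import Data.List.Relation.Unary.All as All using ([]; _∷_)
  open import Data.List.Relation.Unary.AllPairs using (AllPairs; []; _∷_)
  open import Data.List.Relation.Unary.Any using (here; there)
  open import Data.List.Relation.Unary.Unique.Propositional using (Unique)
  import Data.List.Relation.Unary.Unique.Propositional.Properties as Unique
  open import Data.Nat as ℕ using (ℕ; zero; suc; _+_; _∸_; _≤_; _<_; z≤n; s≤s)
  import Data.Nat.Properties as ℕ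
  open import Data.Product using (_×_; _,_; proj₁; proj₂; ∃)
  open import Data.Product.Properties using (≡-dec; ,-injective)
  open import Data.Sum using (_⊎_; inj₁; inj₂)
  open import Function using (_∘_; mk⇔)
  open import Relation.Binary.Definitions using (tri<; tri≈; tri>)
  open import Relation.Binary.PropositionalEquality
    using (_≡_; _≢_; refl; sym; trans; cong; cong₂; subst; subst₂; module ≡-Reasoning)
  open import Relation.Nullary using (Dec; yes; no; ¬_; contradiction; _⊎-dec_; _×-dec_)
  open import Relation.Unary using (Decidable)

  -- Repetition-free lists compared by their members.

  unique∧⇔⇒↭ : ∀ {a} {A : Set a} {xs ys : List A} → Unique xs → Unique ys →
    (∀ {x} → x ∈ xs → x ∈ ys) → (∀ {x} → x ∈ ys → x ∈ xs) → xs ↭ ys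
  unique∧⇔⇒↭ xs! ys! f g = ∼bag⇒↭ (unique∧set⇒bag xs! ys! (mk⇔ f g))

  -- Pigeonhole. It replaces every maximality argument about triangulations: distinct middle
  -- vertices, or distinct diagonals, exhaust their range once there are enough of them.
  ⊆∧length≥⇒⊇ : ∀ {a} {A : Set a} {xs ys : List A} → Unique xs →
    (∀ {x} → x ∈ xs → x ∈ ys) → length ys ≤ length xs → ∀ {y} → y ∈ ys → y ∈ xs
  ⊆∧length≥⇒⊇ {xs = []}     {[]}    _ _ _ ()
  ⊆∧length≥⇒⊇ {xs = x ∷ xs} (x≢ ∷ xs!) xs⊆ys ≤len y∈
    with ys₁ , ys₂ , refl ← ∈-∃++ (xs⊆ys (here refl))
    with ∈-resp-↭ (shift x ys₁ ys₂) y∈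
  ... | here refl = here refl
  ... | there y∈′ = there (⊆∧length≥⇒⊇ xs! xs⊆ys′ ≤len′ y∈′)
    where
    xs⊆ys′ : ∀ {z} → z ∈ xs → z ∈ ys₁ ++ ys₂
    xs⊆ys′ z∈ with ∈-resp-↭ (shift x ys₁ ys₂) (xs⊆ys (there z∈))
    ... | here refl = contradiction refl (All.lookup x≢ z∈)
    ... | there z∈′ = z∈′
    ≤len′ : length (ys₁ ++ ys₂) ≤ length xs
    ≤len′ = ℕ.s≤s⁻¹ (subst (_≤ suc (length xs)) (↭-length (shift x ys₁ ys₂)) ≤len)

  -- A tree with its left end at a stands for a triangulation of the polygon
  -- with vertices a, ..., end t a: the triangle on the edge (a , end t a) has
  -- its third vertex at end l a.

  data Tree : Set where
    leaf : Tree
    node : Tree → Tree → Tree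

  end : Tree → ℕ → ℕ
  end leaf       a = suc a
  end (node l r) a = end r (end l a)

  size : Tree → ℕ
  size leaf       = 0
  size (node l r) = suc (size l + size r)

  end≡+size : ∀ t a → end t a ≡ suc (a + size t)
  end≡+size leaf       a = cong suc (sym (ℕ.+-identityʳ a))
  end≡+size (node l r) a rewrite end≡+size r (end l a) | end≡+size l a
    | ℕ.+-suc a (size l + size r) | ℕ.+-assoc a (size l) (size r) = refl

  a<end : ∀ t a → a < end t a
  a<end t a rewrite end≡+size t a = s≤s (ℕ.m≤m+n a (size t))

  -- Leaves stand for the sides (i , i + 1) and nodes for the longest edges of triangles, so sides
  -- and diagonals are handled alike. Vertices are natural numbers because a subtree lives in a
  -- smaller polygon with another first vertex.
  Edge : Tree → ℕ → ℕ × ℕ → Set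
  Edge leaf       a e = e ≡ (a , suc a)
  Edge (node l r) a e = e ≡ (a , end (node l r) a) ⊎ Edge l a e ⊎ Edge r (end l a) e

  edge? : ∀ t a e → Dec (Edge t a e)
  edge? leaf       a e = ≡-dec ℕ._≟_ ℕ._≟_ e _
  edge? (node l r) a e = ≡-dec ℕ._≟_ ℕ._≟_ e _ ⊎-dec (edge? l a e ⊎-dec edge? r (end l a) e)

  root : ∀ t a → Edge t a (a , end t a)
  root leaf       a = refl
  root (node l r) a = inj₁ refl

  edge-bounds : ∀ t {a x y} → Edge t a (x , y) → a ≤ x × x < y × y ≤ end t a
  edge-bounds leaf refl = ℕ.≤-refl , ℕ.≤-refl , ℕ.≤-refl
  edge-bounds t@(node l r) {a} (inj₁ refl) = ℕ.≤-refl , a<end t a , ℕ.≤-refl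
  edge-bounds (node l r) {a} (inj₂ (inj₁ e)) with a≤x , x<y , y≤m ← edge-bounds l e =
    a≤x , x<y , ℕ.≤-trans y≤m (ℕ.<⇒≤ (a<end r (end l a)))
  edge-bounds (node l r) {a} (inj₂ (inj₂ e)) with m≤x , x<y , y≤b ← edge-bounds r e =
    ℕ.≤-trans (ℕ.<⇒≤ (a<end l a)) m≤x , x<y , y≤b

  side-edge : ∀ t {a i} → a ≤ i → i < end t a → Edge t a (i , suc i)
  side-edge leaf a≤i (s≤s i≤a) with refl ← ℕ.≤-antisym a≤i i≤a = refl
  side-edge (node l r) {a} {i} a≤i i<b with i ℕ.<? end l a
  ... | yes i<m = inj₂ (inj₁ (side-edge l a≤i i<m))
  ... | no  i≮m = inj₂ (inj₂ (side-edge r (ℕ.≮⇒≥ i≮m) i<b))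

  -- Noncrossing edges, faces and chords of a tree.

  _crosses_ : ℕ × ℕ → ℕ × ℕ → Set
  (a , b) crosses (c , d) = a < c × c < b × b < d

  -- Ranging over ordered pairs covers both ways in which endpoints can alternate; `_crosses_` fixes
  -- one of them.
  Noncrossing : (ℕ × ℕ → Set) → Set
  Noncrossing E = ∀ {e f} → E e → E f → ¬ e crosses f

  edge-noncrossing : ∀ t a → Noncrossing (Edge t a)
  edge-noncrossing leaf a refl refl (a<a , _) = ℕ.<-irrefl refl a<a
  edge-noncrossing t@(node l r) a {_ , _} {_ , _} (inj₁ refl) f (_ , _ , b<d) =
    ℕ.<⇒≱ b<d (proj₂ (proj₂ (edge-bounds t f)))
  edge-noncrossing t@(node l r) a {_ , _} {_ , _} e@(inj₂ _) (inj₁ refl) (x<a , _) =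
    ℕ.<⇒≱ x<a (proj₁ (edge-bounds t e))
  edge-noncrossing (node l r) a (inj₂ (inj₁ e)) (inj₂ (inj₁ f)) = edge-noncrossing l a e f
  edge-noncrossing (node l r) a {_ , _} {_ , _} (inj₂ (inj₁ e)) (inj₂ (inj₂ f)) (_ , c<b , _) =
    ℕ.<⇒≱ c<b (ℕ.≤-trans (proj₂ (proj₂ (edge-bounds l e))) (proj₁ (edge-bounds r f)))
  edge-noncrossing (node l r) a {_ , _} {_ , _} (inj₂ (inj₂ e)) (inj₂ (inj₁ f)) (x<c , _ , _) =
    ℕ.<⇒≱ (ℕ.<-trans x<c (proj₁ (proj₂ (edge-bounds l f))))
      (ℕ.≤-trans (proj₂ (proj₂ (edge-bounds l f))) (proj₁ (edge-bounds r e)))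
  edge-noncrossing (node l r) a (inj₂ (inj₂ e)) (inj₂ (inj₂ f)) = edge-noncrossing r (end l a) e f

  record IsTriangle (E : ℕ × ℕ → Set) (Δ : ℕ × ℕ × ℕ) : Set where
    constructor isTriangle
    field
      l<j : proj₁ Δ < proj₁ (proj₂ Δ)
      j<r : proj₁ (proj₂ Δ) < proj₂ (proj₂ Δ)
      lj  : E (proj₁ Δ , proj₁ (proj₂ Δ))
      jr  : E (proj₁ (proj₂ Δ) , proj₂ (proj₂ Δ))
      lr  : E (proj₁ Δ , proj₂ (proj₂ Δ))

  middle : ℕ × ℕ × ℕ → ℕ
  middle = proj₁ ∘ proj₂

  -- If the triangles differ at the left or at the right, the edge from the common middle vertex to
  -- the farther end crosses the longest edge of the other triangle.
  middle-injective : ∀ {E} → Noncrossing E → ∀ {Δ Δ′} →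
    IsTriangle E Δ → IsTriangle E Δ′ → middle Δ ≡ middle Δ′ → Δ ≡ Δ′
  middle-injective nc {l , j , r} {l′ , _ , r′} (isTriangle l<j j<r lj jr lr) (isTriangle l′<j j<r′ l′j jr′ l′r′) refl
    with ℕ.<-cmp l l′ | ℕ.<-cmp r r′
  ... | tri< l<l′ _ _ | _             = ⊥-elim (nc lj l′r′ (l<l′ , l′<j , j<r′))
  ... | tri> _ _ l′<l | _             = ⊥-elim (nc l′j lr (l′<l , l<j , j<r))
  ... | _             | tri< r<r′ _ _ = ⊥-elim (nc lr jr′ (l<j , j<r , r<r′))
  ... | _             | tri> _ _ r′<r = ⊥-elim (nc l′r′ jr (l′<j , j<r′ , r′<r))
  ... | tri≈ _ refl _ | tri≈ _ refl _ = refl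

  faces : Tree → ℕ → List (ℕ × ℕ × ℕ)
  faces leaf       a = []
  faces (node l r) a = (a , end l a , end (node l r) a) ∷ faces l a ++ faces r (end l a)

  length-faces : ∀ t a → length (faces t a) ≡ size t
  length-faces leaf       a = refl
  length-faces (node l r) a = cong suc (trans (List.length-++ (faces l a))
    (cong₂ _+_ (length-faces l a) (length-faces r (end l a))))

  face⇒triangle : ∀ t {a Δ} → Δ ∈ faces t a → IsTriangle (Edge t a) Δ
  face⇒triangle (node l r) {a} (here refl) =
    isTriangle (a<end l a) (a<end r (end l a))
      (inj₂ (inj₁ (root l a))) (inj₂ (inj₂ (root r (end l a)))) (inj₁ refl)
  face⇒triangle (node l r) {a} (there Δ∈) with ∈-++⁻ (faces l a) Δ∈
  ... | inj₁ Δ∈l = let isTriangle p q lj jr lr = face⇒triangle l Δ∈l in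
    isTriangle p q (inj₂ (inj₁ lj)) (inj₂ (inj₁ jr)) (inj₂ (inj₁ lr))
  ... | inj₂ Δ∈r = let isTriangle p q lj jr lr = face⇒triangle r Δ∈r in
    isTriangle p q (inj₂ (inj₂ lj)) (inj₂ (inj₂ jr)) (inj₂ (inj₂ lr))

  face-at : ∀ t {a j} → a < j → j < end t a → ∃ λ Δ → Δ ∈ faces t a × middle Δ ≡ j
  face-at leaf a<j (s≤s j≤a) = contradiction j≤a (ℕ.<⇒≱ a<j)
  face-at (node l r) {a} {j} a<j j<b with ℕ.<-cmp j (end l a)
  ... | tri< j<m _ _ = let Δ , Δ∈ , eq = face-at l a<j j<m in Δ , there (∈-++⁺ˡ Δ∈) , eq
  ... | tri≈ _ refl _ = _ , here refl , refl
  ... | tri> _ _ m<j = let Δ , Δ∈ , eq = face-at r m<j j<b in Δ , there (∈-++⁺ʳ (faces l a) Δ∈) , eq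

  -- The middle vertex lies strictly inside the span of the tree, where some face already has it as
  -- its middle vertex; `middle-injective` identifies the two.
  triangle⇒face : ∀ t {a Δ} → IsTriangle (Edge t a) Δ → Δ ∈ faces t a
  triangle⇒face t {a} {l , j , r} Δ@(isTriangle l<j j<r lj jr lr)
    with Δ′ , Δ′∈ , eq ← face-at t (ℕ.≤-<-trans (proj₁ (edge-bounds t lj)) l<j)
                                   (ℕ.<-≤-trans j<r (proj₂ (proj₂ (edge-bounds t jr))))
    with refl ← middle-injective (edge-noncrossing t a) Δ (face⇒triangle t Δ′∈) (sym eq) = Δ′∈

  -- Recording a face by its longest edge matches the faces with the edges other than the sides (i ,
  -- i + 1).
  chord : ℕ × ℕ × ℕ → ℕ × ℕ
  chord (l , j , r) = l , r

  chords : Tree → ℕ → List (ℕ × ℕ)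
  chords t a = map chord (faces t a)

  -- The chord of the root is left out: in the whole polygon it is the side joining the first and
  -- last vertices, so `inner t 0` consists of the diagonals.
  inner : Tree → ℕ → List (ℕ × ℕ)
  inner leaf       a = []
  inner (node l r) a = chords l a ++ chords r (end l a)

  chords-node : ∀ l r a → chords (node l r) a ≡ (a , end (node l r) a) ∷ inner (node l r) a
  chords-node l r a = cong ((a , end (node l r) a) ∷_) (List.map-++ chord (faces l a) (faces r (end l a)))

  chord⇒edge : ∀ t {a x y} → (x , y) ∈ chords t a → Edge t a (x , y) × y ≢ suc x
  chord⇒edge t e∈ with (_ , j , _) , Δ∈ , refl ← ∈-map⁻ chord e∈
    with isTriangle l<j j<r _ _ lr ← face⇒triangle t Δ∈ =
    lr , λ { refl → ℕ.<⇒≱ j<r l<j }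

  edge⇒chord : ∀ t {a x y} → Edge t a (x , y) → y ≢ suc x → (x , y) ∈ chords t a
  edge⇒chord leaf refl y≢ = contradiction refl y≢
  edge⇒chord (node l r) (inj₁ refl) y≢ = here refl
  edge⇒chord (node l r) {a} {x} {y} (inj₂ (inj₁ e)) y≢ =
    subst ((x , y) ∈_) (sym (chords-node l r a)) (there (∈-++⁺ˡ (edge⇒chord l e y≢)))
  edge⇒chord (node l r) {a} {x} {y} (inj₂ (inj₂ e)) y≢ =
    subst ((x , y) ∈_) (sym (chords-node l r a)) (there (∈-++⁺ʳ (chords l a) (edge⇒chord r e y≢)))

  inner⇒chord : ∀ t {a e} → e ∈ inner t a → e ∈ chords t a
  inner⇒chord t@(node l r) {a} {e} e∈ = subst (e ∈_) (sym (chords-node l r a)) (there e∈)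

  chord⇒inner : ∀ t {a e} → e ∈ chords t a → e ≢ (a , end t a) → e ∈ inner t a
  chord⇒inner t@(node l r) {a} {e} e∈ e≢ with subst (e ∈_) (chords-node l r a) e∈
  ... | here eq   = contradiction eq e≢
  ... | there e∈′ = e∈′

  chords! : ∀ t a → Unique (chords t a)
  inner! : ∀ t a → Unique (inner t a)
  inner-≢ : ∀ t {a e} → e ∈ inner t a → e ≢ (a , end t a)

  inner! leaf       a = []
  inner! (node l r) a = Unique.++⁺ (chords! l a) (chords! r (end l a)) λ { {_ , _} (e∈l , e∈r) →
    let _ , x<y , y≤m = edge-bounds l (proj₁ (chord⇒edge l e∈l))
        m≤x , _       = edge-bounds r (proj₁ (chord⇒edge r e∈r))
    in ℕ.<⇒≱ x<y (ℕ.≤-trans y≤m m≤x) }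

  inner-≢ (node l r) {a} e∈ refl with ∈-++⁻ (chords l a) e∈
  ... | inj₁ e∈l = ℕ.<⇒≱ (a<end r (end l a)) (proj₂ (proj₂ (edge-bounds l (proj₁ (chord⇒edge l e∈l)))))
  ... | inj₂ e∈r = ℕ.<⇒≱ (a<end l a) (proj₁ (edge-bounds r (proj₁ (chord⇒edge r e∈r))))

  chords! leaf       a = []
  chords! t@(node l r) a = subst Unique (sym (chords-node l r a))
    (All.tabulate (λ e∈ eq → inner-≢ t e∈ (sym eq)) ∷ inner! t a)

  faces! : ∀ t a → Unique (faces t a)
  faces! t a = Unique.map⁻ (chords! t a)

  length-inner : ∀ t a → length (inner t a) ≡ size t ∸ 1
  length-inner leaf       a = refl
  length-inner (node l r) a = trans (List.length-++ (chords l a)) (cong₂ _+_ (lc l a) (lc r (end l a)))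
    where
    lc : ∀ t a → length (chords t a) ≡ size t
    lc t a = trans (List.length-map chord (faces t a)) (length-faces t a)

  -- If the third vertices m and m′ over the root edge differed, the edge from a to the larger one
  -- and the edge from the smaller one to the right end would cross, and both are edges of t′. Once
  -- m = m′, the bounds on endpoints sort the edges into left and right subtrees.
  edge⊆⇒≡ : ∀ t t′ {a} → end t a ≡ end t′ a → (∀ {e} → Edge t a e → Edge t′ a e) → t ≡ t′
  edge⊆⇒≡ leaf leaf eq sub = refl
  edge⊆⇒≡ leaf (node l r) {a} eq sub =
    contradiction (ℕ.<-≤-trans (s≤s (a<end l a)) (a<end r (end l a))) (ℕ.<-irrefl eq)
  edge⊆⇒≡ (node l r) leaf {a} eq sub =
    contradiction (ℕ.<-≤-trans (s≤s (a<end l a)) (a<end r (end l a))) (ℕ.<-irrefl (sym eq))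
  edge⊆⇒≡ (node l r) t′@(node l′ r′) {a} eq sub =
    cong₂ node (edge⊆⇒≡ l l′ m≡m′ sub-l) (edge⊆⇒≡ r r′ (trans eq (cong (end r′) (sym m≡m′))) sub-r)
    where
    nc = edge-noncrossing t′ a
    m≡m′ : end l a ≡ end l′ a
    m≡m′ with ℕ.<-cmp (end l a) (end l′ a)
    ... | tri≈ _ m≡m′ _ = m≡m′
    ... | tri< m<m′ _ _ = ⊥-elim (nc (inj₂ (inj₁ (root l′ a))) (sub (inj₂ (inj₂ (root r (end l a)))))
      (a<end l a , m<m′ , subst (end l′ a <_) (sym eq) (a<end r′ (end l′ a))))
    ... | tri> _ _ m>m′ = ⊥-elim (nc (sub (inj₂ (inj₁ (root l a)))) (inj₂ (inj₂ (root r′ (end l′ a))))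
      (a<end l′ a , m>m′ , subst (end l a <_) eq (a<end r (end l a))))
    sub-l : ∀ {e} → Edge l a e → Edge l′ a e
    sub-l {x , y} e with sub (inj₂ (inj₁ e)) | edge-bounds l e
    ... | inj₁ refl | _ , _ , b≤m = contradiction (subst (_≤ end l a) (sym eq) b≤m) (ℕ.<⇒≱ (a<end r (end l a)))
    ... | inj₂ (inj₁ e′) | _ = e′
    ... | inj₂ (inj₂ e′) | _ , x<y , y≤m = contradiction
      (ℕ.≤-trans y≤m (subst (_≤ x) (sym m≡m′) (proj₁ (edge-bounds r′ e′)))) (ℕ.<⇒≱ x<y)
    sub-r : ∀ {e} → Edge r (end l a) e → Edge r′ (end l a) e
    sub-r {x , y} e with sub (inj₂ (inj₂ e)) | edge-bounds r e
    ... | inj₁ refl | m≤a , _ = contradiction m≤a (ℕ.<⇒≱ (a<end l a))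
    ... | inj₂ (inj₂ e′) | _ = subst (λ m → Edge r′ m _) (sym m≡m′) e′
    ... | inj₂ (inj₁ e′) | m≤x , x<y , _ = contradiction
      (ℕ.≤-trans (subst (y ≤_) (sym m≡m′) (proj₂ (proj₂ (edge-bounds l′ e′)))) m≤x) (ℕ.<⇒≱ x<y)

  -- The triangle with middle vertex j is extended to the right, and then to
  -- the left, until it spans (a , b).
  module _ {E : ℕ × ℕ → Set} (nc : Noncrossing E) {A B : ℕ}
    (triangle-at : ∀ {j} → A < j → j < B → ∃ λ Δ → middle Δ ≡ j × IsTriangle E Δ) where

    inside : ∀ {a b l j r} → E (a , b) → a < j → j < b → IsTriangle E (l , j , r) → a ≤ l × r ≤ b
    inside ab a<j j<b (isTriangle l<j j<r lj jr lr) =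
      ℕ.≮⇒≥ (λ l<a → nc lj ab (l<a , a<j , j<b)) , ℕ.≮⇒≥ (λ b<r → nc ab jr (a<j , j<b , b<r))

    spanning : ∀ k {a b l j r} → A ≤ a → b ≤ B → E (a , b) → a ≤ l → r ≤ b → (b ∸ r) + (l ∸ a) ≤ k →
      IsTriangle E (l , j , r) → ∃ λ m → IsTriangle E (a , m , b)
    spanning k {a} {b} {l} {j} {r} A≤a b≤B ab a≤l r≤b ≤k Δ@(isTriangle l<j j<r lj jr lr)
      with ℕ.m≤n⇒m<n∨m≡n r≤b | ℕ.m≤n⇒m<n∨m≡n a≤l
    ... | inj₂ refl | inj₂ refl = j , Δ
    spanning zero {a} {b} {l} {j} {r} A≤a b≤B ab a≤l r≤b ≤k Δ | inj₁ r<b | _ =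
      contradiction (ℕ.≤-trans (ℕ.m≤m+n (b ∸ r) (l ∸ a)) ≤k) (ℕ.<⇒≱ (ℕ.m<n⇒0<n∸m r<b))
    spanning zero {a} {b} {l} {j} {r} A≤a b≤B ab a≤l r≤b ≤k Δ | inj₂ _ | inj₁ a<l =
      contradiction (ℕ.≤-trans (ℕ.m≤n+m (l ∸ a) (b ∸ r)) ≤k) (ℕ.<⇒≱ (ℕ.m<n⇒0<n∸m a<l))
    -- The triangle with middle vertex r ends beyond r, and it starts at or before l, since
    -- otherwise (l , r) would cross its longest edge. So the gap (b - r) + (l - a) shrinks.
    spanning (suc k) {a} {b} {l} {j} {r} A≤a b≤B ab a≤l r≤b ≤k Δ@(isTriangle l<j j<r lj jr lr) | inj₁ r<b | _
      with a<r ← ℕ.≤-<-trans a≤l (ℕ.<-trans l<j j<r)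
      with (l′ , _ , r′) , refl , Δ′@(isTriangle l′<r r<r′ l′r rr′ l′r′) ← triangle-at (ℕ.≤-<-trans A≤a a<r) (ℕ.<-≤-trans r<b b≤B)
      with a≤l′ , r′≤b ← inside ab a<r r<b Δ′ =
      spanning k A≤a b≤B ab a≤l′ r′≤b
        (ℕ.s≤s⁻¹ (ℕ.<-≤-trans (ℕ.+-mono-<-≤ (ℕ.∸-monoʳ-< r<r′ r′≤b) (ℕ.∸-monoˡ-≤ a l′≤l)) ≤k)) Δ′
      where
      l′≤l : l′ ≤ l
      l′≤l = ℕ.≮⇒≥ λ l<l′ → nc lr l′r′ (l<l′ , l′<r , r<r′)
    spanning (suc k) {a} {b} {l} {j} {r} A≤a b≤B ab a≤l r≤b ≤k Δ@(isTriangle l<j j<r lj jr lr) | inj₂ r≡b | inj₁ a<l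
      with l<b ← ℕ.<-≤-trans (ℕ.<-trans l<j j<r) r≤b
      with (l′ , _ , r′) , refl , Δ′@(isTriangle l′<l l<r′ l′l lr′ l′r′) ← triangle-at (ℕ.≤-<-trans A≤a a<l) (ℕ.<-≤-trans l<b b≤B)
      with a≤l′ , r′≤b ← inside ab a<l l<b Δ′ =
      spanning k A≤a b≤B ab a≤l′ r′≤b
        (ℕ.s≤s⁻¹ (ℕ.<-≤-trans (ℕ.+-mono-≤-< (ℕ.∸-monoʳ-≤ b r≤r′) (ℕ.∸-monoˡ-< l′<l a≤l′)) ≤k)) Δ′
      where
      r≤r′ : r ≤ r′
      r≤r′ = ℕ.≮⇒≥ λ r′<r → nc l′r′ lr (l′<l , l<r′ , r′<r)

    tree-on : ∀ k {a b} → A ≤ a → a < b → b ≤ B → b ∸ a ≤ k → E (a , b) →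
      ∃ λ t → end t a ≡ b × (∀ {e} → Edge t a e → E e)
    tree-on zero A≤a a<b b≤B ≤k ab = contradiction ≤k (ℕ.<⇒≱ (ℕ.m<n⇒0<n∸m a<b))
    tree-on (suc k) {a} {b} A≤a a<b b≤B ≤k ab with ℕ.m≤n⇒m<n∨m≡n a<b
    ... | inj₂ refl = leaf , refl , λ { refl → ab }
    ... | inj₁ 1+a<b
      -- Any vertex strictly between a and b can start `spanning`; a + 1 is one because (a , b) is
      -- not the side (a , a + 1).
      with (l , j , r) , refl , Δ ← triangle-at {suc a} (s≤s A≤a) (ℕ.<-≤-trans 1+a<b b≤B)
      with a≤l , r≤b ← inside ab ℕ.≤-refl 1+a<b Δ
      with m , isTriangle a<m m<b am mb _ ← spanning _ A≤a b≤B ab a≤l r≤b ℕ.≤-refl Δ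
      with l , refl , ⊆l ← tree-on k A≤a a<m (ℕ.≤-trans (ℕ.<⇒≤ m<b) b≤B)
             (ℕ.s≤s⁻¹ (ℕ.<-≤-trans (ℕ.∸-monoˡ-< m<b (ℕ.<⇒≤ a<m)) ≤k)) am
      with r , refl , ⊆r ← tree-on k (ℕ.≤-trans A≤a (ℕ.<⇒≤ a<m)) m<b b≤B
             (ℕ.s≤s⁻¹ (ℕ.<-≤-trans (ℕ.∸-monoʳ-< a<m (ℕ.<⇒≤ m<b)) ≤k)) mb =
      node l r , refl , λ { (inj₁ refl) → ab ; (inj₂ (inj₁ e)) → ⊆l e ; (inj₂ (inj₂ e)) → ⊆r e }

  -- Sublists of a fixed list as representatives of sets.

  allPairs-tabulate : ∀ {a ℓ} {A : Set a} {R : A → A → Set ℓ} xs →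
    (∀ {x y} → x ∈ xs → y ∈ xs → R x y) → AllPairs R xs
  allPairs-tabulate []       f = []
  allPairs-tabulate (x ∷ xs) f =
    All.tabulate (f (here refl) ∘ there) ∷ allPairs-tabulate xs (λ p q → f (there p) (there q))

  length-filter-map : ∀ {a b p} {A : Set a} {B : Set b} {P : B → Set p} (P? : Decidable P) (f : A → B) xs →
    length (filter P? (map f xs)) ≡ length (filter (P? ∘ f) xs)
  length-filter-map P? f []       = refl
  length-filter-map P? f (x ∷ xs) with P? (f x)
  ... | yes _ = cong suc (length-filter-map P? f xs)
  ... | no  _ = length-filter-map P? f xs

  map-injectiveOn : ∀ {a b} {A : Set a} {B : Set b} (f : A → B) {xs} → Unique xs →
    (∀ {x y} → x ∈ xs → y ∈ xs → f x ≡ f y → x ≡ y) → Unique (map f xs)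
  map-injectiveOn f {[]}     _           inj = []
  map-injectiveOn f {x ∷ xs} (x≢ ∷ xs!) inj =
    All.tabulate (λ fy∈ eq → let y , y∈ , fy≡ = ∈-map⁻ f fy∈ in
      All.lookup x≢ y∈ (inj (here refl) (there y∈) (trans eq fy≡)))
    ∷ map-injectiveOn f xs! (λ p q → inj (there p) (there q))

  module _ {A : Set} where

    sublists-⊆ : ∀ xs {ys : List A} → ys ∈ sublists xs → ∀ {y} → y ∈ ys → y ∈ xs
    sublists-⊆ []       (here refl) ()
    sublists-⊆ (x ∷ xs) ys∈ y∈ with ∈-++⁻ (map (x ∷_) (sublists xs)) ys∈
    ... | inj₂ ys∈′ = there (sublists-⊆ xs ys∈′ y∈)
    ... | inj₁ ys∈′ with ys , ys∈″ , refl ← ∈-map⁻ (x ∷_) ys∈′ with y∈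
    ...   | here refl = here refl
    ...   | there y∈′ = there (sublists-⊆ xs ys∈″ y∈′)

    sublists! : ∀ {xs : List A} → Unique xs → Unique (sublists xs)
    sublists! {[]}     _          = [] ∷ []
    sublists! {x ∷ xs} x∷xs!@(_ ∷ xs!) = Unique.++⁺ (Unique.map⁺ List.∷-injectiveʳ (sublists! xs!)) (sublists! xs!)
      λ { (ys∈ , ys∈′) → let _ , _ , ys≡ = ∈-map⁻ (x ∷_) ys∈ in
        Unique.Unique[x∷xs]⇒x∉xs x∷xs! (sublists-⊆ xs ys∈′ (subst (x ∈_) (sym ys≡) (here refl))) }

    module _ {p} {P : A → Set p} (P? : Decidable P) where

      filter∈sublists : ∀ xs → filter P? xs ∈ sublists xs
      filter∈sublists []       = here refl
      filter∈sublists (x ∷ xs) with P? x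
      ... | yes _ = ∈-++⁺ˡ (∈-map⁺ (x ∷_) (filter∈sublists xs))
      ... | no  _ = ∈-++⁺ʳ (map (x ∷_) (sublists xs)) (filter∈sublists xs)

      -- Triangulations are compared as lists, so a set of diagonals needs a normal form. A sublist
      -- keeps the order of the ambient list, hence is determined by its members.
      sublist≡filter : ∀ {xs ys} → Unique xs → ys ∈ sublists xs →
        (∀ {x} → x ∈ ys → P x) → (∀ {x} → x ∈ xs → P x → x ∈ ys) → ys ≡ filter P? xs
      sublist≡filter {[]}     _ (here refl) _ _ = refl
      sublist≡filter {x ∷ xs} x∷xs!@(x≢ ∷ xs!) ys∈ sound complete
        with ∈-++⁻ (map (x ∷_) (sublists xs)) ys∈
      ... | inj₂ ys∈′ = trans (sublist≡filter xs! ys∈′ sound (complete ∘ there))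
        (sym (List.filter-reject P? λ px →
          Unique.Unique[x∷xs]⇒x∉xs x∷xs! (sublists-⊆ xs ys∈′ (complete (here refl) px))))
      ... | inj₁ ys∈′ with ys , ys∈″ , refl ← ∈-map⁻ (x ∷_) ys∈′ =
        trans (cong (x ∷_) (sublist≡filter xs! ys∈″ (sound ∘ there) complete′))
          (sym (List.filter-accept P? (sound (here refl))))
        where
        complete′ : ∀ {y} → y ∈ xs → P y → y ∈ ys
        complete′ y∈ py with complete (there y∈) py
        ... | here refl = contradiction refl (All.lookup x≢ y∈)
        ... | there y∈ys = y∈ys

  -- The correspondence between trees and triangulations of the n-gon.

  sideℕ? : ∀ n ((x , y) : ℕ × ℕ) → Dec ((y ≡ suc x) ⊎ (x ≡ 0 × suc y ≡ n))
  sideℕ? n (x , y) = (y ℕ.≟ suc x) ⊎-dec ((x ℕ.≟ 0) ×-dec (suc y ℕ.≟ n))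

  edgesℕ : ℕ × ℕ × ℕ → List (ℕ × ℕ)
  edgesℕ (l , j , r) = (l , j) ∷ (j , r) ∷ (l , r) ∷ []

  earℕ? : ∀ n (Δ : ℕ × ℕ × ℕ) → Dec (2 ≤ length (filter (sideℕ? n) (edgesℕ Δ)))
  earℕ? n Δ = 2 ℕ.≤? length (filter (sideℕ? n) (edgesℕ Δ))

  module _ {n : ℕ} where

    toℕ² : Segment n → ℕ × ℕ
    toℕ² (i , j) = toℕ i , toℕ j

    toℕ³ : Triangle n → ℕ × ℕ × ℕ
    toℕ³ (l , j , r) = toℕ l , toℕ j , toℕ r

    toℕ²-injective : ∀ {e f} → toℕ² e ≡ toℕ² f → e ≡ f
    toℕ²-injective {_ , _} {_ , _} eq with p , q ← ,-injective eq =
      cong₂ _,_ (Fin.toℕ-injective p) (Fin.toℕ-injective q)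

    toℕ³-injective : ∀ {Δ Δ′} → toℕ³ Δ ≡ toℕ³ Δ′ → Δ ≡ Δ′
    toℕ³-injective {_ , _} {_ , _} eq with p , q ← ,-injective eq =
      cong₂ _,_ (Fin.toℕ-injective p) (toℕ²-injective q)

    -- With sides and chosen diagonals gathered in one set of pairs of numbers, the lemmas on
    -- `Noncrossing` and `IsTriangle` apply to D just as they do to a tree.
    EdgeOf : List (Segment n) → ℕ × ℕ → Set
    EdgeOf D p = ∃ λ e → toℕ² e ≡ p × (Side e ⊎ e ∈ D)

    diagonals! : Unique (diagonals n)
    diagonals! = Unique.filter⁺ _ (Unique.filter⁺ _ (Unique.cartesianProduct⁺ (Unique.allFin⁺ n) (Unique.allFin⁺ n)))

    ∈-diagonals⁺ : ∀ {i j : Fin n} → i Fin.< j → ¬ Side (i , j) → (i , j) ∈ diagonals n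
    ∈-diagonals⁺ i<j ¬side = ∈-filter⁺ _ (∈-filter⁺ _ (∈-cartesianProduct⁺ (∈-allFin _) (∈-allFin _)) i<j) ¬side

    ∈-diagonals⁻ : ∀ {i j : Fin n} → (i , j) ∈ diagonals n → i Fin.< j × ¬ Side (i , j)
    ∈-diagonals⁻ e∈ with e∈′ , ¬side ← ∈-filter⁻ _ {xs = segments n} e∈ =
      proj₂ (∈-filter⁻ _ {xs = cartesianProduct (allFin n) (allFin n)} e∈′) , ¬side

    triangles! : ∀ (D : List (Segment n)) → Unique (triangles D)
    triangles! D = Unique.filter⁺ _ (Unique.filter⁺ _
      (Unique.cartesianProduct⁺ (Unique.allFin⁺ n) (Unique.cartesianProduct⁺ (Unique.allFin⁺ n) (Unique.allFin⁺ n))))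

    triangles⁻ : ∀ {D Δ} → Δ ∈ triangles D → IsTriangle (EdgeOf D) (toℕ³ Δ)
    triangles⁻ {D} {l , j , r} Δ∈ with ∈-filter⁻ _ {xs = allTriangles n} Δ∈
    ... | Δ∈′ , lj ∷ jr ∷ lr ∷ []
      with l<j , j<r ← proj₂ (∈-filter⁻ _ {xs = cartesianProduct (allFin n) (cartesianProduct (allFin n) (allFin n))} Δ∈′) =
      isTriangle l<j j<r (_ , refl , lj) (_ , refl , jr) (_ , refl , lr)

    triangles⁺ : ∀ {D Δ} → IsTriangle (EdgeOf D) Δ → Δ ∈ map toℕ³ (triangles D)
    triangles⁺ {D} (isTriangle l<j j<r ((l , j) , refl , lj) ((j′ , r) , eq , jr) ((l″ , r″) , eq′ , lr))
      with e₁ , e₂ ← ,-injective eq | e₃ , e₄ ← ,-injective eq′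
      with refl ← Fin.toℕ-injective e₁ | refl ← e₂
      with refl ← Fin.toℕ-injective e₃ | refl ← Fin.toℕ-injective e₄ =
      ∈-map⁺ toℕ³ (∈-filter⁺ _ (∈-filter⁺ _
        (∈-cartesianProduct⁺ (∈-allFin _) (∈-cartesianProduct⁺ (∈-allFin _) (∈-allFin _))) (l<j , j<r))
        (lj ∷ jr ∷ lr ∷ []))

    -- A side takes part in no crossing: no vertex lies strictly between i and i + 1, none before
    -- the first and none after the last.
    edgeOf-noncrossing : ∀ {D} → AllPairs (λ e f → ¬ Crossing e f) D → Noncrossing (EdgeOf D)
    edgeOf-noncrossing nc ((a , b) , refl , inj₁ (inj₁ eq)) (_ , refl , _) (a<c , c<b , _) =
      ℕ.<⇒≱ a<c (ℕ.s≤s⁻¹ (subst (_ <_) eq c<b))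
    edgeOf-noncrossing nc ((a , b) , refl , inj₁ (inj₂ (_ , eq))) ((c , d) , refl , _) (_ , _ , b<d) =
      ℕ.<⇒≱ b<d (ℕ.s≤s⁻¹ (subst (toℕ d <_) (sym eq) (Fin.toℕ<n d)))
    edgeOf-noncrossing nc (_ , refl , inj₂ _) ((c , d) , refl , inj₁ (inj₁ eq)) (_ , c<b , b<d) =
      ℕ.<⇒≱ c<b (ℕ.s≤s⁻¹ (subst (_ <_) eq b<d))
    edgeOf-noncrossing nc (_ , refl , inj₂ _) ((c , d) , refl , inj₁ (inj₂ (eq , _))) (a<c , _) =
      contradiction (subst (_ <_) eq a<c) ℕ.n≮0
    edgeOf-noncrossing nc (e , refl , inj₂ e∈) (f , refl , inj₂ f∈) cr@(a<c , _) with ∈-AllPairs₂ nc e∈ f∈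
    ... | inj₁ refl     = ℕ.<-irrefl refl a<c
    ... | inj₂ (inj₁ p) = p (inj₁ cr)
    ... | inj₂ (inj₂ p) = p (inj₂ cr)

    𝒮≡ : ∀ (D : List (Segment n)) {Δs} → map toℕ³ (triangles D) ↭ Δs → 𝒮 D ≡ length (filter (earℕ? n) Δs)
    𝒮≡ D {Δs} perm = begin
      length (filter ear? (triangles D))                   ≡⟨ cong length (List.filter-≐ ear? (earℕ? n ∘ toℕ³) ((λ {Δ} → ⇒ Δ) , (λ {Δ} → ⇐ Δ)) (triangles D)) ⟩
      length (filter (earℕ? n ∘ toℕ³) (triangles D))       ≡⟨ length-filter-map (earℕ? n) toℕ³ (triangles D) ⟨
      length (filter (earℕ? n) (map toℕ³ (triangles D)))   ≡⟨ ↭-length (filter-↭ (earℕ? n) perm) ⟩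
      length (filter (earℕ? n) Δs)                         ∎
      where
      open ≡-Reasoning
      sides≡ : ∀ Δ → length (filter side? (edges Δ)) ≡ length (filter (sideℕ? n) (edgesℕ (toℕ³ Δ)))
      sides≡ Δ = sym (length-filter-map (sideℕ? n) toℕ² (edges Δ))
      ⇒ : ∀ Δ → Ear Δ → 2 ≤ length (filter (sideℕ? n) (edgesℕ (toℕ³ Δ)))
      ⇒ Δ = subst (2 ≤_) (sides≡ Δ)
      ⇐ : ∀ Δ → 2 ≤ length (filter (sideℕ? n) (edgesℕ (toℕ³ Δ))) → Ear Δ
      ⇐ Δ = subst (2 ≤_) (sym (sides≡ Δ))

  -- Filtering the list of all diagonals, instead of converting `inner t 0`, gives a member of
  -- `sublists (diagonals n)` in the normal form of `sublist≡filter`.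
  diagonalsOf : ∀ n → Tree → List (Segment n)
  diagonalsOf n t = filter (λ e → edge? t 0 (toℕ² e)) (diagonals n)

  ∈-diagonalsOf⁻ : ∀ {n t e} → e ∈ diagonalsOf n t → e ∈ diagonals n × Edge t 0 (toℕ² e)
  ∈-diagonalsOf⁻ {n} = ∈-filter⁻ _ {xs = diagonals n}

  module _ (t : Tree) {n : ℕ} (end≡ : suc (end t 0) ≡ n) where

    edgeOf⇒edge : ∀ {p} → EdgeOf (diagonalsOf n t) p → Edge t 0 p
    edgeOf⇒edge ((i , j) , refl , inj₁ (inj₁ eq)) = subst (λ y → Edge t 0 (toℕ i , y)) (sym eq)
      (side-edge t z≤n (ℕ.s≤s⁻¹ (subst₂ _≤_ (cong suc eq) (sym end≡) (Fin.toℕ<n j))))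
    edgeOf⇒edge ((i , j) , refl , inj₁ (inj₂ (eq , eq′))) = subst₂ (λ x y → Edge t 0 (x , y)) (sym eq)
      (ℕ.suc-injective (trans end≡ (sym eq′))) (root t 0)
    edgeOf⇒edge (e , refl , inj₂ e∈) = proj₂ (∈-diagonalsOf⁻ {n} {t} e∈)

    edge⇒edgeOf : ∀ {p} → Edge t 0 p → EdgeOf (diagonalsOf n t) p
    edge⇒edgeOf {x , y} e = (i , j) , eq , member
      where
      y<n : y < n
      y<n = subst (y <_) end≡ (s≤s (proj₂ (proj₂ (edge-bounds t e))))
      x<y : x < y
      x<y = proj₁ (proj₂ (edge-bounds t e))
      i = fromℕ< (ℕ.<-trans x<y y<n)
      j = fromℕ< y<n
      eq : toℕ² (i , j) ≡ (x , y)
      eq = cong₂ _,_ (Fin.toℕ-fromℕ< _) (Fin.toℕ-fromℕ< _)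
      member : Side (i , j) ⊎ (i , j) ∈ diagonalsOf n t
      member with side? (i , j)
      ... | yes s = inj₁ s
      ... | no ¬s = inj₂ (∈-filter⁺ _ (∈-diagonals⁺ (subst₂ _<_ (sym (Fin.toℕ-fromℕ< _)) (sym (Fin.toℕ-fromℕ< _)) x<y) ¬s)
        (subst (Edge t 0) (sym eq) e))

    private
      mapTriangle : ∀ {E F : ℕ × ℕ → Set} → (∀ {p} → E p → F p) → ∀ {Δ} → IsTriangle E Δ → IsTriangle F Δ
      mapTriangle f (isTriangle p q lj jr lr) = isTriangle p q (f lj) (f jr) (f lr)

    triangles↭faces : map toℕ³ (triangles (diagonalsOf n t)) ↭ faces t 0
    triangles↭faces = unique∧⇔⇒↭ (Unique.map⁺ toℕ³-injective (triangles! (diagonalsOf n t))) (faces! t 0)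
      (λ Δ∈ → let _ , Δ∈′ , eq = ∈-map⁻ toℕ³ Δ∈ in
        triangle⇒face t (subst (IsTriangle (Edge t 0)) (sym eq) (mapTriangle edgeOf⇒edge (triangles⁻ Δ∈′))))
      (λ Δ∈ → triangles⁺ (mapTriangle edge⇒edgeOf (face⇒triangle t Δ∈)))

    𝒮-diagonalsOf : 𝒮 (diagonalsOf n t) ≡ length (filter (earℕ? n) (faces t 0))
    𝒮-diagonalsOf = 𝒮≡ (diagonalsOf n t) triangles↭faces

    diagonalsOf↭inner : map toℕ² (diagonalsOf n t) ↭ inner t 0
    diagonalsOf↭inner = unique∧⇔⇒↭ (Unique.map⁺ toℕ²-injective (Unique.filter⁺ _ diagonals!)) (inner! t 0) to from
      where
      to : ∀ {p} → p ∈ map toℕ² (diagonalsOf n t) → p ∈ inner t 0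
      to p∈ with (i , j) , e∈ , refl ← ∈-map⁻ toℕ² p∈
        with e∈′ , e ← ∈-diagonalsOf⁻ {n} {t} e∈
        with _ , ¬side ← ∈-diagonals⁻ e∈′ =
        chord⇒inner t (edge⇒chord t e (¬side ∘ inj₁)) λ eq → let eq₁ , eq₂ = ,-injective eq in
          ¬side (inj₂ (eq₁ , trans (cong suc eq₂) end≡))
      from : ∀ {p} → p ∈ inner t 0 → p ∈ map toℕ² (diagonalsOf n t)
      from {x , y} p∈ with edge , y≢ ← chord⇒edge t (inner⇒chord t p∈) with edge⇒edgeOf edge
      ... | e , refl , inj₂ e∈ = ∈-map⁺ toℕ² e∈
      ... | e , refl , inj₁ (inj₁ eq) = contradiction eq y≢
      ... | e , refl , inj₁ (inj₂ (eq₁ , eq₂)) =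
        contradiction (cong₂ _,_ eq₁ (ℕ.suc-injective (trans eq₂ (sym end≡)))) (inner-≢ t p∈)

    private
      n∸2≡ : n ∸ 2 ≡ size t
      n∸2≡ = cong (_∸ 2) (trans (sym end≡) (cong suc (end≡+size t 0)))

    diagonalsOf-triangulation : IsTriangulation n (diagonalsOf n t)
    diagonalsOf-triangulation =
      allPairs-tabulate (diagonalsOf n t) nc ,
      trans (trans (sym (List.length-map toℕ² (diagonalsOf n t))) (↭-length diagonalsOf↭inner))
        (trans (length-inner t 0) (trans (cong (_∸ 1) (sym n∸2≡)) (ℕ.∸-+-assoc n 2 1))) ,
      trans (trans (sym (List.length-map toℕ³ (triangles (diagonalsOf n t)))) (↭-length triangles↭faces))
        (trans (length-faces t 0) (sym n∸2≡))
      where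
      nc : ∀ {e f} → e ∈ diagonalsOf n t → f ∈ diagonalsOf n t → ¬ Crossing e f
      nc e∈ f∈ (inj₁ cr) = edge-noncrossing t 0 (proj₂ (∈-diagonalsOf⁻ {n} {t} e∈)) (proj₂ (∈-diagonalsOf⁻ {n} {t} f∈)) cr
      nc e∈ f∈ (inj₂ cr) = edge-noncrossing t 0 (proj₂ (∈-diagonalsOf⁻ {n} {t} f∈)) (proj₂ (∈-diagonalsOf⁻ {n} {t} e∈)) cr

  diagonalsOf-injective : ∀ {n t t′} → suc (end t 0) ≡ n → suc (end t′ 0) ≡ n → diagonalsOf n t ≡ diagonalsOf n t′ → t ≡ t′
  diagonalsOf-injective {n} {t} {t′} eq eq′ D≡D′ = edge⊆⇒≡ t t′ (ℕ.suc-injective (trans eq (sym eq′)))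
    λ e → edgeOf⇒edge t′ eq′ (subst (λ D → EdgeOf D _) D≡D′ (edge⇒edgeOf t eq e))

  -- n − 2 triangles with distinct middle vertices use up all the vertices
  -- other than the two extreme ones.
  triangulation⇒tree : ∀ {m} {D : List (Segment (suc (suc m)))} → D ∈ sublists (diagonals (suc (suc m))) →
    IsTriangulation (suc (suc m)) D → ∃ λ t → size t ≡ m × D ≡ diagonalsOf (suc (suc m)) t
  triangulation⇒tree {m} {D} D∈ (ncD , length-D , length-triangles) =
    t , ℕ.suc-injective (trans (sym (end≡+size t 0)) end-t) ,
    sublist≡filter (λ e → edge? t 0 (toℕ² e)) diagonals! D∈
      (λ e∈ → proj₂ (∈-diagonalsOf⁻ {n} {t} (D⊆ e∈)))
      (λ e∈ e → t⊆D (∈-filter⁺ _ e∈ e))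
    where
    n = suc (suc m)
    nc = edgeOf-noncrossing ncD
    middles = map (middle ∘ toℕ³) (triangles D)
    middles! : Unique middles
    middles! = map-injectiveOn (middle ∘ toℕ³) (triangles! D) λ Δ∈ Δ′∈ eq →
      toℕ³-injective (middle-injective nc (triangles⁻ Δ∈) (triangles⁻ Δ′∈) eq)
    middles⊆ : ∀ {j} → j ∈ middles → j ∈ applyUpTo suc m
    middles⊆ j∈ with (l , j , r) , Δ∈ , refl ← ∈-map⁻ (middle ∘ toℕ³) j∈
      with isTriangle l<j j<r _ _ _ ← triangles⁻ Δ∈ =
      range (ℕ.≤-<-trans z≤n l<j) (ℕ.<-≤-trans j<r (ℕ.s≤s⁻¹ (Fin.toℕ<n r)))
      where
      range : ∀ {k} → 0 < k → k < suc m → k ∈ applyUpTo suc m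
      range {suc _} _ (s≤s k<m) = ∈-applyUpTo⁺ suc k<m
    triangle-at : ∀ {j} → 0 < j → j < suc m → ∃ λ Δ → middle Δ ≡ j × IsTriangle (EdgeOf D) Δ
    triangle-at {suc j} _ (s≤s j<m)
      with Δ , Δ∈ , eq ← ∈-map⁻ (middle ∘ toℕ³) (⊆∧length≥⇒⊇ middles! middles⊆
             (ℕ.≤-reflexive (trans (List.length-applyUpTo suc m)
               (sym (trans (List.length-map (middle ∘ toℕ³) (triangles D)) length-triangles))))
             (∈-applyUpTo⁺ suc j<m)) = toℕ³ Δ , sym eq , triangles⁻ Δ∈
    0-n : EdgeOf D (0 , suc m)
    0-n = (Fin.zero , Fin.fromℕ (suc m)) , cong (0 ,_) (Fin.toℕ-fromℕ (suc m)) ,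
      inj₁ (inj₂ (refl , cong suc (Fin.toℕ-fromℕ (suc m))))
    tree = tree-on nc triangle-at (suc m) ℕ.≤-refl (s≤s z≤n) ℕ.≤-refl ℕ.≤-refl 0-n
    t = proj₁ tree
    end-t : end t 0 ≡ suc m
    end-t = proj₁ (proj₂ tree)
    t⊆D : ∀ {e} → e ∈ diagonalsOf n t → e ∈ D
    t⊆D {e} e∈ with e∈′ , edge ← ∈-diagonalsOf⁻ {n} {t} e∈ with proj₂ (proj₂ tree) edge
    ... | f , eq , inj₂ f∈ with refl ← toℕ²-injective {e = e} {f} (sym eq) = f∈
    ... | f , eq , inj₁ s  with refl ← toℕ²-injective {e = e} {f} (sym eq) =
      contradiction s (proj₂ (∈-diagonals⁻ e∈′))
    -- The diagonals of the tree belong to D, and both lists have n - 3 members, so D has no others.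
    D⊆ : ∀ {e} → e ∈ D → e ∈ diagonalsOf n t
    D⊆ = ⊆∧length≥⇒⊇ (Unique.filter⁺ _ diagonals!) t⊆D (ℕ.≤-reflexive
      (trans length-D (sym (proj₁ (proj₂ (diagonalsOf-triangulation t (cong suc end-t)))))))

  triangulations↭ : ∀ {m ts} → Unique ts → (∀ {t} → size t ≡ m → t ∈ ts) → (∀ {t} → t ∈ ts → size t ≡ m) →
    triangulations (suc (suc m)) ↭ map (diagonalsOf (suc (suc m))) ts
  triangulations↭ {m} {ts} ts! complete sound = unique∧⇔⇒↭
    (Unique.filter⁺ _ (sublists! diagonals!))
    (map-injectiveOn _ ts! λ {t} {t′} t∈ t′∈ → diagonalsOf-injective {n} {t} {t′} (end≡ t∈) (end≡ t′∈))
    (λ D∈ → let D∈′ , tri = ∈-filter⁻ _ {xs = sublists (diagonals n)} D∈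
                t , size≡ , D≡ = triangulation⇒tree D∈′ tri
            in subst (_∈ map (diagonalsOf n) ts) (sym D≡) (∈-map⁺ _ (complete size≡)))
    (λ D∈ → let t , t∈ , D≡ = ∈-map⁻ _ D∈ in subst (_∈ triangulations n) (sym D≡)
      (∈-filter⁺ _ (filter∈sublists _ (diagonals n)) (diagonalsOf-triangulation t (end≡ t∈))))
    where
    n = suc (suc m)
    end≡ : ∀ {t} → t ∈ ts → suc (end t 0) ≡ n
    end≡ {t} t∈ = cong suc (trans (end≡+size t 0) (cong suc (sound t∈)))

  -- Ears read off from the tree.

  cherry : Tree → Tree → ℕ
  cherry leaf leaf = 1
  cherry _    _    = 0

  cherries : Tree → ℕ
  cherries leaf       = 0
  cherries (node l r) = cherry l r + (cherries l + cherries r)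

  isLeaf : Tree → ℕ
  isLeaf leaf       = 1
  isLeaf (node _ _) = 0

  module _ {n : ℕ} where

    private
      sideCount : List (ℕ × ℕ) → ℕ
      sideCount es = length (filter (sideℕ? n) es)

    -- The disjunction says that (a , `end t a`) is not the side joining the first and last
    -- vertices; only a leaf can then contribute a side.
    sideCount-leaf : ∀ t {a} es → suc (end t a) ≤ n → 0 < a ⊎ suc (end t a) < n →
      sideCount ((a , end t a) ∷ es) ≡ isLeaf t + sideCount es
    sideCount-leaf leaf       {a} es _ _ = cong length (List.filter-accept (sideℕ? n) {a , suc a} {es} (inj₁ refl))
    sideCount-leaf (node l r) {a} es b≤n proper = cong length (List.filter-reject (sideℕ? n) {a , end (node l r) a} {es} (¬side proper))
      where
      ¬side : 0 < a ⊎ suc (end (node l r) a) < n →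
        ¬ (end (node l r) a ≡ suc a ⊎ (a ≡ 0 × suc (end (node l r) a) ≡ n))
      ¬side _          (inj₁ eq)         = ℕ.<-irrefl (sym eq) (ℕ.≤-trans (s≤s (a<end l a)) (a<end r (end l a)))
      ¬side (inj₁ 0<a) (inj₂ (refl , _)) = ℕ.n≮0 0<a
      ¬side (inj₂ b<n) (inj₂ (_ , eq))   = ℕ.<-irrefl eq b<n

    -- Away from the side joining the first and last vertices, the sides of a triangle come from its
    -- leaf children alone, so two of them mean a cherry.
    count-ears : ∀ t {a} → suc (end t a) ≤ n → 0 < a ⊎ suc (end t a) < n →
      length (filter (earℕ? n) (faces t a)) ≡ cherries t

    sideCount-children : ∀ l r {a} es → suc (end (node l r) a) ≤ n →
      sideCount ((a , end l a) ∷ (end l a , end (node l r) a) ∷ es) ≡ isLeaf l + (isLeaf r + sideCount es)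
    sideCount-children l r {a} es b≤n =
      trans (sideCount-leaf l ((end l a , end (node l r) a) ∷ es) (ℕ.<⇒≤ m<n) (inj₂ m<n))
        (cong (isLeaf l +_) (sideCount-leaf r es b≤n (inj₁ (ℕ.≤-<-trans z≤n (a<end l a)))))
      where
      m<n : suc (end l a) < n
      m<n = ℕ.≤-trans (s≤s (a<end r (end l a))) b≤n

    count-children : ∀ l r {a} → suc (end (node l r) a) ≤ n →
      length (filter (earℕ? n) (faces l a ++ faces r (end l a))) ≡ cherries l + cherries r
    count-children l r {a} b≤n = trans (cong length (List.filter-++ (earℕ? n) (faces l a) (faces r (end l a))))
      (trans (List.length-++ (filter (earℕ? n) (faces l a)))
        (cong₂ _+_ (count-ears l (ℕ.<⇒≤ m<n) (inj₂ m<n)) (count-ears r b≤n (inj₁ (ℕ.≤-<-trans z≤n (a<end l a))))))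
      where
      m<n : suc (end l a) < n
      m<n = ℕ.≤-trans (s≤s (a<end r (end l a))) b≤n

    count-accept : ∀ Δ Δs → 2 ≤ sideCount (edgesℕ Δ) →
      length (filter (earℕ? n) (Δ ∷ Δs)) ≡ suc (length (filter (earℕ? n) Δs))
    count-accept Δ Δs ear = cong length (List.filter-accept (earℕ? n) {Δ} {Δs} ear)

    count-reject : ∀ Δ Δs → sideCount (edgesℕ Δ) ≤ 1 →
      length (filter (earℕ? n) (Δ ∷ Δs)) ≡ length (filter (earℕ? n) Δs)
    count-reject Δ Δs ¬ear = cong length (List.filter-reject (earℕ? n) {Δ} {Δs} (λ ear → ℕ.<⇒≱ ear ¬ear))

    count-ears leaf _ _ = refl
    count-ears t@(node l r) {a} b≤n proper = trans (aux l r (a , end l a , end t a) (faces l a ++ faces r (end l a)) sides) (cong (cherry l r +_) (count-children l r b≤n))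
      where
      sides : sideCount (edgesℕ (a , end l a , end t a)) ≡ isLeaf l + (isLeaf r + 0)
      sides = trans (sideCount-children l r ((a , end t a) ∷ []) b≤n)
        (cong (λ k → isLeaf l + (isLeaf r + k)) (sideCount-leaf t [] b≤n proper))
      aux : ∀ l r Δ Δs → sideCount (edgesℕ Δ) ≡ isLeaf l + (isLeaf r + 0) →
        length (filter (earℕ? n) (Δ ∷ Δs)) ≡ cherry l r + length (filter (earℕ? n) Δs)
      aux leaf       leaf       Δ Δs eq = count-accept Δ Δs (ℕ.≤-reflexive (sym eq))
      aux leaf       (node _ _) Δ Δs eq = count-reject Δ Δs (ℕ.≤-reflexive eq)
      aux (node _ _) leaf       Δ Δs eq = count-reject Δ Δs (ℕ.≤-reflexive eq)
      aux (node _ _) (node _ _) Δ Δs eq = count-reject Δ Δs (ℕ.≤-trans (ℕ.≤-reflexive eq) z≤n)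

  -- The root triangle also has the side joining the first and last vertices.
  ears : Tree → ℕ
  ears leaf       = 0
  ears (node l r) = (isLeaf l + isLeaf r) + (cherries l + cherries r)

  -- From size 2 on at most one child of the root is a leaf, and together with the side below the
  -- root it makes one ear. At size 1 the two leaves would count the single triangle twice.
  𝒮≡ears : ∀ t {n} → suc (end t 0) ≡ n → 2 ≤ size t → 𝒮 (diagonalsOf n t) ≡ ears t
  𝒮≡ears t@(node l r) {n} refl 2≤size = trans (𝒮-diagonalsOf t refl)
    (trans (aux l r (0 , end l 0 , end t 0) (faces l 0 ++ faces r (end l 0)) 2≤size sides) (cong (isLeaf l + isLeaf r +_) (count-children l r ℕ.≤-refl)))
    where
    sides : length (filter (sideℕ? n) (edgesℕ (0 , end l 0 , end t 0))) ≡ isLeaf l + (isLeaf r + 1)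
    sides = trans (sideCount-children l r ((0 , end t 0) ∷ []) ℕ.≤-refl)
      (cong (λ k → isLeaf l + (isLeaf r + k))
        (cong length (List.filter-accept (sideℕ? n) {0 , end t 0} {[]} (inj₂ (refl , refl)))))
    aux : ∀ l r Δ Δs → 2 ≤ size (node l r) → length (filter (sideℕ? n) (edgesℕ Δ)) ≡ isLeaf l + (isLeaf r + 1) →
      length (filter (earℕ? n) (Δ ∷ Δs)) ≡ (isLeaf l + isLeaf r) + length (filter (earℕ? n) Δs)
    aux leaf       leaf       Δ Δs (s≤s ()) eq
    aux leaf       (node _ _) Δ Δs _ eq = count-accept Δ Δs (ℕ.≤-reflexive (sym eq))
    aux (node _ _) leaf       Δ Δs _ eq = count-accept Δ Δs (ℕ.≤-reflexive (sym eq))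
    aux (node _ _) (node _ _) Δ Δs _ eq = count-reject Δ Δs (ℕ.≤-reflexive eq)

open Polygon

open import Algebra.Bundles using (AbelianGroup; CommutativeMonoid; CommutativeRing)
import Algebra.Construct.DirectProduct as DirectProduct
open import Algebra.Morphism.Structures using (module RingMorphisms)
import Algebra.Solver.Ring.NaturalCoefficients.Default as NaturalCoefficients
import Data.Integer as ℤ
open import Data.List using (List; []; _∷_; _++_; map; length; concat; applyUpTo; cartesianProductWith; upTo)
open import Data.List.Membership.Propositional using (_∈_)
open import Data.List.Membership.Propositional.Properties
  using (∈-concat⁺′; ∈-concat⁻′; ∈-applyUpTo⁺; ∈-applyUpTo⁻; ∈-cartesianProductWith⁺; ∈-cartesianProductWith⁻)
import Data.List.Properties as List
open import Data.List.Relation.Binary.Permutation.Propositional as ↭ using (_↭_)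
open import Data.List.Relation.Binary.Permutation.Propositional.Properties using (↭-length)
open import Data.List.Relation.Unary.All using ([]; _∷_)
import Data.List.Relation.Unary.All.Properties as All
open import Data.List.Relation.Unary.AllPairs using ([]; _∷_)
import Data.List.Relation.Unary.AllPairs.Properties as AllPairs
open import Data.List.Relation.Unary.Any using (here; there)
open import Data.List.Relation.Unary.Unique.Propositional using (Unique)
import Data.List.Relation.Unary.Unique.Propositional.Properties as Unique
open import Data.Nat as ℕ using (ℕ; zero; suc; z≤n; s≤s)
open import Data.Nat.Combinatorics using (_C_; nCk+nC[k+1]≡[n+1]C[k+1]; k>n⇒nCk≡0; nC1≡n)
import Data.Nat.Properties as ℕ
import Data.Nat.Solver as ℕSolver
open import Data.Product using (_×_; _,_; proj₁; proj₂)
open import Data.Rational as ℚ using (ℚ; 1ℚ)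
import Data.Rational.Properties as ℚ
open import Function using (_∘_; const)
open import Relation.Binary.PropositionalEquality as ≡ using (_≡_)

-- All trees of size m, provided that m is at most the first argument.
trees : ℕ → ℕ → List Tree
splits : ℕ → ℕ → ℕ → List Tree

trees _       zero    = leaf ∷ []
trees zero    (suc m) = []
trees (suc f) (suc m) = concat (applyUpTo (splits f m) (suc m))

splits f m i = cartesianProductWith node (trees f i) (trees f (m ℕ.∸ i))

trees-size : ∀ f m {t} → t ∈ trees f m → size t ≡ m
trees-size _       zero    (here ≡.refl) = ≡.refl
trees-size (suc f) (suc m) t∈
  with _ , t∈′ , ∈ts ← ∈-concat⁻′ (applyUpTo (splits f m) (suc m)) t∈
  with i , i<1+m , ≡.refl ← ∈-applyUpTo⁻ (splits f m) ∈ts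
  with l , r , l∈ , r∈ , ≡.refl ← ∈-cartesianProductWith⁻ node (trees f i) (trees f (m ℕ.∸ i)) t∈′ =
  ≡.cong suc (≡.trans (≡.cong₂ ℕ._+_ (trees-size f i l∈) (trees-size f (m ℕ.∸ i) r∈)) (ℕ.m+[n∸m]≡n (ℕ.s≤s⁻¹ i<1+m)))

∈-trees : ∀ t {f} → size t ℕ.≤ f → t ∈ trees f (size t)
∈-trees leaf       _ = here ≡.refl
∈-trees (node l r) {suc f} (s≤s ≤f) = ∈-concat⁺′
  (∈-cartesianProductWith⁺ node
    (∈-trees l (ℕ.≤-trans (ℕ.m≤m+n (size l) (size r)) ≤f))
    (≡.subst (λ k → r ∈ trees f k) (≡.sym (ℕ.m+n∸m≡n (size l) (size r)))
      (∈-trees r (ℕ.≤-trans (ℕ.m≤n+m (size r) (size l)) ≤f))))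
  (∈-applyUpTo⁺ (splits f _) (s≤s (ℕ.m≤m+n (size l) (size r))))

-- Blocks with different i are disjoint because i is the size of the left subtree.
trees! : ∀ f m → Unique (trees f m)
trees! _       zero    = [] ∷ []
trees! zero    (suc m) = []
trees! (suc f) (suc m) = Unique.concat⁺
  (All.applyUpTo⁺₂ (splits f m) (suc m) λ i →
    Unique.cartesianProductWith⁺ node (λ { ≡.refl → ≡.refl , ≡.refl }) (trees! f i) (trees! f (m ℕ.∸ i)))
  (AllPairs.applyUpTo⁺₁ (splits f m) (suc m) λ {i} {j} i<j _ (t∈ , t∈′) → ℕ.<⇒≢ i<j (same i j t∈ t∈′))
  where
  same : ∀ i j {t} → t ∈ splits f m i → t ∈ splits f m j → i ≡ j
  same i j t∈ t∈′
    with l , r , l∈ , _ , ≡.refl ← ∈-cartesianProductWith⁻ node (trees f i) (trees f (m ℕ.∸ i)) t∈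
    with _ , _ , l∈′ , _ , ≡.refl ← ∈-cartesianProductWith⁻ node (trees f j) (trees f (m ℕ.∸ j)) t∈′ =
    ≡.trans (≡.sym (trees-size f i l∈)) (trees-size f j l∈′)

-- Finite sums and Cauchy products over a ℚ-algebra.

module Convolution {c ℓ} (A : ℚ-Algebra c ℓ) where
  open ℚ-Algebra A
  open import Relation.Binary.Reasoning.Setoid setoid
  open NaturalCoefficients commutativeSemiring using (solve; _:=_; _:+_; _:*_; con)

  Seq : Set c
  Seq = ℕ → Carrier

  Σ : ℕ → Seq → Carrier
  Σ zero    f = 0#
  Σ (suc n) f = f 0 + Σ n (f ∘ suc)

  Σ-cong : ∀ n {f g : Seq} → (∀ {i} → i ℕ.< n → f i ≈ g i) → Σ n f ≈ Σ n g
  Σ-cong zero    f≈g = refl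
  Σ-cong (suc n) f≈g = +-cong (f≈g (s≤s z≤n)) (Σ-cong n (f≈g ∘ s≤s))

  Σ-last : ∀ n f → Σ (suc n) f ≈ Σ n f + f n
  Σ-last zero    f = +-comm _ _
  Σ-last (suc n) f = trans (+-congˡ (Σ-last n (f ∘ suc))) (sym (+-assoc _ _ _))

  Σ-+ : ∀ n f g → Σ n (λ i → f i + g i) ≈ Σ n f + Σ n g
  Σ-+ zero    f g = sym (+-identityˡ 0#)
  Σ-+ (suc n) f g = trans (+-congˡ (Σ-+ n (f ∘ suc) (g ∘ suc)))
    (solve 4 (λ a b c d → ((a :+ b) :+ (c :+ d)) := ((a :+ c) :+ (b :+ d))) refl _ _ _ _)

  Σ-* : ∀ n x f → Σ n (λ i → x * f i) ≈ x * Σ n f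
  Σ-* zero    x f = sym (zeroʳ x)
  Σ-* (suc n) x f = trans (+-congˡ (Σ-* n x (f ∘ suc))) (sym (distribˡ x _ _))

  Σ-0 : ∀ n {f} → (∀ i → f i ≈ 0#) → Σ n f ≈ 0#
  Σ-0 zero    f≈0 = refl
  Σ-0 (suc n) f≈0 = trans (+-cong (f≈0 0) (Σ-0 n (f≈0 ∘ suc))) (+-identityˡ 0#)

  sum-++ : ∀ xs ys → sum A (xs ++ ys) ≈ sum A xs + sum A ys
  sum-++ []       ys = sym (+-identityˡ _)
  sum-++ (x ∷ xs) ys = trans (+-congˡ (sum-++ xs ys)) (sym (+-assoc _ _ _))

  sum-applyUpTo : ∀ f n → sum A (applyUpTo f n) ≡ Σ n f
  sum-applyUpTo f zero    = ≡.refl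
  sum-applyUpTo f (suc n) = ≡.cong (f 0 +_) (sum-applyUpTo (f ∘ suc) n)

  sum-upTo : ∀ f n → sum A (map f (upTo n)) ≡ Σ n f
  sum-upTo f n = ≡.trans (≡.cong (sum A) (List.map-upTo f n)) (sum-applyUpTo f n)

  module _ {X : Set} where

    sum-↭ : ∀ (f : X → Carrier) {xs ys} → xs ↭ ys → sum A (map f xs) ≈ sum A (map f ys)
    sum-↭ f ↭.refl         = refl
    sum-↭ f (↭.prep x p)   = +-congˡ (sum-↭ f p)
    sum-↭ f (↭.swap x y p) = trans (+-congˡ (+-congˡ (sum-↭ f p)))
      (solve 3 (λ a b c → (a :+ (b :+ c)) := (b :+ (a :+ c))) refl _ _ _)
    sum-↭ f (↭.trans p q)  = trans (sum-↭ f p) (sum-↭ f q)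

    sum-cong : ∀ {f g : X → Carrier} xs → (∀ {x} → x ∈ xs → f x ≈ g x) → sum A (map f xs) ≈ sum A (map g xs)
    sum-cong []       f≈g = refl
    sum-cong (x ∷ xs) f≈g = +-cong (f≈g (here ≡.refl)) (sum-cong xs (f≈g ∘ there))

    sum-concat : ∀ (h : X → Carrier) F n →
      sum A (map h (concat (applyUpTo F n))) ≈ Σ n (λ i → sum A (map h (F i)))
    sum-concat h F zero    = refl
    sum-concat h F (suc n) = trans (reflexive (≡.cong (sum A) (List.map-++ h (F 0) _)))
      (trans (sum-++ (map h (F 0)) _) (+-congˡ (sum-concat h (F ∘ suc) n)))

  sum-*ˡ : ∀ {X : Set} x (f : X → Carrier) xs → sum A (map (λ y → x * f y) xs) ≈ x * sum A (map f xs)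
  sum-*ˡ x f []       = sym (zeroʳ x)
  sum-*ˡ x f (y ∷ ys) = trans (+-congˡ (sum-*ˡ x f ys)) (sym (distribˡ x _ _))

  sum-product : ∀ {X Y Z : Set} (_∙_ : X → Y → Z) (h : Z → Carrier) (f : X → Carrier) (g : Y → Carrier) xs ys →
    (∀ {x y} → x ∈ xs → y ∈ ys → h (x ∙ y) ≈ f x * g y) →
    sum A (map h (cartesianProductWith _∙_ xs ys)) ≈ sum A (map f xs) * sum A (map g ys)
  sum-product _∙_ h f g []       ys h≈ = sym (zeroˡ _)
  sum-product _∙_ h f g (x ∷ xs) ys h≈ = begin
    sum A (map h (map (x ∙_) ys ++ cartesianProductWith _∙_ xs ys))
      ≈⟨ reflexive (≡.cong (sum A) (List.map-++ h (map (x ∙_) ys) _)) ⟩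
    sum A (map h (map (x ∙_) ys) ++ map h (cartesianProductWith _∙_ xs ys))
      ≈⟨ sum-++ (map h (map (x ∙_) ys)) _ ⟩
    sum A (map h (map (x ∙_) ys)) + sum A (map h (cartesianProductWith _∙_ xs ys))
      ≈⟨ +-cong (reflexive (≡.cong (sum A) (≡.sym (List.map-∘ ys))))
                (sum-product _∙_ h f g xs ys (h≈ ∘ there)) ⟩
    sum A (map (λ y → h (x ∙ y)) ys) + sum A (map f xs) * sum A (map g ys)
      ≈⟨ +-congʳ (trans (sum-cong ys (h≈ (here ≡.refl))) (sum-*ˡ (f x) g ys)) ⟩
    f x * sum A (map g ys) + sum A (map f xs) * sum A (map g ys)
      ≈⟨ distribʳ _ _ _ ⟨
    (f x + sum A (map f xs)) * sum A (map g ys) ∎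

  conv : Seq → Seq → Seq
  conv f g m = Σ (suc m) (λ i → f i * g (m ℕ.∸ i))

  -- Splitting at the root gives a Cauchy product. Factorisation is asked for only at the size in
  -- question, since a cherry at the root spoils it at size 1; and u, v may differ from h, since a
  -- leaf matters for the ears as a child of the root.
  sum-trees : ∀ (h u v : Tree → Carrier) f m →
    (∀ {l r} → size l ℕ.+ size r ≡ m → h (node l r) ≈ u l * v r) →
    sum A (map h (trees (suc f) (suc m))) ≈
      conv (λ i → sum A (map u (trees f i))) (λ i → sum A (map v (trees f i))) m
  sum-trees h u v f m h≈ = trans (sum-concat h (splits f m) (suc m)) (Σ-cong (suc m) λ {i} i<1+m →
    sum-product node h u v (trees f i) (trees f (m ℕ.∸ i)) λ l∈ r∈ →
      h≈ (≡.trans (≡.cong₂ ℕ._+_ (trees-size f i l∈) (trees-size f (m ℕ.∸ i) r∈)) (ℕ.m+[n∸m]≡n (ℕ.s≤s⁻¹ i<1+m))))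

  conv-cong : ∀ m {f f′ g g′ : Seq} → (∀ {i} → i ℕ.≤ m → f i ≈ f′ i) → (∀ {i} → i ℕ.≤ m → g i ≈ g′ i) →
    conv f g m ≈ conv f′ g′ m
  conv-cong m f≈ g≈ = Σ-cong (suc m) λ {i} i<1+m → *-cong (f≈ (ℕ.s≤s⁻¹ i<1+m)) (g≈ (ℕ.m∸n≤m m i))

  conv-+ˡ : ∀ f f′ g m → conv (λ i → f i + f′ i) g m ≈ conv f g m + conv f′ g m
  conv-+ˡ f f′ g m = trans (Σ-cong (suc m) λ {i} _ → distribʳ (g (m ℕ.∸ i)) (f i) (f′ i))
    (Σ-+ (suc m) (λ i → f i * g (m ℕ.∸ i)) (λ i → f′ i * g (m ℕ.∸ i)))

  conv-*ˡ : ∀ x f g m → conv (λ i → x * f i) g m ≈ x * conv f g m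
  conv-*ˡ x f g m = trans (Σ-cong (suc m) λ {i} _ → *-assoc x (f i) (g (m ℕ.∸ i)))
    (Σ-* (suc m) x (λ i → f i * g (m ℕ.∸ i)))

  conv-+ʳ : ∀ f g g′ m → conv f (λ i → g i + g′ i) m ≈ conv f g m + conv f g′ m
  conv-+ʳ f g g′ m = trans (Σ-cong (suc m) λ {i} _ → distribˡ (f i) (g (m ℕ.∸ i)) (g′ (m ℕ.∸ i)))
    (Σ-+ (suc m) (λ i → f i * g (m ℕ.∸ i)) (λ i → f i * g′ (m ℕ.∸ i)))

  conv-*ʳ : ∀ x f g m → conv f (λ i → x * g i) m ≈ x * conv f g m
  conv-*ʳ x f g m = trans
    (Σ-cong (suc m) λ {i} _ → solve 3 (λ a b c → (a :* (b :* c)) := (b :* (a :* c))) refl (f i) x (g (m ℕ.∸ i)))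
    (Σ-* (suc m) x (λ i → f i * g (m ℕ.∸ i)))

  one : Seq
  one zero    = 1#
  one (suc _) = 0#

  conv-oneˡ : ∀ f m → conv one f m ≈ f m
  conv-oneˡ f m = trans (+-cong (*-identityˡ (f m)) (Σ-0 m λ _ → zeroˡ _)) (+-identityʳ (f m))

  conv-oneʳ : ∀ f m → conv f one m ≈ f m
  conv-oneʳ f zero    = trans (+-identityʳ _) (*-identityʳ _)
  conv-oneʳ f (suc m) = trans (+-cong (zeroʳ (f 0)) (conv-oneʳ (f ∘ suc) m)) (+-identityˡ _)

  -- On power series this is multiplication by t.
  shift⁺ : Seq → Seq
  shift⁺ f zero    = 0#
  shift⁺ f (suc m) = f m

  shift⁺-cong : ∀ m {f g : Seq} → (∀ {i} → i ℕ.< m → f i ≈ g i) → shift⁺ f m ≈ shift⁺ g m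
  shift⁺-cong zero    f≈g = refl
  shift⁺-cong (suc m) f≈g = f≈g ℕ.≤-refl

  conv-shift⁺ : ∀ f g m → conv (shift⁺ f) g m ≈ shift⁺ (conv f g) m
  conv-shift⁺ f g zero    = trans (+-identityʳ _) (zeroˡ _)
  conv-shift⁺ f g (suc m) = trans (+-congʳ (zeroˡ _)) (+-identityˡ _)

-- Segner's convolution identity from the ratio of consecutive Catalan numbers.

module CatalanConvolution {c ℓ} (A : ℚ-Algebra c ℓ) where
  open ℚ-Algebra A
  open Convolution A
  open import Relation.Binary.Reasoning.Setoid setoid
  open import Algebra.Properties.Group +-group using () renaming (∙-cancelˡ to +-cancelˡ)
  open NaturalCoefficients commutativeSemiring using (solve; _:=_; _:+_; _:*_; con)

  num : Seq
  num zero    = 0#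
  num (suc n) = 1# + num n

  num-+ : ∀ m n → num (m ℕ.+ n) ≈ num m + num n
  num-+ zero    n = sym (+-identityˡ (num n))
  num-+ (suc m) n = trans (+-congˡ (num-+ m n)) (sym (+-assoc _ _ _))

  module _ (a : Seq)
    (a-rec : ∀ j → a (suc j) * (1# + 1# + num j) ≈ (1# + 1#) * (1# + (1# + 1#) * num j) * a j) where

    -- The summands a j * a (n - j) of the convolution telescope: with i = n - j,
    -- (n + 1) (n + 2) a j a i is the difference of two consecutive values of
    -- (j + 1) (2 i + 1) (j - i - 1) a j a i, whose positive and negative
    -- parts are T⁺ and T⁻.
    T⁺ T⁻ : ℕ → ℕ → Carrier
    T⁺ j i = (1# + num j) * (1# + (1# + 1#) * num i) * num j * (a j * a i)
    T⁻ j i = (1# + num j) * (1# + (1# + 1#) * num i) * (1# + num i) * (a j * a i)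

    weight : Carrier → Carrier
    weight n = (1# + n) * (1# + 1# + n)

    -- One telescoping step, from (j , i + 1) to (j + 1 , i), with the negative parts moved across
    -- the equation because the solver works in commutative semirings.
    T-step : ∀ j i → T⁺ (suc j) i + T⁻ j (suc i) ≈
      T⁻ (suc j) i + (T⁺ j (suc i) + weight (1# + (num j + num i)) * (a j * a (suc i)))
    T-step j i = begin
      T⁺ (suc j) i + T⁻ j (suc i)
        ≈⟨ solve 6 (λ J I aj ai aj′ ai′ →
             (con 1 :+ (con 1 :+ J)) :* (con 1 :+ (con 1 :+ con 1) :* I) :* (con 1 :+ J) :* (aj′ :* ai)
             :+ (con 1 :+ J) :* (con 1 :+ (con 1 :+ con 1) :* (con 1 :+ I)) :* (con 1 :+ (con 1 :+ I)) :* (aj :* ai′)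
             := (con 1 :+ J) :* ((aj′ :* (con 1 :+ con 1 :+ J)) :* (ai :* (con 1 :+ (con 1 :+ con 1) :* I)))
             :+ (con 1 :+ J) :* (con 1 :+ (con 1 :+ con 1) :* (con 1 :+ I)) :* (con 1 :+ (con 1 :+ I)) :* (aj :* ai′))
             refl J I aj ai aj′ ai′ ⟩
      (1# + J) * ((aj′ * (1# + 1# + J)) * (ai * (1# + (1# + 1#) * I))) + T⁻ j (suc i)
        ≈⟨ +-congʳ (*-congˡ E≈) ⟩
      (1# + J) * E + T⁻ j (suc i)
        ≈⟨ solve 4 (λ J I aj ai′ →
             (con 1 :+ J) :* ((con 1 :+ (con 1 :+ con 1) :* J) :* aj :* (ai′ :* (con 1 :+ con 1 :+ I)))
             :+ (con 1 :+ J) :* (con 1 :+ (con 1 :+ con 1) :* (con 1 :+ I)) :* (con 1 :+ (con 1 :+ I)) :* (aj :* ai′)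
             := (con 1 :+ I) :* ((con 1 :+ (con 1 :+ con 1) :* J) :* aj :* (ai′ :* (con 1 :+ con 1 :+ I)))
             :+ ((con 1 :+ J) :* (con 1 :+ (con 1 :+ con 1) :* (con 1 :+ I)) :* J :* (aj :* ai′)
             :+ (con 1 :+ (con 1 :+ (J :+ I))) :* (con 1 :+ con 1 :+ (con 1 :+ (J :+ I))) :* (aj :* ai′)))
             refl J I aj ai′ ⟩
      (1# + I) * E + rest
        ≈⟨ +-congʳ (*-congˡ E≈) ⟨
      (1# + I) * ((aj′ * (1# + 1# + J)) * (ai * (1# + (1# + 1#) * I))) + rest
        ≈⟨ +-congʳ (solve 4 (λ J I aj′ ai →
             (con 1 :+ I) :* ((aj′ :* (con 1 :+ con 1 :+ J)) :* (ai :* (con 1 :+ (con 1 :+ con 1) :* I)))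
             := (con 1 :+ (con 1 :+ J)) :* (con 1 :+ (con 1 :+ con 1) :* I) :* (con 1 :+ I) :* (aj′ :* ai))
             refl J I aj′ ai) ⟩
      T⁻ (suc j) i + rest ∎
      where
      J = num j
      I = num i
      aj = a j
      ai = a i
      aj′ = a (suc j)
      ai′ = a (suc i)
      E = (1# + (1# + 1#) * J) * aj * (ai′ * (1# + 1# + I))
      rest = T⁺ j (suc i) + weight (1# + (J + I)) * (aj * ai′)
      -- By `a-rec` at j and at i, both products equal 2 (2 j + 1) (2 i + 1) `a j` `a i`; this is
      -- how the index pair (j + 1 , i) is traded for (j , i + 1).
      E≈ : (aj′ * (1# + 1# + J)) * (ai * (1# + (1# + 1#) * I)) ≈ E
      E≈ = begin
        (aj′ * (1# + 1# + J)) * (ai * (1# + (1# + 1#) * I))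
          ≈⟨ *-congʳ (a-rec j) ⟩
        (1# + 1#) * (1# + (1# + 1#) * J) * aj * (ai * (1# + (1# + 1#) * I))
          ≈⟨ solve 4 (λ J I aj ai →
               (con 1 :+ con 1) :* (con 1 :+ (con 1 :+ con 1) :* J) :* aj :* (ai :* (con 1 :+ (con 1 :+ con 1) :* I))
               := (con 1 :+ (con 1 :+ con 1) :* J) :* aj :* ((con 1 :+ con 1) :* (con 1 :+ (con 1 :+ con 1) :* I) :* ai))
               refl J I aj ai ⟩
        (1# + (1# + 1#) * J) * aj * ((1# + 1#) * (1# + (1# + 1#) * I) * ai)
          ≈⟨ *-congˡ (a-rec i) ⟨
        E ∎

    partial : ℕ → ℕ → Carrier
    partial n k = Σ k (λ j → a j * a (n ℕ.∸ j))

    -- The first k steps added up. The telescope starts at -`T⁻ 0 n`, as `T⁺ 0 n` has the factor 0.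
    T-sum : ∀ k i {n} → k ℕ.+ i ≡ n → T⁺ k i + T⁻ 0 n ≈ T⁻ k i + weight (num n) * partial n k
    T-sum zero i ≡.refl =
      solve 3 (λ I a0 ai →
        (con 1 :+ con 0) :* (con 1 :+ (con 1 :+ con 1) :* I) :* con 0 :* (a0 :* ai)
        :+ (con 1 :+ con 0) :* (con 1 :+ (con 1 :+ con 1) :* I) :* (con 1 :+ I) :* (a0 :* ai)
        := (con 1 :+ con 0) :* (con 1 :+ (con 1 :+ con 1) :* I) :* (con 1 :+ I) :* (a0 :* ai)
        :+ (con 1 :+ I) :* (con 1 :+ con 1 :+ I) :* con 0) refl (num i) (a 0) (a i)
    T-sum (suc k) i {n} ≡.refl = +-cancelˡ (T⁻ k (suc i)) _ _ (begin
      T⁻ k (suc i) + (T⁺ (suc k) i + T⁻ 0 n)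
        ≈⟨ solve 3 (λ x y z → x :+ (y :+ z) := (y :+ x) :+ z) refl _ _ (T⁻ 0 n) ⟩
      (T⁺ (suc k) i + T⁻ k (suc i)) + T⁻ 0 n
        ≈⟨ +-congʳ (T-step k i) ⟩
      (T⁻ (suc k) i + (T⁺ k (suc i) + weight (1# + (num k + num i)) * y)) + T⁻ 0 n
        ≈⟨ solve 4 (λ x u v z → (x :+ (u :+ v)) :+ z := x :+ (v :+ (u :+ z))) refl (T⁻ (suc k) i) _ _ (T⁻ 0 n) ⟩
      T⁻ (suc k) i + (weight (1# + (num k + num i)) * y + (T⁺ k (suc i) + T⁻ 0 n))
        ≈⟨ +-congˡ (+-cong (*-cong weight≈ y≈) (T-sum k (suc i) (ℕ.+-suc k i))) ⟩
      T⁻ (suc k) i + (weight (num n) * y′ + (T⁻ k (suc i) + weight (num n) * partial n k))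
        ≈⟨ solve 5 (λ x t w y s → x :+ (w :* y :+ (t :+ w :* s)) := t :+ (x :+ w :* (s :+ y))) refl
             (T⁻ (suc k) i) (T⁻ k (suc i)) (weight (num n)) y′ (partial n k) ⟩
      T⁻ k (suc i) + (T⁻ (suc k) i + weight (num n) * (partial n k + y′))
        ≈⟨ +-congˡ (+-congˡ (*-congˡ (Σ-last k _))) ⟨
      T⁻ k (suc i) + (T⁻ (suc k) i + weight (num n) * partial n (suc k)) ∎)
      where
      y = a k * a (suc i)
      y′ = a k * a (n ℕ.∸ k)
      y≈ : y ≈ y′
      y≈ = reflexive (≡.cong (λ m → a k * a m)
        (≡.trans (≡.sym (ℕ.m+n∸m≡n k (suc i))) (≡.cong (ℕ._∸ k) (ℕ.+-suc k i))))
      num≈ : 1# + (num k + num i) ≈ num n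
      num≈ = +-congˡ (sym (num-+ k i))
      weight≈ : weight (1# + (num k + num i)) ≈ weight (num n)
      weight≈ = *-cong (+-congˡ num≈) (+-congˡ num≈)

    -- `T-sum` ends at i = 0 and covers the summands j < n; the summand j = n is added separately.
    -- The boundary terms contribute 3 n (n + 1) `a n` and this summand (n + 1) (n + 2) `a n`, which
    -- make 2 (2 n + 1) (n + 1) `a n`. The weight can be cancelled only later, over ℚ.
    conv-recurrence : a 0 ≈ 1# → ∀ n → weight (num n) * a (suc n) ≈ weight (num n) * conv a a n
    conv-recurrence a0≈1 n = +-cancelˡ ((1# + N) * a n) _ _ (begin
      (1# + N) * a n + weight N * a (suc n)
        ≈⟨ solve 3 (λ N c c′ → (con 1 :+ N) :* c :+ (con 1 :+ N) :* (con 1 :+ con 1 :+ N) :* c′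
             := (con 1 :+ N) :* c :+ (con 1 :+ N) :* (c′ :* (con 1 :+ con 1 :+ N))) refl N (a n) (a (suc n)) ⟩
      (1# + N) * a n + (1# + N) * (a (suc n) * (1# + 1# + N))
        ≈⟨ +-congˡ (*-congˡ (a-rec n)) ⟩
      (1# + N) * a n + (1# + N) * ((1# + 1#) * (1# + (1# + 1#) * N) * a n)
        ≈⟨ solve 2 (λ N c → (con 1 :+ N) :* c :+ (con 1 :+ N) :* ((con 1 :+ con 1) :* (con 1 :+ (con 1 :+ con 1) :* N) :* c)
             := (con 1 :+ N) :* (con 1 :+ (con 1 :+ con 1) :* con 0) :* N :* (c :* con 1)
             :+ (con 1 :+ con 0) :* (con 1 :+ (con 1 :+ con 1) :* N) :* (con 1 :+ N) :* (con 1 :* c)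
             :+ (con 1 :+ N) :* (con 1 :+ con 1 :+ N) :* (c :* con 1)) refl N (a n) ⟩
      (1# + N) * (1# + (1# + 1#) * 0#) * N * (a n * 1#)
        + (1# + 0#) * (1# + (1# + 1#) * N) * (1# + N) * (1# * a n) + weight N * (a n * 1#)
        ≈⟨ +-cong (+-cong (*-congˡ (*-congˡ a0≈1)) (*-congˡ (*-congʳ a0≈1))) (*-congˡ (*-congˡ a0≈1)) ⟨
      T⁺ n 0 + T⁻ 0 n + weight N * (a n * a 0)
        ≈⟨ +-congʳ (T-sum n 0 (ℕ.+-identityʳ n)) ⟩
      T⁻ n 0 + weight N * partial n n + weight N * (a n * a 0)
        ≈⟨ +-congʳ (+-congʳ (*-congˡ (*-congˡ a0≈1))) ⟩
      (1# + N) * (1# + (1# + 1#) * 0#) * (1# + 0#) * (a n * 1#) + weight N * partial n n + weight N * (a n * a 0)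
        ≈⟨ solve 5 (λ N c w s y → (con 1 :+ N) :* (con 1 :+ (con 1 :+ con 1) :* con 0) :* (con 1 :+ con 0) :* (c :* con 1) :+ w :* s :+ w :* y
             := (con 1 :+ N) :* c :+ w :* (s :+ y)) refl N (a n) (weight N) (partial n n) (a n * a 0) ⟩
      (1# + N) * a n + weight N * (partial n n + a n * a 0)
        ≈⟨ +-congˡ (*-congˡ (+-congˡ (reflexive (≡.cong (λ m → a n * a m) (ℕ.n∸n≡0 n))))) ⟨
      (1# + N) * a n + weight N * (partial n n + a n * a (n ℕ.∸ n))
        ≈⟨ +-congˡ (*-congˡ (Σ-last n (λ j → a j * a (n ℕ.∸ j)))) ⟨
      (1# + N) * a n + weight N * conv a a n ∎)
      where N = num n

-- Sequences are formal power series in t: U multiplies by 1 + x t, p j is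
-- tʲ (1 + x t)ʲ⁺¹, and P a is Σⱼ aⱼ tʲ (1 + x t)ʲ⁺¹.  By conv-P, P catalan solves
-- F = 1 + x t + t F².
module Series {c ℓ} (A : ℚ-Algebra c ℓ) (x : ℚ-Algebra.Carrier A) where
  open ℚ-Algebra A
  open Convolution A
  open import Relation.Binary.Reasoning.Setoid setoid
  open NaturalCoefficients commutativeSemiring using (solve; _:=_; _:+_; _:*_; con)

  U : Seq → Seq
  U f m = f m + x * shift⁺ f m

  U-cong : ∀ m {f g : Seq} → (∀ {i} → i ℕ.≤ m → f i ≈ g i) → U f m ≈ U g m
  U-cong m f≈g = +-cong (f≈g ℕ.≤-refl) (*-congˡ (shift⁺-cong m (f≈g ∘ ℕ.<⇒≤)))

  conv-U : ∀ f g m → conv (U f) g m ≈ U (conv f g) m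
  conv-U f g m = trans (conv-+ˡ f (λ i → x * shift⁺ f i) g m) (+-congˡ (trans (conv-*ˡ x (shift⁺ f) g m) (*-congˡ (conv-shift⁺ f g m))))

  p : ℕ → Seq
  p zero    = U one
  p (suc j) = shift⁺ (U (p j))

  -- As tʲ divides `p j`, the sum defining `P` may stop at j = m.
  p-low : ∀ j m → m ℕ.< j → p j m ≈ 0#
  p-low (suc j) zero          _         = refl
  p-low (suc j) (suc zero)    (s≤s 0<j) = trans (+-cong (p-low j 0 0<j) (zeroʳ x)) (+-identityˡ 0#)
  p-low (suc j) (suc (suc m)) (s≤s m<j) =
    trans (+-cong (p-low j (suc m) m<j) (trans (*-congˡ (p-low j m (ℕ.<⇒≤ m<j))) (zeroʳ x))) (+-identityˡ 0#)

  P : Seq → Seq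
  P a m = Σ (suc m) (λ j → a j * p j m)

  P-cong : ∀ {a b} → (∀ i → a i ≈ b i) → ∀ m → P a m ≈ P b m
  P-cong a≈b m = Σ-cong (suc m) λ {i} _ → *-congʳ {p i m} (a≈b i)

  P-linear : ∀ y a b m → P (λ i → y * a i + b i) m ≈ y * P a m + P b m
  P-linear y a b m = trans
    (Σ-cong (suc m) λ {i} _ → solve 4 (λ y a b p → ((y :* a :+ b) :* p) := (y :* (a :* p) :+ b :* p)) refl
      y (a i) (b i) (p i m))
    (trans (Σ-+ (suc m) (λ i → y * (a i * p i m)) (λ i → b i * p i m))
      (+-congʳ (Σ-* (suc m) y (λ i → a i * p i m))))

  -- Horner's rule: t (1 + x t) is taken out of all terms but the first. The factor t gained here
  -- drives the induction on the degree in `conv-P`.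
  horner : ∀ a m → P a m ≈ a 0 * p 0 m + shift⁺ (U (P (a ∘ suc))) m
  horner a zero    = refl
  horner a (suc m) = +-congˡ (trans
    (Σ-cong (suc m) λ {j} _ → solve 4 (λ a p x q → (a :* (p :+ x :* q)) := (a :* p :+ x :* (a :* q))) refl
      (a (suc j)) (p j m) x (shift⁺ (p j) m))
    (trans (Σ-+ (suc m) (λ j → a (suc j) * p j m) (λ j → x * (a (suc j) * shift⁺ (p j) m))) (+-congˡ (trans (Σ-* (suc m) x (λ j → a (suc j) * shift⁺ (p j) m)) (*-congˡ (shifted m))))))
    where
    -- For the coefficient at m - 1 the sum is one term too long; the surplus term j = m vanishes by
    -- `p-low`.
    shifted : ∀ m → Σ (suc m) (λ j → a (suc j) * shift⁺ (p j) m) ≈ shift⁺ (P (a ∘ suc)) m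
    shifted zero    = trans (+-identityʳ _) (zeroʳ _)
    shifted (suc m) = trans (Σ-last (suc m) (λ j → a (suc j) * p j m))
      (trans (+-congˡ (trans (*-congˡ (p-low (suc m) m ℕ.≤-refl)) (zeroʳ _))) (+-identityʳ _))

  U-linear : ∀ y f g m → U (λ i → y * f i + g i) m ≈ y * U f m + U g m
  U-linear y f g zero    = solve 5 (λ y f g x z → ((y :* f :+ g) :+ x :* con 0) := (y :* (f :+ x :* con 0) :+ (g :+ x :* con 0))) refl y (f 0) (g 0) x x
  U-linear y f g (suc m) = solve 6 (λ y f g x f′ g′ →
    ((y :* f :+ g) :+ x :* (y :* f′ :+ g′)) := (y :* (f :+ x :* f′) :+ (g :+ x :* g′))) refl y (f (suc m)) (g (suc m)) x (f m) (g m)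

  U-shift⁺ : ∀ f m → U (shift⁺ f) m ≈ shift⁺ (U f) m
  U-shift⁺ f zero          = trans (+-identityˡ _) (zeroʳ x)
  U-shift⁺ f (suc zero)    = refl
  U-shift⁺ f (suc (suc m)) = refl

  -- Horner's rule for the first factor only: the shifted product is `a 0` times the shift of b,
  -- plus `conv (a ∘ suc) b`; the parts with `a 0` reassemble to `P b`.
  P-conv : ∀ a b m → P (conv a b) m ≈ a 0 * P b m + shift⁺ (U (P (conv (a ∘ suc) b))) m
  P-conv a b m = begin
    P (conv a b) m
      ≈⟨ horner (conv a b) m ⟩
    conv a b 0 * p 0 m + shift⁺ (U (P (conv a b ∘ suc))) m
      ≈⟨ +-congˡ (shift⁺-linear m (λ i → trans (U-cong i (λ {j} _ → P-linear (a 0) (b ∘ suc) (conv (a ∘ suc) b) j))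
           (U-linear (a 0) (P (b ∘ suc)) (P (conv (a ∘ suc) b)) i))) ⟩
    (a 0 * b 0 + 0#) * p 0 m + (a 0 * shift⁺ (U (P (b ∘ suc))) m + shift⁺ (U (P (conv (a ∘ suc) b))) m)
      ≈⟨ solve 5 (λ a b p q r → ((a :* b :+ con 0) :* p :+ (a :* q :+ r)) := (a :* (b :* p :+ q) :+ r)) refl (a 0) (b 0) (p 0 m) _ _ ⟩
    a 0 * (b 0 * p 0 m + shift⁺ (U (P (b ∘ suc))) m) + shift⁺ (U (P (conv (a ∘ suc) b))) m
      ≈⟨ +-congʳ (*-congˡ (horner b m)) ⟨
    a 0 * P b m + shift⁺ (U (P (conv (a ∘ suc) b))) m ∎
    where
    shift⁺-linear : ∀ {y f g h} m → (∀ i → h i ≈ y * f i + g i) → shift⁺ h m ≈ y * shift⁺ f m + shift⁺ g m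
    shift⁺-linear {y} zero    h≈ = sym (trans (+-identityʳ _) (zeroʳ y))
    shift⁺-linear     (suc m) h≈ = h≈ m

  -- With u = 1 + x t, the product of tⁱ uⁱ⁺¹ and tʲ uʲ⁺¹ is u times tⁱ⁺ʲ uⁱ⁺ʲ⁺¹, which explains the
  -- single `U`. Peeling off `a 0` leaves coefficients below m; the bound n serves this strong
  -- induction.
  conv-P : ∀ n m → m ℕ.≤ n → ∀ a b → conv (P a) (P b) m ≈ U (P (conv a b)) m
  conv-P n m m≤n a b = begin
    conv (P a) (P b) m
      ≈⟨ conv-cong m {g = P b} (λ {i} _ → horner a i) (λ _ → refl) ⟩
    conv (λ i → a 0 * p 0 i + shift⁺ (U (P (a ∘ suc))) i) (P b) m
      ≈⟨ trans (conv-+ˡ (λ i → a 0 * p 0 i) (shift⁺ (U (P (a ∘ suc)))) (P b) m) (+-cong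
           (trans (conv-*ˡ (a 0) (p 0) (P b) m) (*-congˡ (trans (conv-U one (P b) m) (U-cong m λ {i} _ → conv-oneˡ (P b) i))))
           (trans (conv-shift⁺ (U (P (a ∘ suc))) (P b) m) (shift⁺-cong m λ {i} _ → conv-U (P (a ∘ suc)) (P b) i))) ⟩
    a 0 * U (P b) m + shift⁺ (U (conv (P (a ∘ suc)) (P b))) m
      ≈⟨ +-congˡ (lower n m m≤n) ⟩
    a 0 * U (P b) m + shift⁺ (U (U (P (conv (a ∘ suc) b)))) m
      ≈⟨ +-congˡ (U-shift⁺ (U (P (conv (a ∘ suc) b))) m) ⟨
    a 0 * U (P b) m + U (shift⁺ (U (P (conv (a ∘ suc) b)))) m
      ≈⟨ U-linear (a 0) (P b) _ m ⟨
    U (λ i → a 0 * P b i + shift⁺ (U (P (conv (a ∘ suc) b))) i) m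
      ≈⟨ U-cong m (λ {i} _ → P-conv a b i) ⟨
    U (P (conv a b)) m ∎
    where
    lower : ∀ n m → m ℕ.≤ n →
      shift⁺ (U (conv (P (a ∘ suc)) (P b))) m ≈ shift⁺ (U (U (P (conv (a ∘ suc) b)))) m
    lower n       zero    _         = refl
    lower (suc n) (suc m) (s≤s m≤n) = U-cong m λ i≤m → conv-P n _ (ℕ.≤-trans i≤m m≤n) (a ∘ suc) b

-- Rational arithmetic, binomial coefficients and Catalan numbers.

module CatalanNumbers where

  open import Data.Nat.Combinatorics using (nCk≡nC[n∸k])
  open import Data.Rational
  import Data.Rational.Unnormalised as ℚᵘ
  import Data.Rational.Unnormalised.Properties as ℚᵘ
  import Data.Integer.Properties as ℤ
  open import Relation.Binary.PropositionalEquality using (_≡_; refl; sym; trans; cong; cong₂; module ≡-Reasoning)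

  fromℕᵘ : ∀ k → toℚᵘ (fromℕ k) ℚᵘ.≃ ℚᵘ.mkℚᵘ (ℤ.+ k) 0
  fromℕᵘ k = ℚ.toℚᵘ-fromℚᵘ (ℚᵘ.mkℚᵘ (ℤ.+ k) 0)

  fromℕ-+ : ∀ m n → fromℕ (m ℕ.+ n) ≡ fromℕ m + fromℕ n
  fromℕ-+ m n = ℚ.toℚᵘ-injective (begin
    toℚᵘ (fromℕ (m ℕ.+ n))                        ≈⟨ fromℕᵘ (m ℕ.+ n) ⟩
    ℚᵘ.mkℚᵘ (ℤ.+ (m ℕ.+ n)) 0                     ≈⟨ ℚᵘ.*≡* (cong (ℤ._* ℤ.+ 1) (sym (cong₂ ℤ._+_ (ℤ.*-identityʳ (ℤ.+ m)) (ℤ.*-identityʳ (ℤ.+ n))))) ⟩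
    ℚᵘ.mkℚᵘ (ℤ.+ m) 0 ℚᵘ.+ ℚᵘ.mkℚᵘ (ℤ.+ n) 0      ≈⟨ ℚᵘ.+-cong (fromℕᵘ m) (fromℕᵘ n) ⟨
    toℚᵘ (fromℕ m) ℚᵘ.+ toℚᵘ (fromℕ n)            ≈⟨ ℚ.toℚᵘ-homo-+ (fromℕ m) (fromℕ n) ⟨
    toℚᵘ (fromℕ m + fromℕ n)                      ∎)
    where open ℚᵘ.≃-Reasoning

  fromℕ-suc : ∀ n → fromℕ (suc n) ≡ 1ℚ + fromℕ n
  fromℕ-suc = fromℕ-+ 1

  fromℕ-* : ∀ m n → fromℕ (m ℕ.* n) ≡ fromℕ m * fromℕ n
  fromℕ-* m n = ℚ.toℚᵘ-injective (begin
    toℚᵘ (fromℕ (m ℕ.* n))                        ≈⟨ fromℕᵘ (m ℕ.* n) ⟩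
    ℚᵘ.mkℚᵘ (ℤ.+ (m ℕ.* n)) 0                     ≈⟨ ℚᵘ.*≡* (cong (ℤ._* ℤ.+ 1) (ℤ.pos-* m n)) ⟩
    ℚᵘ.mkℚᵘ (ℤ.+ m) 0 ℚᵘ.* ℚᵘ.mkℚᵘ (ℤ.+ n) 0      ≈⟨ ℚᵘ.*-cong (fromℕᵘ m) (fromℕᵘ n) ⟨
    toℚᵘ (fromℕ m) ℚᵘ.* toℚᵘ (fromℕ n)            ≈⟨ ℚ.toℚᵘ-homo-* (fromℕ m) (fromℕ n) ⟨
    toℚᵘ (fromℕ m * fromℕ n)                      ∎)
    where open ℚᵘ.≃-Reasoning

  /-*-cancel : ∀ a d .{{_ : ℕ.NonZero d}} → ((ℤ.+ a) / d) * fromℕ d ≡ fromℕ a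
  /-*-cancel a d@(suc d-1) = ℚ.toℚᵘ-injective (begin
    toℚᵘ ((ℤ.+ a) / d * fromℕ d)                  ≈⟨ ℚ.toℚᵘ-homo-* ((ℤ.+ a) / d) (fromℕ d) ⟩
    toℚᵘ ((ℤ.+ a) / d) ℚᵘ.* toℚᵘ (fromℕ d)        ≈⟨ ℚᵘ.*-cong (ℚ.toℚᵘ-fromℚᵘ (ℚᵘ.mkℚᵘ (ℤ.+ a) d-1)) (fromℕᵘ d) ⟩
    ℚᵘ.mkℚᵘ (ℤ.+ a) d-1 ℚᵘ.* ℚᵘ.mkℚᵘ (ℤ.+ d) 0    ≈⟨ ℚᵘ.*≡* (trans (ℤ.*-identityʳ _) (cong (λ k → ℤ.+ a ℤ.* ℤ.+ k) (sym (ℕ.*-identityʳ d)))) ⟩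
    ℚᵘ.mkℚᵘ (ℤ.+ a) 0                             ≈⟨ fromℕᵘ a ⟨
    toℚᵘ (fromℕ a)                                ∎)
    where open ℚᵘ.≃-Reasoning

  fromℕ-cancelʳ : ∀ d .{{_ : ℕ.NonZero d}} {p q} → p * fromℕ d ≡ q * fromℕ d → p ≡ q
  fromℕ-cancelʳ d {p} {q} eq = trans (sym (undo p)) (trans (cong (_* (ℤ.+ 1 / d)) eq) (undo q))
    where
    undo : ∀ p → p * fromℕ d * (ℤ.+ 1 / d) ≡ p
    undo p = trans (ℚ.*-assoc p _ _) (trans (cong (p *_) (trans (ℚ.*-comm (fromℕ d) _) (/-*-cancel 1 d))) (ℚ.*-identityʳ p))

  ≡-/ : ∀ a d .{{_ : ℕ.NonZero d}} {q} → q * fromℕ d ≡ fromℕ a → q ≡ (ℤ.+ a) / d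
  ≡-/ a d eq = fromℕ-cancelʳ d (trans eq (sym (/-*-cancel a d)))

  absorption : ∀ n k → suc k ℕ.* (suc n C suc k) ≡ suc n ℕ.* (n C k)
  absorption zero    zero    = refl
  absorption zero    (suc k) = begin
    suc (suc k) ℕ.* (1 C suc (suc k)) ≡⟨ cong (suc (suc k) ℕ.*_) (k>n⇒nCk≡0 {1} {suc (suc k)} (s≤s (s≤s z≤n))) ⟩
    suc (suc k) ℕ.* 0                 ≡⟨ ℕ.*-zeroʳ (suc (suc k)) ⟩
    0                                 ≡⟨ cong (1 ℕ.*_) (k>n⇒nCk≡0 {0} {suc k} (s≤s z≤n)) ⟨
    1 ℕ.* (0 C suc k)                 ∎
    where open ≡-Reasoning
  absorption (suc n) zero = begin
    1 ℕ.* (suc (suc n) C 1)              ≡⟨ cong (1 ℕ.*_) (nCk+nC[k+1]≡[n+1]C[k+1] (suc n) 0) ⟨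
    1 ℕ.* (1 ℕ.+ (suc n C 1))            ≡⟨ ℕ.*-distribˡ-+ 1 1 (suc n C 1) ⟩
    1 ℕ.+ 1 ℕ.* (suc n C 1)              ≡⟨ cong suc (absorption n 0) ⟩
    suc (suc n) ℕ.* 1                    ∎
    where open ≡-Reasoning
  absorption (suc n) (suc k) = begin
    suc (suc k) ℕ.* (suc (suc n) C suc (suc k))
      ≡⟨ cong (suc (suc k) ℕ.*_) (nCk+nC[k+1]≡[n+1]C[k+1] (suc n) (suc k)) ⟨
    suc (suc k) ℕ.* (a ℕ.+ b)
      ≡⟨ ℕ.*-distribˡ-+ (suc (suc k)) a b ⟩
    (a ℕ.+ suc k ℕ.* a) ℕ.+ suc (suc k) ℕ.* b
      ≡⟨ cong₂ (λ u v → (a ℕ.+ u) ℕ.+ v) (absorption n k) (absorption n (suc k)) ⟩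
    (a ℕ.+ suc n ℕ.* (n C k)) ℕ.+ suc n ℕ.* (n C suc k)
      ≡⟨ ℕ.+-assoc a _ _ ⟩
    a ℕ.+ (suc n ℕ.* (n C k) ℕ.+ suc n ℕ.* (n C suc k))
      ≡⟨ cong (a ℕ.+_) (ℕ.*-distribˡ-+ (suc n) (n C k) (n C suc k)) ⟨
    a ℕ.+ suc n ℕ.* (n C k ℕ.+ n C suc k)
      ≡⟨ cong (λ u → a ℕ.+ suc n ℕ.* u) (nCk+nC[k+1]≡[n+1]C[k+1] n k) ⟩
    suc (suc n) ℕ.* a ∎
    where
    open ≡-Reasoning
    a = suc n C suc k
    b = suc n C suc (suc k)

  -- Two absorptions lead from 2 j + 2 choose j + 1 down to 2 j choose j. Between them, symmetry
  -- raises the lower index of 2 j + 1 choose j to j + 1; the auxiliary factor j + 1 feeds the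
  -- second absorption.
  central : ∀ j → suc j ℕ.* ((2 ℕ.* suc j) C suc j) ≡ 2 ℕ.* suc (2 ℕ.* j) ℕ.* ((2 ℕ.* j) C j)
  central j = ℕ.*-cancelˡ-≡ _ _ (suc j) (begin
    suc j ℕ.* (suc j ℕ.* ((2 ℕ.* suc j) C suc j))
      ≡⟨ cong (λ k → suc j ℕ.* (suc j ℕ.* (k C suc j))) (ℕ.*-suc 2 j) ⟩
    suc j ℕ.* (suc j ℕ.* (suc (suc (2 ℕ.* j)) C suc j))
      ≡⟨ cong (suc j ℕ.*_) (absorption (suc (2 ℕ.* j)) j) ⟩
    suc j ℕ.* (suc (suc (2 ℕ.* j)) ℕ.* (suc (2 ℕ.* j) C j))
      ≡⟨ cong (λ k → suc j ℕ.* (suc (suc (2 ℕ.* j)) ℕ.* k)) symmetry ⟩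
    suc j ℕ.* (suc (suc (2 ℕ.* j)) ℕ.* (suc (2 ℕ.* j) C suc j))
      ≡⟨ solve 2 (λ j x → (con 1 :+ j) :* ((con 2 :+ con 2 :* j) :* x) := (con 2 :+ con 2 :* j) :* ((con 1 :+ j) :* x)) refl j (suc (2 ℕ.* j) C suc j) ⟩
    suc (suc (2 ℕ.* j)) ℕ.* (suc j ℕ.* (suc (2 ℕ.* j) C suc j))
      ≡⟨ cong (suc (suc (2 ℕ.* j)) ℕ.*_) (absorption (2 ℕ.* j) j) ⟩
    suc (suc (2 ℕ.* j)) ℕ.* (suc (2 ℕ.* j) ℕ.* ((2 ℕ.* j) C j))
      ≡⟨ solve 2 (λ j x → (con 2 :+ con 2 :* j) :* ((con 1 :+ con 2 :* j) :* x) := (con 1 :+ j) :* (con 2 :* (con 1 :+ con 2 :* j) :* x)) refl j ((2 ℕ.* j) C j) ⟩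
    suc j ℕ.* (2 ℕ.* suc (2 ℕ.* j) ℕ.* ((2 ℕ.* j) C j)) ∎)
    where
    open ≡-Reasoning
    open ℕSolver.+-*-Solver
    symmetry : suc (2 ℕ.* j) C j ≡ suc (2 ℕ.* j) C suc j
    symmetry = trans (nCk≡nC[n∸k] {j} {suc (2 ℕ.* j)} (ℕ.m≤n⇒m≤1+n (ℕ.m≤m+n j (j ℕ.+ 0))))
      (cong (suc (2 ℕ.* j) C_) (trans (cong (ℕ._∸ j) (trans (cong (λ k → suc (j ℕ.+ k)) (ℕ.+-identityʳ j)) (sym (ℕ.+-suc j j))))
        (ℕ.m+n∸m≡n j (suc j))))

  catalan-* : ∀ k → catalan k * fromℕ (suc k) ≡ fromℕ ((2 ℕ.* k) C k)
  catalan-* k = /-*-cancel ((2 ℕ.* k) C k) (suc k)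

  catalan-suc : ∀ j → catalan (suc j) * fromℕ (2 ℕ.+ j) ≡ fromℕ (2 ℕ.* (1 ℕ.+ 2 ℕ.* j)) * catalan j
  catalan-suc j = fromℕ-cancelʳ (suc j) (begin
    catalan (suc j) * fromℕ (2 ℕ.+ j) * fromℕ (suc j)
      ≡⟨ cong (_* fromℕ (suc j)) (catalan-* (suc j)) ⟩
    fromℕ ((2 ℕ.* suc j) C suc j) * fromℕ (suc j)
      ≡⟨ trans (ℚ.*-comm (fromℕ ((2 ℕ.* suc j) C suc j)) (fromℕ (suc j))) (sym (fromℕ-* (suc j) ((2 ℕ.* suc j) C suc j))) ⟩
    fromℕ (suc j ℕ.* ((2 ℕ.* suc j) C suc j))
      ≡⟨ cong fromℕ (central j) ⟩
    fromℕ ((2 ℕ.* (1 ℕ.+ 2 ℕ.* j)) ℕ.* ((2 ℕ.* j) C j))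
      ≡⟨ fromℕ-* (2 ℕ.* (1 ℕ.+ 2 ℕ.* j)) ((2 ℕ.* j) C j) ⟩
    fromℕ (2 ℕ.* (1 ℕ.+ 2 ℕ.* j)) * fromℕ ((2 ℕ.* j) C j)
      ≡⟨ cong (fromℕ (2 ℕ.* (1 ℕ.+ 2 ℕ.* j)) *_) (catalan-* j) ⟨
    fromℕ (2 ℕ.* (1 ℕ.+ 2 ℕ.* j)) * (catalan j * fromℕ (suc j))
      ≡⟨ ℚ.*-assoc (fromℕ (2 ℕ.* (1 ℕ.+ 2 ℕ.* j))) (catalan j) (fromℕ (suc j)) ⟨
    fromℕ (2 ℕ.* (1 ℕ.+ 2 ℕ.* j)) * catalan j * fromℕ (suc j) ∎)
    where
    open ≡-Reasoning

  open Convolution ℚ-algebra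
  open CatalanConvolution ℚ-algebra

  num≡fromℕ : ∀ n → num n ≡ fromℕ n
  num≡fromℕ zero    = refl
  num≡fromℕ (suc n) = trans (cong (1ℚ +_) (num≡fromℕ n)) (sym (fromℕ-suc n))

  -- Over ℚ the factor (n + 1) (n + 2) of `conv-recurrence` can be cancelled.
  catalan-conv : ∀ n → catalan (suc n) ≡ conv catalan catalan n
  catalan-conv n = fromℕ-cancelʳ (suc n ℕ.* suc (suc n))
    (trans (shuffle (catalan (suc n))) (trans (conv-recurrence catalan catalan-rec refl n)
      (sym (shuffle (conv catalan catalan n)))))
    where
    catalan-rec : ∀ j → catalan (suc j) * (1ℚ + 1ℚ + num j) ≡ (1ℚ + 1ℚ) * (1ℚ + (1ℚ + 1ℚ) * num j) * catalan j
    catalan-rec j = trans (cong (catalan (suc j) *_) (sym eq₁)) (trans (catalan-suc j) (cong (_* catalan j) eq₂))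
      where
      eq₁ : fromℕ (2 ℕ.+ j) ≡ 1ℚ + 1ℚ + num j
      eq₁ = trans (fromℕ-+ 2 j) (cong (fromℕ 2 +_) (sym (num≡fromℕ j)))
      eq₂ : fromℕ (2 ℕ.* (1 ℕ.+ 2 ℕ.* j)) ≡ (1ℚ + 1ℚ) * (1ℚ + (1ℚ + 1ℚ) * num j)
      eq₂ = trans (fromℕ-* 2 (1 ℕ.+ 2 ℕ.* j)) (cong (fromℕ 2 *_) (trans (fromℕ-suc (2 ℕ.* j))
        (cong (1ℚ +_) (trans (fromℕ-* 2 j) (cong (fromℕ 2 *_) (sym (num≡fromℕ j)))))))
    shuffle : ∀ q → q * fromℕ (suc n ℕ.* suc (suc n)) ≡ (1ℚ + num n) * (1ℚ + 1ℚ + num n) * q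
    shuffle q = trans (ℚ.*-comm q _) (cong (_* q) (trans (fromℕ-* (suc n) (suc (suc n)))
      (cong₂ _*_ (sym (num≡fromℕ (suc n)))
        (trans (fromℕ-+ 2 n) (cong (fromℕ 2 +_) (sym (num≡fromℕ n)))))))

open CatalanNumbers

-- The number of triangulations.

module Q = Convolution ℚ-algebra

1-sum≡length : ∀ {X : Set} (xs : List X) → sum ℚ-algebra (map (const 1ℚ) xs) ≡ fromℕ (length xs)
1-sum≡length []       = ≡.refl
1-sum≡length (x ∷ xs) = ≡.trans (≡.cong (1ℚ ℚ.+_) (1-sum≡length xs)) (≡.sym (fromℕ-suc (length xs)))

-- Counting is summation of the weight 1, which factors at every root, so the count obeys the
-- Catalan convolution.
tree-count : ∀ f m → m ℕ.≤ f → fromℕ (length (trees f m)) ≡ catalan m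
tree-count f m m≤f = ≡.trans (≡.sym (1-sum≡length (trees f m))) (go f m m≤f)
  where
  go : ∀ f m → m ℕ.≤ f → sum ℚ-algebra (map (const 1ℚ) (trees f m)) ≡ catalan m
  go f       zero    _         = ≡.refl
  go (suc f) (suc m) (s≤s m≤f) = ≡.trans
    (Q.sum-trees (const 1ℚ) (const 1ℚ) (const 1ℚ) f m (λ _ → ≡.refl))
    (≡.trans (Q.conv-cong m (λ i≤m → go f _ (ℕ.≤-trans i≤m m≤f)) (λ i≤m → go f _ (ℕ.≤-trans i≤m m≤f)))
      (≡.sym (catalan-conv m)))

reciprocal-1/ : ∀ N {q} → fromℕ N ≡ q → (q≢0 : ℚ.NonZero q) → reciprocal N ≡ (ℚ.1/ q) {{q≢0}}
reciprocal-1/ zero    ≡.refl ()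
reciprocal-1/ (suc k) ≡.refl q≢0 = fromℕ-cancelʳ (suc k)
  (≡.trans (/-*-cancel 1 (suc k)) (≡.sym (ℚ.*-inverseˡ (fromℕ (suc k)) {{q≢0}})))

module _ (m : ℕ) where

  polygon : ℕ
  polygon = suc (suc m)

  polygon-triangulations : triangulations polygon ↭ map (diagonalsOf polygon) (trees m m)
  polygon-triangulations = triangulations↭ (trees! m m)
    (λ { {t} ≡.refl → ∈-trees t ℕ.≤-refl }) (trees-size m m)

  triangulation-count : fromℕ (length (triangulations polygon)) ≡ catalan m
  triangulation-count = ≡.trans
    (≡.cong fromℕ (≡.trans (↭-length polygon-triangulations) (List.length-map (diagonalsOf polygon) (trees m m))))
    (tree-count m m ℕ.≤-refl)

  normalisation : reciprocal (length (triangulations polygon)) ≡ (ℚ.1/ catalan m) {{catalan≢0 m}}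
  normalisation = reciprocal-1/ (length (triangulations polygon)) triangulation-count (catalan≢0 m)

-- The probability generating function of the number of ears.

cherry≡0 : ∀ l r {m} → size l ℕ.+ size r ≡ suc m → cherry l r ≡ 0
cherry≡0 leaf       leaf       ()
cherry≡0 leaf       (node _ _) _ = ≡.refl
cherry≡0 (node _ _) _          _ = ≡.refl

module _ {o ℓ} (A : ℚ-Algebra o ℓ) where
  open ℚ-Algebra A
  open Convolution A
  open RingMorphisms ℚ.+-*-rawRing rawRing using (module IsRingHomomorphism)
  open IsRingHomomorphism isRingHomomorphism using (+-homo; *-homo; 0#-homo; 1#-homo)

  ι-Σ : ∀ n f → ι (Q.Σ n f) ≈ Σ n (ι ∘ f)
  ι-Σ zero    f = 0#-homo
  ι-Σ (suc n) f = trans (+-homo _ _) (+-congˡ (ι-Σ n (f ∘ suc)))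

  ι-conv : ∀ f g m → ι (Q.conv f g m) ≈ conv (ι ∘ f) (ι ∘ g) m
  ι-conv f g m = trans (ι-Σ (suc m) (λ i → f i ℚ.* g (m ℕ.∸ i))) (Σ-cong (suc m) λ {i} _ → *-homo (f i) (g (m ℕ.∸ i)))

  c : Seq
  c = ι ∘ catalan

  c-0 : c 0 ≈ 1#
  c-0 = 1#-homo

  c-suc : ∀ n → c (suc n) ≈ conv c c n
  c-suc n = trans (reflexive (≡.cong ι (catalan-conv n))) (ι-conv catalan catalan n)

  ι-fromℕ-+ : ∀ m n → ι (fromℕ (m ℕ.+ n)) ≈ ι (fromℕ m) + ι (fromℕ n)
  ι-fromℕ-+ m n = trans (reflexive (≡.cong ι (fromℕ-+ m n))) (+-homo (fromℕ m) (fromℕ n))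

  module _ (z : Carrier) where

    private
      x = z - 1#

    open Series A x
    open import Relation.Binary.Reasoning.Setoid setoid
    open NaturalCoefficients commutativeSemiring using (solve; _:=_; _:+_; _:*_; con)

    z≈1+x : z ≈ 1# + x
    z≈1+x = sym (trans (+-comm _ _) (trans (+-assoc _ _ _) (trans (+-congˡ (-‿inverseˡ 1#)) (+-identityʳ z))))

    ^-+ : ∀ m n → z ^ (m ℕ.+ n) ≈ z ^ m * z ^ n
    ^-+ = ^-homo-* z
      where open import Algebra.Properties.Semiring.Exp semiring using (^-homo-*)

    W : ℕ → Seq
    W f m = sum A (map (λ t → z ^ cherries t) (trees f m))

    -- From size 2 on the root is no cherry, and the weight is multiplicative.
    W-suc : ∀ f m → W (suc f) (suc (suc m)) ≈ conv (W f) (W f) (suc m)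
    W-suc f m = sum-trees (λ t → z ^ cherries t) _ _ f (suc m) λ {l} {r} eq →
      trans (reflexive (≡.cong (λ k → z ^ (k ℕ.+ (cherries l ℕ.+ cherries r))) (cherry≡0 l r eq)))
        (^-+ (cherries l) (cherries r))

    -- In F = 1 + x t + t F² the part 1 + x t is gone from degree 2 on.
    P-c : ∀ m → conv (P c) (P c) (suc m) ≈ P c (suc (suc m))
    P-c m = begin
      conv (P c) (P c) (suc m)                             ≈⟨ conv-P (suc m) (suc m) ℕ.≤-refl c c ⟩
      U (P (conv c c)) (suc m)                             ≈⟨ U-cong (suc m) (λ {i} _ → P-cong c-suc i) ⟨
      U (P (c ∘ suc)) (suc m)                              ≈⟨ +-identityˡ _ ⟨
      0# + U (P (c ∘ suc)) (suc m)                         ≈⟨ +-congʳ (trans (*-congˡ (trans (+-identityˡ _) (zeroʳ x))) (zeroʳ (c 0))) ⟨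
      c 0 * p 0 (suc (suc m)) + U (P (c ∘ suc)) (suc m)    ≈⟨ horner c (suc (suc m)) ⟨
      P c (suc (suc m))                                    ∎

    W≈P : ∀ f m → m ℕ.≤ f → W f m ≈ P c m
    W≈P f zero _ = begin
      1# + 0#                            ≈⟨ solve 1 (λ x → con 1 :+ con 0 := con 1 :* (con 1 :+ x :* con 0) :+ con 0) refl x ⟩
      1# * (1# + x * 0#) + 0#            ≈⟨ +-congʳ (*-congʳ c-0) ⟨
      c 0 * (1# + x * 0#) + 0#           ∎
    -- The single node is a cherry of weight z = 1 + x, while its two leaves multiply to 1: the
    -- difference is the term x t.
    W≈P (suc f) (suc zero) _ = begin
      z * 1# + 0#                        ≈⟨ trans (+-identityʳ _) (trans (*-identityʳ z) z≈1+x) ⟩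
      1# + x                             ≈⟨ solve 1 (λ x → con 1 :+ x := con 1 :* (con 0 :+ x :* con 1) :+ ((con 1 :* con 1 :+ con 0) :* ((con 1 :+ x :* con 0) :+ x :* con 0) :+ con 0)) refl x ⟩
      1# * (0# + x * 1#) + ((1# * 1# + 0#) * ((1# + x * 0#) + x * 0#) + 0#)
        ≈⟨ +-cong (*-congʳ c-0) (+-congʳ (*-congʳ (trans (c-suc 0) (+-congʳ (*-cong c-0 c-0))))) ⟨
      c 0 * (0# + x * 1#) + (c 1 * ((1# + x * 0#) + x * 0#) + 0#) ∎
    W≈P (suc f) (suc (suc m)) (s≤s 1+m≤f) = begin
      W (suc f) (suc (suc m))            ≈⟨ W-suc f m ⟩
      conv (W f) (W f) (suc m)           ≈⟨ conv-cong (suc m) {W f} {P c} {W f} {P c} (λ i≤ → W≈P f _ (ℕ.≤-trans i≤ 1+m≤f)) (λ i≤ → W≈P f _ (ℕ.≤-trans i≤ 1+m≤f)) ⟩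
      conv (P c) (P c) (suc m)           ≈⟨ P-c m ⟩
      P c (suc (suc m))                  ∎

    -- The weight of a child of the root: a leaf there turns the root triangle into an ear and so
    -- counts z.
    V : ℕ → Seq
    V f m = sum A (map (λ t → z ^ (isLeaf t ℕ.+ cherries t)) (trees f m))

    V≈ : ∀ f m → V f m ≈ W f m + x * one m
    V≈ f zero    = trans (+-congʳ (trans (*-identityʳ z) z≈1+x))
      (solve 1 (λ x → (con 1 :+ x) :+ con 0 := (con 1 :+ con 0) :+ x :* con 1) refl x)
    V≈ f (suc m) = trans (sum-cong (trees f (suc m)) same) (sym (trans (+-congˡ (zeroʳ x)) (+-identityʳ _)))
      where
      same : ∀ {t} → t ∈ trees f (suc m) → z ^ (isLeaf t ℕ.+ cherries t) ≈ z ^ cherries t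
      same {leaf}     t∈ with () ← trees-size f (suc m) t∈
      same {node _ _} t∈ = refl

    -- Both children of the root carry the series F + x, and t (F + x)² = t F² + 2 x t F + x² t; the
    -- last term affects only degree 1, that is, n = 3.
    ears-sum : ∀ f m → suc m ℕ.≤ f →
      sum A (map (λ t → z ^ ears t) (trees (suc f) (suc (suc m)))) ≈
        P c (suc (suc m)) + (1# + 1#) * (x * P c (suc m))
    ears-sum f m 1+m≤f = begin
      sum A (map (λ t → z ^ ears t) (trees (suc f) (suc (suc m))))
        ≈⟨ sum-trees (λ t → z ^ ears t) (λ t → z ^ (isLeaf t ℕ.+ cherries t)) (λ t → z ^ (isLeaf t ℕ.+ cherries t)) f (suc m)
             (λ {l} {r} _ → trans (reflexive (≡.cong (z ^_) (interchange (isLeaf l) (isLeaf r) (cherries l) (cherries r))))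
               (^-+ (isLeaf l ℕ.+ cherries l) _)) ⟩
      conv (V f) (V f) (suc m)
        ≈⟨ conv-cong (suc m) {V f} {λ i → P c i + x * one i} {V f} {λ i → P c i + x * one i} V≈P V≈P ⟩
      conv (λ i → P c i + x * one i) (λ i → P c i + x * one i) (suc m)
        ≈⟨ conv-+ˡ (P c) (λ i → x * one i) (λ i → P c i + x * one i) (suc m) ⟩
      conv (P c) (λ i → P c i + x * one i) (suc m) + conv (λ i → x * one i) (λ i → P c i + x * one i) (suc m)
        ≈⟨ +-cong (trans (conv-+ʳ (P c) (P c) (λ i → x * one i) (suc m))
                    (+-cong (P-c m) (trans (conv-*ʳ x (P c) one (suc m)) (*-congˡ (conv-oneʳ (P c) (suc m))))))
                  (trans (conv-*ˡ x one (λ i → P c i + x * one i) (suc m)) (*-congˡ (conv-oneˡ (λ i → P c i + x * one i) (suc m)))) ⟩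
      (P c (suc (suc m)) + x * P c (suc m)) + x * (P c (suc m) + x * 0#)
        ≈⟨ solve 3 (λ q x p → (q :+ x :* p) :+ x :* (p :+ x :* con 0) := q :+ (con 1 :+ con 1) :* (x :* p)) refl
             (P c (suc (suc m))) x (P c (suc m)) ⟩
      P c (suc (suc m)) + (1# + 1#) * (x * P c (suc m)) ∎
      where
      V≈P : ∀ {i} → i ℕ.≤ suc m → V f i ≈ P c i + x * one i
      V≈P {i} i≤ = trans (V≈ f i) (+-congʳ (W≈P f i (ℕ.≤-trans i≤ 1+m≤f)))
      interchange : ∀ a b c d → (a ℕ.+ b) ℕ.+ (c ℕ.+ d) ≡ (a ℕ.+ c) ℕ.+ (b ℕ.+ d)
      interchange = ℕ+.interchange
        where
        import Algebra.Properties.CommutativeSemigroup ℕ.+-commutativeSemigroup as ℕ+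

    -- The binomial theorem for (1 + x t)ʲ⁺¹, with Pascal's rule as the induction step.
    p-explicit : ∀ j k → p j (j ℕ.+ k) ≈ ι (fromℕ (suc j C k)) * x ^ k
    p-explicit zero zero = trans
      (solve 1 (λ x → con 1 :+ x :* con 0 := con 1 :* con 1) refl x)
      (*-congʳ (sym 1#-homo))
    p-explicit zero (suc zero) = trans
      (solve 1 (λ x → con 0 :+ x :* con 1 := con 1 :* (x :* con 1)) refl x)
      (*-congʳ (sym 1#-homo))
    p-explicit zero (suc (suc k)) = trans (trans (+-identityˡ _) (zeroʳ x))
      (sym (trans (*-congʳ (trans (reflexive (≡.cong (ι ∘ fromℕ) (k>n⇒nCk≡0 {1} {suc (suc k)} (s≤s (s≤s z≤n))))) 0#-homo)) (zeroˡ _)))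
    p-explicit (suc j) zero = begin
      p j (j ℕ.+ 0) + x * shift⁺ (p j) (j ℕ.+ 0)     ≈⟨ +-cong (p-explicit j 0) (*-congˡ (low (j ℕ.+ 0) (ℕ.≤-reflexive (ℕ.+-identityʳ j)))) ⟩
      ι (fromℕ 1) * 1# + x * 0#                      ≈⟨ trans (+-congˡ (zeroʳ x)) (+-identityʳ _) ⟩
      ι (fromℕ 1) * 1#                               ∎
      where
      low : ∀ m → m ℕ.≤ j → shift⁺ (p j) m ≈ 0#
      low zero    _   = refl
      low (suc m) m<j = p-low j m m<j
    p-explicit (suc j) (suc k) = begin
      p j (j ℕ.+ suc k) + x * shift⁺ (p j) (j ℕ.+ suc k)
        ≈⟨ +-cong (p-explicit j (suc k)) (*-congˡ (trans (reflexive (≡.cong (shift⁺ (p j)) (ℕ.+-suc j k))) (p-explicit j k))) ⟩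
      ι (fromℕ (suc j C suc k)) * (x * x ^ k) + x * (ι (fromℕ (suc j C k)) * x ^ k)
        ≈⟨ solve 4 (λ a b x y → a :* (x :* y) :+ x :* (b :* y) := (b :+ a) :* (x :* y)) refl
             (ι (fromℕ (suc j C suc k))) (ι (fromℕ (suc j C k))) x (x ^ k) ⟩
      (ι (fromℕ (suc j C k)) + ι (fromℕ (suc j C suc k))) * (x * x ^ k)
        ≈⟨ *-congʳ (ι-fromℕ-+ (suc j C k) (suc j C suc k)) ⟨
      ι (fromℕ ((suc j C k) ℕ.+ (suc j C suc k))) * (x * x ^ k)
        ≈⟨ *-congʳ (reflexive (≡.cong (ι ∘ fromℕ) (nCk+nC[k+1]≡[n+1]C[k+1] (suc j) k))) ⟩
      ι (fromℕ (suc (suc j) C suc k)) * (x * x ^ k) ∎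

    p-diagonal : ∀ j → p j j ≈ 1#
    p-diagonal j = trans (reflexive (≡.cong (p j) (≡.sym (ℕ.+-identityʳ j))))
      (trans (p-explicit j 0) (trans (*-identityʳ _) 1#-homo))

    -- The lower indices and j + 1 are separate arguments so that the truncated differences of the
    -- theorem can be rewritten inside them.
    term : ℕ → ℕ → ℕ → ℕ → Carrier
    term j j+1 u v = ι (catalan j ℚ.* fromℕ ((j+1 C u) ℕ.+ 2 ℕ.* (j+1 C v))) * x ^ u

    summand : ℕ → ℕ → ℕ → Carrier
    summand a b j = term j (j ℕ.+ 1) (a ℕ.∸ j) (b ℕ.∸ j)

    summand≈ : ∀ m j {k} → j ℕ.+ k ≡ m → summand (suc m) m j ≈ c j * p j (suc m) + (1# + 1#) * (x * (c j * p j m))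
    summand≈ m j {k} j+k≡m = begin
      summand (suc m) m j
        ≈⟨ reflexive (≡.trans (≡.cong₂ (term j (j ℕ.+ 1)) (difference (≡.trans (ℕ.+-suc j k) (≡.cong suc j+k≡m))) (difference j+k≡m))
             (≡.cong (λ i → term j i (suc k) k) j+1≡)) ⟩
      term j (suc j) (suc k) k
        ≈⟨ *-congʳ (trans (*-homo (catalan j) (fromℕ ((suc j C suc k) ℕ.+ 2 ℕ.* (suc j C k)))) (*-congˡ (trans (ι-fromℕ-+ (suc j C suc k) (2 ℕ.* (suc j C k)))
             (+-congˡ (trans (ι-fromℕ-+ (suc j C k) (suc j C k ℕ.+ 0)) (+-congˡ (reflexive (≡.cong (ι ∘ fromℕ) (ℕ.+-identityʳ (suc j C k)))))))))) ⟩
      (c j * (a k + (b k + b k))) * x ^ suc k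
        ≈⟨ solve 5 (λ c a b x y → (c :* (a :+ (b :+ b))) :* (x :* y) := c :* (a :* (x :* y)) :+ (con 1 :+ con 1) :* (x :* (c :* (b :* y)))) refl
             (c j) (a k) (b k) x (x ^ k) ⟩
      c j * (a k * x ^ suc k) + (1# + 1#) * (x * (c j * (b k * x ^ k)))
        ≈⟨ +-cong (*-congˡ (trans (reflexive (≡.cong (p j) (≡.sym (≡.trans (ℕ.+-suc j k) (≡.cong suc j+k≡m))))) (p-explicit j (suc k))))
             (*-congˡ (*-congˡ (*-congˡ (trans (reflexive (≡.cong (p j) (≡.sym j+k≡m))) (p-explicit j k))))) ⟨
      c j * p j (suc m) + (1# + 1#) * (x * (c j * p j m)) ∎
      where
      a b : ℕ → Carrier
      a k = ι (fromℕ (suc j C suc k))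
      b k = ι (fromℕ (suc j C k))
      j+1≡ : j ℕ.+ 1 ≡ suc j
      j+1≡ = ℕ.+-comm j 1
      difference : ∀ {k m} → j ℕ.+ k ≡ m → m ℕ.∸ j ≡ k
      difference {k} ≡.refl = ℕ.m+n∸m≡n j k

    -- The term j = m + 1 of the first series has `p-diagonal` coefficient 1 and is split off; after
    -- division by the Catalan number it is the leading 1 of the theorem. The other terms of the two
    -- series pair up by j.
    P-summands : ∀ m → P c (suc m) + (1# + 1#) * (x * P c m) ≈ c (suc m) + Σ (suc m) (summand (suc m) m)
    P-summands m = begin
      P c (suc m) + (1# + 1#) * (x * P c m)
        ≈⟨ +-cong (Σ-last (suc m) (λ j → c j * p j (suc m)))
             (sym (trans (Σ-* (suc m) (1# + 1#) (λ j → x * (c j * p j m))) (*-congˡ (Σ-* (suc m) x (λ j → c j * p j m))))) ⟩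
      (Σ (suc m) (λ j → c j * p j (suc m)) + c (suc m) * p (suc m) (suc m))
        + Σ (suc m) (λ j → (1# + 1#) * (x * (c j * p j m)))
        ≈⟨ +-congʳ (+-congˡ (trans (*-congˡ (p-diagonal (suc m))) (*-identityʳ _))) ⟩
      (Σ (suc m) (λ j → c j * p j (suc m)) + c (suc m)) + Σ (suc m) (λ j → (1# + 1#) * (x * (c j * p j m)))
        ≈⟨ solve 3 (λ a b d → (a :+ b) :+ d := b :+ (a :+ d)) refl _ _ _ ⟩
      c (suc m) + (Σ (suc m) (λ j → c j * p j (suc m)) + Σ (suc m) (λ j → (1# + 1#) * (x * (c j * p j m))))
        ≈⟨ +-congˡ (trans (Σ-cong (suc m) λ {j} j<1+m → summand≈ m j (proj₂ (ℕ.m≤n⇒∃[o]m+o≡n (ℕ.s≤s⁻¹ j<1+m))))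
             (Σ-+ (suc m) (λ j → c j * p j (suc m)) (λ j → (1# + 1#) * (x * (c j * p j m))))) ⟨
      c (suc m) + Σ (suc m) (summand (suc m) m) ∎

    g-explicit : ∀ m → g A (4 ℕ.+ m) z ≈
      1# + ι ((ℚ.1/ catalan (2 ℕ.+ m)) {{catalan≢0 (2 ℕ.+ m)}}) * Σ (2 ℕ.+ m) (summand (2 ℕ.+ m) (suc m))
    g-explicit m = begin
      ι (reciprocal (length (triangulations n))) * sum A (map (λ T → z ^ 𝒮 T) (triangulations n))
        ≈⟨ *-cong (reflexive (≡.cong ι (normalisation k))) (sum-↭ (λ T → z ^ 𝒮 T) (polygon-triangulations k)) ⟩
      ι 1/c * sum A (map (λ T → z ^ 𝒮 T) (map (diagonalsOf n) (trees k k)))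
        ≈⟨ *-congˡ (reflexive (≡.cong (sum A) (≡.sym (List.map-∘ (trees k k))))) ⟩
      ι 1/c * sum A (map (λ t → z ^ 𝒮 (diagonalsOf n t)) (trees k k))
        ≈⟨ *-congˡ (sum-cong (trees k k) λ {t} t∈ → reflexive (≡.cong (z ^_) (𝒮≡ears t
             (≡.cong suc (≡.trans (end≡+size t 0) (≡.cong suc (trees-size k k t∈))))
             (≡.subst (2 ℕ.≤_) (≡.sym (trees-size k k t∈)) (s≤s (s≤s z≤n)))))) ⟩
      ι 1/c * sum A (map (λ t → z ^ ears t) (trees k k))
        ≈⟨ *-congˡ (trans (ears-sum (suc m) m ℕ.≤-refl) (P-summands (suc m))) ⟩
      ι 1/c * (c k + Σ k (summand (2 ℕ.+ m) (suc m)))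
        ≈⟨ distribˡ _ _ _ ⟩
      ι 1/c * c k + ι 1/c * Σ k (summand (2 ℕ.+ m) (suc m))
        ≈⟨ +-congʳ (trans (sym (*-homo 1/c (catalan k))) (trans (reflexive (≡.cong ι (ℚ.*-inverseˡ (catalan k) {{catalan≢0 k}}))) 1#-homo)) ⟩
      1# + ι 1/c * Σ k (summand (2 ℕ.+ m) (suc m)) ∎
      where
      k = 2 ℕ.+ m
      n = 4 ℕ.+ m
      1/c : ℚ
      1/c = (ℚ.1/ catalan k) {{catalan≢0 k}}

    formula : ℕ → ℕ → Carrier
    formula a b = 1# + ι ((ℚ.1/ catalan a) {{catalan≢0 a}}) * sum A (map (summand a b) (upTo a))

    -- Subtractions compute on 4 + m; `relabel` carries the identity to n as a whole.
    g-formula : ∀ n → 4 ℕ.≤ n → g A n z ≈ formula (n ℕ.∸ 2) (n ℕ.∸ 3)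
    g-formula n 4≤n = let m , eq = ℕ.m≤n⇒∃[o]m+o≡n 4≤n in
      relabel n eq (≡.cong (ℕ._∸ 2) eq) (≡.cong (ℕ._∸ 3) eq) (trans (g-explicit m) (+-congˡ (*-congˡ (reflexive
        (≡.sym (sum-upTo (summand (2 ℕ.+ m) (suc m)) (2 ℕ.+ m)))))))
      where
      relabel : ∀ n {k a b} → k ≡ n → a ≡ n ℕ.∸ 2 → b ≡ n ℕ.∸ 3 → g A k z ≈ formula a b → g A n z ≈ formula (n ℕ.∸ 2) (n ℕ.∸ 3)
      relabel n ≡.refl ≡.refl ≡.refl g≈ = g≈

-- Power series truncated at ε³.

module Truncated {o ℓ} (A : ℚ-Algebra o ℓ) where
  open ℚ-Algebra A
  open NaturalCoefficients commutativeSemiring using (solve; _:=_; _:+_; _:*_; con)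
  open RingMorphisms ℚ.+-*-rawRing rawRing using (module IsRingHomomorphism)
  module ι = IsRingHomomorphism isRingHomomorphism

  -- The triple (a , b , c) is a + b ε + c ε² in A[ε] / (ε³).
  +-group³ : AbelianGroup o ℓ
  +-group³ = DirectProduct.abelianGroup +-abelianGroup (DirectProduct.abelianGroup +-abelianGroup +-abelianGroup)

  open AbelianGroup +-group³ using () renaming (Carrier to Carrier³; _≈_ to _≈³_; _∙_ to _+³_)

  _*³_ : Carrier³ → Carrier³ → Carrier³
  (a , b , c) *³ (d , e , f) = a * d , a * e + b * d , a * f + (b * e + c * d)

  *³-comm : ∀ u v → (u *³ v) ≈³ (v *³ u)
  *³-comm (a , b , c) (d , e , f) = *-comm a d ,
    solve 4 (λ a b d e → a :* e :+ b :* d := d :* b :+ e :* a) refl a b d e ,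
    solve 6 (λ a b c d e f → a :* f :+ (b :* e :+ c :* d) := d :* c :+ (e :* b :+ f :* a)) refl a b c d e f

  *³-assoc : ∀ u v w → ((u *³ v) *³ w) ≈³ (u *³ (v *³ w))
  *³-assoc (a , b , c) (d , e , f) (g , h , i) = *-assoc a d g ,
    solve 6 (λ a b d e g h → a :* d :* h :+ (a :* e :+ b :* d) :* g := a :* (d :* h :+ e :* g) :+ b :* (d :* g)) refl a b d e g h ,
    solve 9 (λ a b c d e f g h i →
      a :* d :* i :+ ((a :* e :+ b :* d) :* h :+ (a :* f :+ (b :* e :+ c :* d)) :* g)
      := a :* (d :* i :+ (e :* h :+ f :* g)) :+ (b :* (d :* h :+ e :* g) :+ c :* (d :* g))) refl a b c d e f g h i

  *³-identityˡ : ∀ u → ((1# , 0# , 0#) *³ u) ≈³ u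
  *³-identityˡ (a , b , c) = *-identityˡ a ,
    solve 2 (λ a b → con 1 :* b :+ con 0 :* a := b) refl a b ,
    solve 3 (λ a b c → con 1 :* c :+ (con 0 :* b :+ con 0 :* a) := c) refl a b c

  *³-distribˡ : ∀ u v w → (u *³ (v +³ w)) ≈³ ((u *³ v) +³ (u *³ w))
  *³-distribˡ (a , b , c) (d , e , f) (g , h , i) = distribˡ a d g ,
    solve 6 (λ a b d e g h → a :* (e :+ h) :+ b :* (d :+ g) := (a :* e :+ b :* d) :+ (a :* h :+ b :* g)) refl a b d e g h ,
    solve 9 (λ a b c d e f g h i →
      a :* (f :+ i) :+ (b :* (e :+ h) :+ c :* (d :+ g))
      := (a :* f :+ (b :* e :+ c :* d)) :+ (a :* i :+ (b :* h :+ c :* g))) refl a b c d e f g h i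

  commutativeRing³ : CommutativeRing o ℓ
  commutativeRing³ = record
    { _*_ = _*³_
    ; 1#  = 1# , 0# , 0#
    ; isCommutativeRing = record
      { isRing = record
        { +-isAbelianGroup = AbelianGroup.isAbelianGroup +-group³
        ; *-cong     = λ (p , q , r) (p′ , q′ , r′) → *-cong p p′ , +-cong (*-cong p q′) (*-cong q p′) ,
                         +-cong (*-cong p r′) (+-cong (*-cong q q′) (*-cong r p′))
        ; *-assoc    = *³-assoc
        ; *-identity = *³-identityˡ , λ u → trans³ (*³-comm u _) (*³-identityˡ u)
        ; distrib    = *³-distribˡ , λ u v w → trans³ (*³-comm (v +³ w) u)
                         (trans³ (*³-distribˡ u v w) (∙-cong (*³-comm u v) (*³-comm u w)))
        }
      ; *-comm = *³-comm
      }
    }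
    where open AbelianGroup +-group³ using (∙-cong) renaming (trans to trans³)

  algebra : ℚ-Algebra o ℓ
  algebra = record
    { commutativeRing = commutativeRing³
    ; ι = λ q → ι q , 0# , 0#
    ; isRingHomomorphism = record
      { isSemiringHomomorphism = record
        { isNearSemiringHomomorphism = record
          { +-isMonoidHomomorphism = record
            { isMagmaHomomorphism = record
              { isRelHomomorphism = record { cong = λ eq → ι.⟦⟧-cong eq , refl , refl }
              ; homo = λ p q → ι.+-homo p q , sym (+-identityˡ 0#) , sym (+-identityˡ 0#)
              }
            ; ε-homo = ι.0#-homo , refl , refl
            }
          ; *-homo = λ p q → ι.*-homo p q ,
              solve 2 (λ a b → con 0 := a :* con 0 :+ con 0 :* b) refl (ι p) (ι q) ,
              solve 2 (λ a b → con 0 := a :* con 0 :+ (con 0 :* con 0 :+ con 0 :* b)) refl (ι p) (ι q)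
          }
        ; 1#-homo = ι.1#-homo , refl , refl
        }
      ; -‿homo = λ p → ι.-‿homo p , sym -0≈0 , sym -0≈0
      }
    }
    where
    -0≈0 : - 0# ≈ 0#
    -0≈0 = ε⁻¹≈ε
      where open import Algebra.Properties.Group +-group using (ε⁻¹≈ε)

  sum-components : ∀ {X : Set} (f : X → Carrier³) xs → sum algebra (map f xs) ≈³
    (sum A (map (proj₁ ∘ f) xs) , sum A (map (proj₁ ∘ proj₂ ∘ f) xs) , sum A (map (proj₂ ∘ proj₂ ∘ f) xs))
  sum-components f []       = refl , refl , refl
  sum-components f (x ∷ xs) with p , q , r ← sum-components f xs = +-congˡ p , +-congˡ q , +-congˡ r

  -- The reciprocal of the number of triangulations enters as a constant, without ε, so expectations
  -- are taken coefficient by coefficient.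
  𝔼-components : ∀ n (f : List (Segment n) → Carrier³) → 𝔼 algebra n f ≈³
    (𝔼 A n (proj₁ ∘ f) , 𝔼 A n (proj₁ ∘ proj₂ ∘ f) , 𝔼 A n (proj₂ ∘ proj₂ ∘ f))
  𝔼-components n f = let p , q , r = sum-components f (triangulations n) in
    *-congˡ p ,
    trans (+-cong (*-congˡ q) (zeroˡ _)) (+-identityʳ _) ,
    trans (+-cong (*-congˡ r) (trans (+-cong (zeroˡ _) (zeroˡ _)) (+-identityˡ 0#))) (+-identityʳ _)

-- Variance and factorial moments.

module _ {o ℓ} (A : ℚ-Algebra o ℓ) where
  open ℚ-Algebra A
  open Convolution A
  open NaturalCoefficients commutativeSemiring using (solve; _:=_; _:+_; _:*_; con)
  open import Relation.Binary.Reasoning.Setoid setoid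
  open import Algebra.Properties.Group +-group using () renaming (∙-cancelʳ to +-cancelʳ)

  -- The expansion of (f - μ)² with its negative term moved to the left. The semiring solver sees y
  -- = f x - μ as an unknown and f x as y + μ.
  sum-square : ∀ {X : Set} (f : X → Carrier) μ xs →
    sum A (map (λ x → (f x - μ) ^ 2) xs) + (1# + 1#) * (μ * sum A (map f xs)) ≈
    sum A (map (λ x → f x * f x) xs) + (μ * μ) * sum A (map (const 1#) xs)
  sum-square f μ []       = solve 1 (λ μ → con 0 :+ (con 1 :+ con 1) :* (μ :* con 0) := con 0 :+ (μ :* μ) :* con 0) refl μ
  sum-square f μ (x ∷ xs) = begin
    (y * (y * 1#) + S₂) + (1# + 1#) * (μ * (f x + S))
      ≈⟨ +-congˡ (*-congˡ (*-congˡ (+-congʳ fx≈))) ⟩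
    (y * (y * 1#) + S₂) + (1# + 1#) * (μ * ((y + μ) + S))
      ≈⟨ solve 4 (λ y μ a b → (y :* (y :* con 1) :+ a) :+ (con 1 :+ con 1) :* (μ :* ((y :+ μ) :+ b))
           := ((y :+ μ) :* (y :+ μ) :+ μ :* μ) :+ (a :+ (con 1 :+ con 1) :* (μ :* b))) refl y μ S₂ S ⟩
    ((y + μ) * (y + μ) + μ * μ) + (S₂ + (1# + 1#) * (μ * S))
      ≈⟨ +-cong (+-congʳ (*-cong (sym fx≈) (sym fx≈))) (sum-square f μ xs) ⟩
    (f x * f x + μ * μ) + (S′ + (μ * μ) * S₀)
      ≈⟨ solve 4 (λ a m b c → (a :+ m) :+ (b :+ m :* c) := (a :+ b) :+ m :* (con 1 :+ c)) refl (f x * f x) (μ * μ) S′ S₀ ⟩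
    (f x * f x + S′) + (μ * μ) * (1# + S₀) ∎
    where
    y = f x - μ
    S = sum A (map f xs)
    S₀ = sum A (map (const 1#) xs)
    S₂ = sum A (map (λ x → (f x - μ) ^ 2) xs)
    S′ = sum A (map (λ x → f x * f x) xs)
    fx≈ : f x ≈ y + μ
    fx≈ = sym (trans (+-assoc _ _ _) (trans (+-congˡ (-‿inverseˡ μ)) (+-identityʳ (f x))))

  variance : ∀ n f → 𝔼 A n (const 1#) ≈ 1# → Var A n f + 𝔼 A n f * 𝔼 A n f ≈ 𝔼 A n (λ T → f T * f T)
  variance n f 𝔼1≈1 = +-cancelʳ (μ * μ) _ _ (begin
    (r * S₂ + μ * μ) + μ * μ
      ≈⟨ solve 4 (λ r s m q → (r :* s :+ m :* (r :* q)) :+ m :* (r :* q) := r :* (s :+ (con 1 :+ con 1) :* (m :* q))) refl r S₂ μ S ⟩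
    r * (S₂ + (1# + 1#) * (μ * S))
      ≈⟨ *-congˡ (sum-square f μ (triangulations n)) ⟩
    r * (S′ + (μ * μ) * S₀)
      ≈⟨ solve 4 (λ r s m q → r :* (s :+ m :* q) := r :* s :+ m :* (r :* q)) refl r S′ (μ * μ) S₀ ⟩
    r * S′ + (μ * μ) * (r * S₀)
      ≈⟨ +-congˡ (trans (*-congˡ 𝔼1≈1) (*-identityʳ _)) ⟩
    r * S′ + μ * μ ∎)
    where
    μ = 𝔼 A n f
    r = ι (reciprocal (length (triangulations n)))
    S = sum A (map f (triangulations n))
    S₀ = sum A (map (const 1#) (triangulations n))
    S₂ = sum A (map (λ T → (f T - μ) ^ 2) (triangulations n))
    S′ = sum A (map (λ T → f T * f T) (triangulations n))

  -- Clears the denominators 2 a and 8 a b of the mean μ and of τ = 𝔼 (𝒮 choose 2)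
  -- in v = 2 τ + μ - μ².
  clear-denominators : ∀ {v μ τ a b k l} → v + μ * μ ≈ (τ + τ) + μ →
    μ * ((1# + 1#) * a) ≈ k → τ * ((1# + 1#) * ((1# + 1#) * ((1# + 1#) * (a * b)))) ≈ l →
    (1# + 1#) * (v * ((1# + 1#) * (a * a) * b)) + k * k * b ≈ l * a + (1# + 1#) * (k * a * b)
  clear-denominators {v} {μ} {τ} {a} {b} {k} {l} v≈ k≈ l≈ = begin
    (1# + 1#) * (v * ((1# + 1#) * (a * a) * b)) + k * k * b
      ≈⟨ +-congˡ (*-congʳ (*-cong k≈ k≈)) ⟨
    (1# + 1#) * (v * ((1# + 1#) * (a * a) * b)) + (μ * ((1# + 1#) * a)) * (μ * ((1# + 1#) * a)) * b
      ≈⟨ solve 4 (λ v μ a b →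
           (con 1 :+ con 1) :* (v :* ((con 1 :+ con 1) :* (a :* a) :* b)) :+ (μ :* ((con 1 :+ con 1) :* a)) :* (μ :* ((con 1 :+ con 1) :* a)) :* b
           := (v :+ μ :* μ) :* ((con 1 :+ con 1) :* ((con 1 :+ con 1) :* (a :* a :* b)))) refl v μ a b ⟩
    (v + μ * μ) * ((1# + 1#) * ((1# + 1#) * (a * a * b)))
      ≈⟨ *-congʳ v≈ ⟩
    ((τ + τ) + μ) * ((1# + 1#) * ((1# + 1#) * (a * a * b)))
      ≈⟨ solve 4 (λ τ μ a b →
           ((τ :+ τ) :+ μ) :* ((con 1 :+ con 1) :* ((con 1 :+ con 1) :* (a :* a :* b)))
           := τ :* ((con 1 :+ con 1) :* ((con 1 :+ con 1) :* ((con 1 :+ con 1) :* (a :* b)))) :* a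
              :+ (con 1 :+ con 1) :* (μ :* ((con 1 :+ con 1) :* a) :* a :* b)) refl τ μ a b ⟩
    τ * ((1# + 1#) * ((1# + 1#) * ((1# + 1#) * (a * b)))) * a + (1# + 1#) * (μ * ((1# + 1#) * a) * a * b)
      ≈⟨ +-cong (*-congʳ l≈) (*-congˡ (*-congʳ (*-congʳ k≈))) ⟩
    l * a + (1# + 1#) * (k * a * b) ∎

-- This is k choose 2, by the recursion that multiplication by 1 + ε imposes on the coefficient of
-- ε².
triangular : ℕ → ℕ
triangular zero    = 0
triangular (suc k) = k ℕ.+ triangular k

square≡ : ∀ k → k ℕ.* k ≡ (triangular k ℕ.+ triangular k) ℕ.+ k
square≡ zero    = ≡.refl
square≡ (suc k) = ≡.trans
  (solve 1 (λ k → (con 1 :+ k) :* (con 1 :+ k) := k :* k :+ (con 1 :+ (k :+ k))) ≡.refl k)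
  (≡.trans (≡.cong (ℕ._+ (1 ℕ.+ (k ℕ.+ k))) (square≡ k))
    (solve 2 (λ k t → ((t :+ t) :+ k) :+ (con 1 :+ (k :+ k)) := ((k :+ t) :+ (k :+ t)) :+ (con 1 :+ k)) ≡.refl k (triangular k)))
  where open ℕSolver.+-*-Solver

-- The binomial factors at j = n - 3 and j = n - 4 for n = m + 4, where z - 1 has exponent 1 and 2.
weight₁ weight₂ : ℕ → ℕ
weight₁ m = ((suc m ℕ.+ 1) C 1) ℕ.+ 2 ℕ.* ((suc m ℕ.+ 1) C 0)
weight₂ m = ((m ℕ.+ 1) C 2) ℕ.+ 2 ℕ.* ((m ℕ.+ 1) C 1)

module _ {o ℓ} (A : ℚ-Algebra o ℓ) (z : ℚ-Algebra.Carrier A) where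
  open ℚ-Algebra A

  -- For j < m the exponent is at least 3. Nilpotency is stated in the nested form to which the
  -- power unfolds.
  summand-vanishes : (∀ u → (z - 1#) * ((z - 1#) * ((z - 1#) * u)) ≈ 0#) →
    ∀ m j {k} → suc j ℕ.+ k ≡ m → summand A z (2 ℕ.+ m) (suc m) j ≈ 0#
  summand-vanishes x³*≈0 m j {k} 1+j+k≡m =
    trans (*-congˡ (trans (reflexive (≡.cong ((z - 1#) ^_) exponent)) (x³*≈0 ((z - 1#) ^ k)))) (zeroʳ _)
    where
    exponent : 2 ℕ.+ m ℕ.∸ j ≡ 3 ℕ.+ k
    exponent = ≡.trans (≡.cong (ℕ._∸ j) (≡.sym (≡.trans (≡.trans (ℕ.+-suc j (2 ℕ.+ k)) (≡.cong suc (≡.trans (ℕ.+-suc j (suc k)) (≡.cong suc (ℕ.+-suc j k)))))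
      (≡.cong (2 ℕ.+_) 1+j+k≡m)))) (ℕ.m+n∸m≡n j (3 ℕ.+ k))

module _ {o ℓ} (A : ℚ-Algebra o ℓ) where
  open ℚ-Algebra A
  open Truncated A
  open CatalanConvolution A using (num; num-+)
  open NaturalCoefficients commutativeSemiring using (solve; _:=_; _:+_; _:*_; con)

  private
    module T = ℚ-Algebra algebra
    module TC = Convolution algebra

  -- (1 + ε) ^ k = 1 + k ε + (k choose 2) ε² turns the generating function at
  -- z = 1 + ε into the first two factorial moments.
  z : T.Carrier
  z = 1# , 1# , 0#

  z^ : ∀ k → z T.^ k T.≈ (1# , num k , num (triangular k))
  z^ zero    = refl , refl , refl
  z^ (suc k) with p , q , r ← z^ k =
    trans (*-identityˡ _) p ,
    trans (+-cong (*-identityˡ _) (*-identityˡ _)) (trans (+-cong q p) (+-comm _ _)) ,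
    trans (+-cong (*-identityˡ _) (trans (+-cong (*-identityˡ _) (zeroˡ _)) (+-identityʳ _)))
      (trans (+-cong r q) (trans (+-comm _ _) (sym (num-+ k (triangular k)))))

  ε : T.Carrier
  ε = z T.- T.1#

  ε* : ∀ u → ε T.* u T.≈ (0# , proj₁ u , proj₁ (proj₂ u))
  ε* u@(a , b , c) = T.trans (T.*-congʳ {u} (-‿inverseʳ 1# , 1-0≈1 , -‿inverseʳ 0#))
    ( zeroˡ a
    , solve 2 (λ a b → con 0 :* b :+ con 1 :* a := a) refl a b
    , solve 3 (λ a b c → con 0 :* c :+ (con 1 :* b :+ con 0 :* a) := b) refl a b c)
    where
    1-0≈1 : 1# - 0# ≈ 1#
    1-0≈1 = trans (+-congˡ ε⁻¹≈ε) (+-identityʳ 1#)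
      where open import Algebra.Properties.Group +-group using (ε⁻¹≈ε)

  ε^1 : ε T.^ 1 T.≈ (0# , 1# , 0#)
  ε^1 = ε* T.1#

  ε^2 : ε T.^ 2 T.≈ (0# , 0# , 1#)
  ε^2 with p , q , _ ← ε^1 = T.trans (ε* (ε T.^ 1)) (refl , p , q)

  ε³* : ∀ u → ε T.* (ε T.* (ε T.* u)) T.≈ T.0#
  ε³* u = T.trans (T.*-congˡ {ε} (T.*-congˡ {ε} (ε* u))) (T.trans (T.*-congˡ {ε} (ε* u₁)) (ε* u₂))
    where
    u₁ u₂ : T.Carrier
    u₁ = 0# , proj₁ u , proj₁ (proj₂ u)
    u₂ = 0# , 0# , proj₁ u

  ι³* : ∀ q u → T.ι q T.* u T.≈ (ι q * proj₁ u , ι q * proj₁ (proj₂ u) , ι q * proj₂ (proj₂ u))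
  ι³* q (a , b , c) = refl ,
    solve 3 (λ q a b → q :* b :+ con 0 :* a := q :* b) refl (ι q) a b ,
    solve 4 (λ q a b c → q :* c :+ (con 0 :* b :+ con 0 :* a) := q :* c) refl (ι q) a b c

  private
    summand³ : ℕ → ℕ → T.Carrier
    summand³ m = summand algebra z (suc m) m

    term³ : ℕ → ℕ → ℕ → T.Carrier
    term³ j = term algebra z j (j ℕ.+ 1)

    a+k∸a : ∀ a {k j} → j ℕ.+ a ≡ k → k ℕ.∸ j ≡ a
    a+k∸a a {j = j} ≡.refl = ℕ.m+n∸m≡n j a

    last₁ : ∀ m → summand³ (suc m) (suc m) T.≈ (0# , ι (catalan (suc m) ℚ.* fromℕ (weight₁ m)) , 0#)
    last₁ m = T.trans
      (T.reflexive (≡.cong₂ (term³ (suc m)) (a+k∸a 1 {suc (suc m)} {suc m} (ℕ.+-comm (suc m) 1)) (ℕ.n∸n≡0 (suc m))))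
      (T.trans (T.*-congˡ {T.ι q} ε^1) (T.trans (ι³* q _) (zeroʳ _ , *-identityʳ _ , zeroʳ _)))
      where q = catalan (suc m) ℚ.* fromℕ (weight₁ m)

    last₂ : ∀ m → summand³ (suc m) m T.≈ (0# , 0# , ι (catalan m ℚ.* fromℕ (weight₂ m)))
    last₂ m = T.trans
      (T.reflexive (≡.cong₂ (term³ m) (a+k∸a 2 {suc (suc m)} {m} (ℕ.+-comm m 2)) (a+k∸a 1 {suc m} {m} (ℕ.+-comm m 1))))
      (T.trans (T.*-congˡ {T.ι q} ε^2) (T.trans (ι³* q _) (zeroʳ _ , zeroʳ _ , *-identityʳ _)))
      where q = catalan m ℚ.* fromℕ (weight₂ m)

    tail≈ : ∀ m → TC.Σ (2 ℕ.+ m) (summand³ (suc m)) T.≈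
      (0# , ι (catalan (suc m) ℚ.* fromℕ (weight₁ m)) , ι (catalan m ℚ.* fromℕ (weight₂ m)))
    tail≈ m = T.trans (TC.Σ-last (suc m) (summand³ (suc m)))
      (T.trans (T.+-cong (T.trans (TC.Σ-last m (summand³ (suc m)))
          (T.+-cong (T.trans (TC.Σ-cong m {summand³ (suc m)} {const T.0#} λ {j} j<m → summand-vanishes algebra z ε³* m j (proj₂ (ℕ.m≤n⇒∃[o]m+o≡n j<m))) (TC.Σ-0 m (λ _ → T.refl))) (last₂ m)))
        (last₁ m))
        ( solve 0 ((con 0 :+ con 0) :+ con 0 := con 0) refl
        , solve 1 (λ a → (con 0 :+ con 0) :+ a := a) refl _
        , solve 1 (λ a → (con 0 :+ a) :+ con 0 := a) refl _))

  -- `g-explicit` at 1 + ε, compared coefficientwise: the powers `z^` give the expectations on one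
  -- side, and the last two summands give the other.
  factorial-moments : ∀ m (let i = (ℚ.1/ catalan (2 ℕ.+ m)) {{catalan≢0 (2 ℕ.+ m)}}) →
    𝔼 A (4 ℕ.+ m) (λ T → num (𝒮 T)) ≈ ι i * ι (catalan (suc m) ℚ.* fromℕ (weight₁ m)) ×
    𝔼 A (4 ℕ.+ m) (λ T → num (triangular (𝒮 T))) ≈ ι i * ι (catalan m ℚ.* fromℕ (weight₂ m))
  factorial-moments m = proj₁ (proj₂ both) , proj₂ (proj₂ both)
    where
    n = 4 ℕ.+ m
    i = (ℚ.1/ catalan (2 ℕ.+ m)) {{catalan≢0 (2 ℕ.+ m)}}
    moments : List (Segment n) → T.Carrier
    moments T = 1# , num (𝒮 T) , num (triangular (𝒮 T))
    both : (𝔼 A n (const 1#) , 𝔼 A n (λ T → num (𝒮 T)) , 𝔼 A n (λ T → num (triangular (𝒮 T)))) T.≈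
      (1# , ι i * ι (catalan (suc m) ℚ.* fromℕ (weight₁ m)) , ι i * ι (catalan m ℚ.* fromℕ (weight₂ m)))
    both = T.trans (T.sym (𝔼-components n moments))
      (T.trans (T.*-congˡ {T.ι (reciprocal (length (triangulations n)))}
          (TC.sum-cong {f = moments} {λ T → z T.^ 𝒮 T} (triangulations n) (λ {D} _ → T.sym (z^ (𝒮 D)))))
        (T.trans (g-explicit algebra z m)
          (T.trans (T.+-congˡ {T.1#} (T.trans (T.*-congˡ {T.ι i} (tail≈ m)) (ι³* i _)))
            (trans (+-congˡ (zeroʳ _)) (+-identityʳ 1#) , +-identityˡ _ , +-identityˡ _))))

  -- Here i is 1 / `c₂`, and the Catalan recurrence makes `c₁` / `c₂` equal to e / d; all is
  -- multiplied out to avoid division.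
  ratio₁ : ∀ {i c₂ c₁ d e k} → i * c₂ ≈ 1# → c₂ * e ≈ d * c₁ → (i * (c₁ * k)) * d ≈ k * e
  ratio₁ {i} {c₂} {c₁} {d} {e} {k} ic₂≈1 eq = begin
    (i * (c₁ * k)) * d    ≈⟨ solve 4 (λ i c k d → (i :* (c :* k)) :* d := i :* (k :* (d :* c))) refl i c₁ k d ⟩
    i * (k * (d * c₁))    ≈⟨ *-congˡ (*-congˡ eq) ⟨
    i * (k * (c₂ * e))    ≈⟨ solve 4 (λ i c k e → i :* (k :* (c :* e)) := (i :* c) :* (k :* e)) refl i c₂ k e ⟩
    (i * c₂) * (k * e)    ≈⟨ trans (*-congʳ ic₂≈1) (*-identityˡ _) ⟩
    k * e                 ∎
    where open import Relation.Binary.Reasoning.Setoid setoid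

  -- Two such quotients in a row. The factor 2 clears the denominator of the binomial coefficient m
  -- + 1 choose 2 contained in `weight₂`, for which k stands.
  ratio₂ : ∀ {i c₂ c₁ c₀ d e d′ e′ k k′} → i * c₂ ≈ 1# → c₂ * e ≈ d * c₁ → c₁ * e′ ≈ d′ * c₀ → (1# + 1#) * k ≈ k′ →
    (i * (c₀ * k)) * ((1# + 1#) * (d * d′)) ≈ k′ * (e * e′)
  ratio₂ {i} {c₂} {c₁} {c₀} {d} {e} {d′} {e′} {k} {k′} ic₂≈1 eq eq′ 2k≈k′ = begin
    (i * (c₀ * k)) * ((1# + 1#) * (d * d′))
      ≈⟨ solve 5 (λ i c k d d′ → (i :* (c :* k)) :* ((con 1 :+ con 1) :* (d :* d′)) := (i :* ((d′ :* c) :* ((con 1 :+ con 1) :* k))) :* d) refl i c₀ k d d′ ⟩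
    (i * ((d′ * c₀) * ((1# + 1#) * k))) * d    ≈⟨ *-congʳ (*-congˡ (*-cong (sym eq′) 2k≈k′)) ⟩
    (i * ((c₁ * e′) * k′)) * d                 ≈⟨ *-congʳ (*-congˡ (*-assoc c₁ e′ k′)) ⟩
    (i * (c₁ * (e′ * k′))) * d                 ≈⟨ ratio₁ ic₂≈1 eq ⟩
    (e′ * k′) * e                              ≈⟨ solve 3 (λ e e′ k → (e′ :* k) :* e := k :* (e :* e′)) refl e e′ k′ ⟩
    k′ * (e * e′)                              ∎
    where open import Relation.Binary.Reasoning.Setoid setoid

𝔼-cong : ∀ n {f g : List (Segment n) → ℚ} → (∀ T → f T ≡ g T) → 𝔼 ℚ-algebra n f ≡ 𝔼 ℚ-algebra n g
𝔼-cong n f≡g = ≡.cong (λ xs → reciprocal (length (triangulations n)) ℚ.* sum ℚ-algebra xs) (List.map-cong f≡g (triangulations n))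

𝔼-1 : ∀ m → 𝔼 ℚ-algebra (suc (suc m)) (const 1ℚ) ≡ 1ℚ
𝔼-1 m = ≡.trans (≡.cong₂ ℚ._*_ (normalisation m)
    (≡.trans (1-sum≡length (triangulations (suc (suc m)))) (triangulation-count m)))
  (ℚ.*-inverseˡ (catalan m) {{catalan≢0 m}})

-- Mean and variance.

module _ (m : ℕ) where

  private
    n = 4 ℕ.+ m
    -- a and b are 2 n - 5 and 2 n - 7, in the form in which `catalan-suc` produces them.
    a = 1 ℕ.+ 2 ℕ.* (1 ℕ.+ m)
    b = 1 ℕ.+ 2 ℕ.* m
    i = (ℚ.1/ catalan (2 ℕ.+ m)) {{catalan≢0 (2 ℕ.+ m)}}

  μ τ : ℚ
  μ = 𝔼 ℚ-algebra n (λ T → fromℕ (𝒮 T))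
  τ = 𝔼 ℚ-algebra n (λ T → fromℕ (triangular (𝒮 T)))

  μ≡ : μ ≡ i ℚ.* (catalan (suc m) ℚ.* fromℕ (weight₁ m))
  μ≡ = ≡.trans (𝔼-cong n (λ T → ≡.sym (num≡fromℕ (𝒮 T)))) (proj₁ (factorial-moments ℚ-algebra m))

  τ≡ : τ ≡ i ℚ.* (catalan m ℚ.* fromℕ (weight₂ m))
  τ≡ = ≡.trans (𝔼-cong n (λ T → ≡.sym (num≡fromℕ (triangular (𝒮 T))))) (proj₂ (factorial-moments ℚ-algebra m))

  weight₁≡ : weight₁ m ≡ n
  weight₁≡ = ≡.trans (≡.cong (ℕ._+ 2) (nC1≡n (suc m ℕ.+ 1)))
    (solve 1 (λ m → (con 1 :+ m :+ con 1) :+ con 2 := con 4 :+ m) ≡.refl m)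
    where open ℕSolver.+-*-Solver

  weight₂≡ : 2 ℕ.* weight₂ m ≡ (1 ℕ.+ m) ℕ.* n
  weight₂≡ = ≡.trans (≡.cong (λ k → 2 ℕ.* ((k C 2) ℕ.+ 2 ℕ.* (k C 1))) (ℕ.+-comm m 1))
    (≡.trans (ℕ.*-distribˡ-+ 2 (suc m C 2) (2 ℕ.* (suc m C 1)))
      (≡.trans (≡.cong₂ (λ u v → u ℕ.+ 2 ℕ.* (2 ℕ.* v))
          (≡.trans (absorption m 1) (≡.cong (suc m ℕ.*_) (nC1≡n m))) (nC1≡n (suc m)))
        (solve 1 (λ m → (con 1 :+ m) :* m :+ con 2 :* (con 2 :* (con 1 :+ m)) := (con 1 :+ m) :* (con 4 :+ m)) ≡.refl m)))
    where open ℕSolver.+-*-Solver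

  private
    i*c : i ℚ.* catalan (2 ℕ.+ m) ≡ 1ℚ
    i*c = ℚ.*-inverseˡ (catalan (2 ℕ.+ m)) {{catalan≢0 (2 ℕ.+ m)}}

  μ-scaled : μ ℚ.* fromℕ (2 ℕ.* a) ≡ fromℕ (n ℕ.* (3 ℕ.+ m))
  μ-scaled = ≡.trans (≡.cong (ℚ._* fromℕ (2 ℕ.* a)) μ≡)
    (≡.trans (ratio₁ ℚ-algebra {i} {catalan (2 ℕ.+ m)} {catalan (1 ℕ.+ m)} {fromℕ (2 ℕ.* a)} {fromℕ (3 ℕ.+ m)} {fromℕ (weight₁ m)} i*c (catalan-suc (suc m)))
      (≡.trans (≡.cong (λ k → fromℕ k ℚ.* fromℕ (3 ℕ.+ m)) weight₁≡) (≡.sym (fromℕ-* n (3 ℕ.+ m)))))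

  -- In terms of n, the second factorial moment 2 τ is n (n - 1) (n - 2) (n - 3) / (4 (2 n - 5) (2 n
  -- - 7)).
  τ-scaled : τ ℚ.* (fromℕ 2 ℚ.* (fromℕ (2 ℕ.* a) ℚ.* fromℕ (2 ℕ.* b))) ≡ fromℕ ((1 ℕ.+ m) ℕ.* n ℕ.* ((3 ℕ.+ m) ℕ.* (2 ℕ.+ m)))
  τ-scaled = ≡.trans (≡.cong (ℚ._* (fromℕ 2 ℚ.* (fromℕ (2 ℕ.* a) ℚ.* fromℕ (2 ℕ.* b)))) τ≡)
    (≡.trans (ratio₂ ℚ-algebra {i} {catalan (2 ℕ.+ m)} {catalan (1 ℕ.+ m)} {catalan m} {fromℕ (2 ℕ.* a)} {fromℕ (3 ℕ.+ m)}
        {fromℕ (2 ℕ.* b)} {fromℕ (2 ℕ.+ m)} {fromℕ (weight₂ m)} {fromℕ ((1 ℕ.+ m) ℕ.* n)} i*c (catalan-suc (suc m)) (catalan-suc m)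
        (≡.trans (≡.sym (fromℕ-* 2 (weight₂ m))) (≡.cong fromℕ weight₂≡)))
      (≡.trans (≡.cong (fromℕ ((1 ℕ.+ m) ℕ.* n) ℚ.*_) (≡.sym (fromℕ-* (3 ℕ.+ m) (2 ℕ.+ m))))
        (≡.sym (fromℕ-* ((1 ℕ.+ m) ℕ.* n) ((3 ℕ.+ m) ℕ.* (2 ℕ.+ m))))))

  2n∸5≡ : 2 ℕ.* n ℕ.∸ 5 ≡ a
  2n∸5≡ = ≡.trans (≡.cong (ℕ._∸ 5) (solve 1 (λ m → con 2 :* (con 4 :+ m) := con 5 :+ (con 1 :+ con 2 :* (con 1 :+ m))) ≡.refl m))
    (ℕ.m+n∸m≡n 5 a)
    where open ℕSolver.+-*-Solver

  mean : (4≤n : 4 ℕ.≤ n) → μ ≡ ℚ._/_ (ℤ.+ (n ℕ.* (n ℕ.∸ 1))) (2 ℕ.* (2 ℕ.* n ℕ.∸ 5)) {{mean-denominator≢0 4≤n}}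
  mean 4≤n = ≡-/ (n ℕ.* (3 ℕ.+ m)) (2 ℕ.* (2 ℕ.* n ℕ.∸ 5)) {{mean-denominator≢0 4≤n}}
    (≡.trans (≡.cong (λ d → μ ℚ.* fromℕ (2 ℕ.* d)) 2n∸5≡) μ-scaled)

  σ² : ℚ
  σ² = Var ℚ-algebra n (λ T → fromℕ (𝒮 T))

  -- By linearity, from s² = 2 (s choose 2) + s.
  σ²≡ : σ² ℚ.+ μ ℚ.* μ ≡ (τ ℚ.+ τ) ℚ.+ μ
  σ²≡ = ≡.trans (variance ℚ-algebra n (λ T → fromℕ (𝒮 T)) (𝔼-1 (2 ℕ.+ m)))
    (≡.trans (𝔼-cong n square) (≡.trans (𝔼-+ _ _) (≡.cong (ℚ._+ μ) (𝔼-+ _ _))))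
    where
    square : ∀ T → fromℕ (𝒮 T) ℚ.* fromℕ (𝒮 T) ≡
      (fromℕ (triangular (𝒮 T)) ℚ.+ fromℕ (triangular (𝒮 T))) ℚ.+ fromℕ (𝒮 T)
    square T = ≡.trans (≡.sym (fromℕ-* s s)) (≡.trans (≡.cong fromℕ (square≡ s))
      (≡.trans (fromℕ-+ (triangular s ℕ.+ triangular s) s) (≡.cong (ℚ._+ fromℕ s) (fromℕ-+ (triangular s) (triangular s)))))
      where s = 𝒮 T
    sum-+ : ∀ (f g : List (Segment n) → ℚ) xs →
      sum ℚ-algebra (map (λ T → f T ℚ.+ g T) xs) ≡ sum ℚ-algebra (map f xs) ℚ.+ sum ℚ-algebra (map g xs)
    sum-+ f g []       = ≡.refl
    sum-+ f g (T ∷ Ts) = ≡.trans (≡.cong (f T ℚ.+ g T ℚ.+_) (sum-+ f g Ts)) (interchange (f T) (g T) _ _)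
      where
      open import Algebra.Bundles using (CommutativeMonoid)
      open import Algebra.Properties.CommutativeSemigroup
        (CommutativeMonoid.commutativeSemigroup ℚ.+-0-commutativeMonoid) using (interchange)
    𝔼-+ : ∀ f g → 𝔼 ℚ-algebra n (λ T → f T ℚ.+ g T) ≡ 𝔼 ℚ-algebra n f ℚ.+ 𝔼 ℚ-algebra n g
    𝔼-+ f g = ≡.trans (≡.cong (reciprocal (length (triangulations n)) ℚ.*_) (sum-+ f g (triangulations n)))
      (ℚ.*-distribˡ-+ (reciprocal (length (triangulations n))) _ _)

  σ²-scaled : fromℕ 2 ℚ.* (σ² ℚ.* (fromℕ 2 ℚ.* (fromℕ a ℚ.* fromℕ a) ℚ.* fromℕ b))
      ℚ.+ fromℕ (n ℕ.* (3 ℕ.+ m)) ℚ.* fromℕ (n ℕ.* (3 ℕ.+ m)) ℚ.* fromℕ b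
    ≡ fromℕ ((1 ℕ.+ m) ℕ.* n ℕ.* ((3 ℕ.+ m) ℕ.* (2 ℕ.+ m))) ℚ.* fromℕ a
      ℚ.+ fromℕ 2 ℚ.* (fromℕ (n ℕ.* (3 ℕ.+ m)) ℚ.* fromℕ a ℚ.* fromℕ b)
  σ²-scaled = clear-denominators ℚ-algebra {σ²} {μ} {τ} {fromℕ a} {fromℕ b} {fromℕ (n ℕ.* (3 ℕ.+ m))}
    {fromℕ ((1 ℕ.+ m) ℕ.* n ℕ.* ((3 ℕ.+ m) ℕ.* (2 ℕ.+ m)))} σ²≡
    (≡.trans (≡.cong (μ ℚ.*_) (≡.sym (fromℕ-* 2 a))) μ-scaled)
    (≡.trans (≡.cong (λ d → τ ℚ.* (fromℕ 2 ℚ.* d)) (≡.sym shuffle)) τ-scaled)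
    where
    shuffle : fromℕ (2 ℕ.* a) ℚ.* fromℕ (2 ℕ.* b) ≡ fromℕ 2 ℚ.* (fromℕ 2 ℚ.* (fromℕ a ℚ.* fromℕ b))
    shuffle = ≡.trans (≡.sym (fromℕ-* (2 ℕ.* a) (2 ℕ.* b)))
      (≡.trans (≡.cong fromℕ (solve 2 (λ a b → con 2 :* a :* (con 2 :* b) := con 2 :* (con 2 :* (a :* b))) ≡.refl a b))
        (≡.trans (fromℕ-* 2 (2 ℕ.* (a ℕ.* b))) (≡.cong (fromℕ 2 ℚ.*_)
          (≡.trans (fromℕ-* 2 (a ℕ.* b)) (≡.cong (fromℕ 2 ℚ.*_) (fromℕ-* a b))))))
      where open ℕSolver.+-*-Solver

module _ (k : ℕ) where

  private
    m = 2 ℕ.+ k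
    n = 6 ℕ.+ k
    a = 1 ℕ.+ 2 ℕ.* (1 ℕ.+ m)
    b = 1 ℕ.+ 2 ℕ.* m
    K = n ℕ.* (3 ℕ.+ m)
    L = (1 ℕ.+ m) ℕ.* n ℕ.* ((3 ℕ.+ m) ℕ.* (2 ℕ.+ m))
    N = n ℕ.* (5 ℕ.+ k) ℕ.* (2 ℕ.+ k) ℕ.* (1 ℕ.+ k)
    D = 2 ℕ.* (a ℕ.* a) ℕ.* b

  -- Up to the factor n (n - 1) this is 2 (n - 4) (n - 5) + n (n - 1) (2 n - 7) = (n - 2) (n - 3) (2
  -- n - 5) + 2 (2 n - 5) (2 n - 7). With n = 6 + k all factors are polynomials in k with natural
  -- coefficients.
  numerator : 2 ℕ.* N ℕ.+ K ℕ.* K ℕ.* b ≡ L ℕ.* a ℕ.+ 2 ℕ.* (K ℕ.* a ℕ.* b)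
  numerator = solve 1 (λ k →
    con 2 :* ((con 6 :+ k) :* (con 5 :+ k) :* (con 2 :+ k) :* (con 1 :+ k))
    :+ ((con 6 :+ k) :* (con 5 :+ k)) :* ((con 6 :+ k) :* (con 5 :+ k)) :* (con 1 :+ con 2 :* (con 2 :+ k))
    := (con 3 :+ k) :* (con 6 :+ k) :* ((con 5 :+ k) :* (con 4 :+ k)) :* (con 1 :+ con 2 :* (con 3 :+ k))
    :+ con 2 :* ((con 6 :+ k) :* (con 5 :+ k) :* (con 1 :+ con 2 :* (con 3 :+ k)) :* (con 1 :+ con 2 :* (con 2 :+ k)))) ≡.refl k
    where open ℕSolver.+-*-Solver

  denominator : 2 ℕ.* (2 ℕ.* n ℕ.∸ 5) ℕ.^ 2 ℕ.* (2 ℕ.* n ℕ.∸ 7) ≡ D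
  denominator = ≡.cong₂ (λ u v → 2 ℕ.* u ℕ.* v)
    (≡.trans (≡.cong (ℕ._^ 2) (2n∸5≡ m)) (≡.cong (a ℕ.*_) (ℕ.*-identityʳ a)))
    (≡.trans (≡.cong (ℕ._∸ 7) (solve 1 (λ k → con 2 :* (con 6 :+ k) := con 7 :+ (con 1 :+ con 2 :* (con 2 :+ k))) ≡.refl k))
      (ℕ.m+n∸m≡n 7 b))
    where open ℕSolver.+-*-Solver

  var : (6≤n : 6 ℕ.≤ n) → Var ℚ-algebra n (λ T → fromℕ (𝒮 T)) ≡
    ℚ._/_ (ℤ.+ (n ℕ.* (n ℕ.∸ 1) ℕ.* (n ℕ.∸ 4) ℕ.* (n ℕ.∸ 5)))
      (2 ℕ.* (2 ℕ.* n ℕ.∸ 5) ℕ.^ 2 ℕ.* (2 ℕ.* n ℕ.∸ 7)) {{variance-denominator≢0 6≤n}}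
  var 6≤n = ≡-/ N (2 ℕ.* (2 ℕ.* n ℕ.∸ 5) ℕ.^ 2 ℕ.* (2 ℕ.* n ℕ.∸ 7)) {{variance-denominator≢0 6≤n}}
    -- By `numerator`, `σ²-scaled` is twice the claim with X, which stems from μ², added on both
    -- sides; X and the 2 are cancelled.
    (fromℕ-cancelʳ 2 (≡.trans (ℚ.*-comm y (fromℕ 2))
      (≡.trans (+-cancelʳ X (fromℕ 2 ℚ.* y) (fromℕ 2 ℚ.* fromℕ N) sums) (ℚ.*-comm (fromℕ 2) (fromℕ N)))))
    where
    open import Algebra.Properties.Group ℚ.+-0-group using () renaming (∙-cancelʳ to +-cancelʳ)
    open ≡.≡-Reasoning
    y = σ² m ℚ.* fromℕ (2 ℕ.* (2 ℕ.* n ℕ.∸ 5) ℕ.^ 2 ℕ.* (2 ℕ.* n ℕ.∸ 7))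
    X = fromℕ K ℚ.* fromℕ K ℚ.* fromℕ b
    D≡ : fromℕ D ≡ fromℕ 2 ℚ.* (fromℕ a ℚ.* fromℕ a) ℚ.* fromℕ b
    D≡ = ≡.trans (fromℕ-* (2 ℕ.* (a ℕ.* a)) b) (≡.cong (ℚ._* fromℕ b)
      (≡.trans (fromℕ-* 2 (a ℕ.* a)) (≡.cong (fromℕ 2 ℚ.*_) (fromℕ-* a a))))
    sums : fromℕ 2 ℚ.* y ℚ.+ X ≡ fromℕ 2 ℚ.* fromℕ N ℚ.+ X
    sums = begin
      fromℕ 2 ℚ.* y ℚ.+ X
        ≡⟨ ≡.cong (λ d → fromℕ 2 ℚ.* (σ² m ℚ.* d) ℚ.+ X) (≡.trans (≡.cong fromℕ denominator) D≡) ⟩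
      fromℕ 2 ℚ.* (σ² m ℚ.* (fromℕ 2 ℚ.* (fromℕ a ℚ.* fromℕ a) ℚ.* fromℕ b)) ℚ.+ X
        ≡⟨ σ²-scaled m ⟩
      fromℕ L ℚ.* fromℕ a ℚ.+ fromℕ 2 ℚ.* (fromℕ K ℚ.* fromℕ a ℚ.* fromℕ b)
        ≡⟨ ≡.cong₂ ℚ._+_ (fromℕ-* L a) (≡.trans (fromℕ-* 2 (K ℕ.* a ℕ.* b)) (≡.cong (fromℕ 2 ℚ.*_)
             (≡.trans (fromℕ-* (K ℕ.* a) b) (≡.cong (ℚ._* fromℕ b) (fromℕ-* K a))))) ⟨
      fromℕ (L ℕ.* a) ℚ.+ fromℕ (2 ℕ.* (K ℕ.* a ℕ.* b))
        ≡⟨ fromℕ-+ (L ℕ.* a) (2 ℕ.* (K ℕ.* a ℕ.* b)) ⟨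
      fromℕ (L ℕ.* a ℕ.+ 2 ℕ.* (K ℕ.* a ℕ.* b))
        ≡⟨ ≡.cong fromℕ numerator ⟨
      fromℕ (2 ℕ.* N ℕ.+ K ℕ.* K ℕ.* b)
        ≡⟨ fromℕ-+ (2 ℕ.* N) (K ℕ.* K ℕ.* b) ⟩
      fromℕ (2 ℕ.* N) ℚ.+ fromℕ (K ℕ.* K ℕ.* b)
        ≡⟨ ≡.cong₂ ℚ._+_ (fromℕ-* 2 N) (≡.trans (fromℕ-* (K ℕ.* K) b) (≡.cong (ℚ._* fromℕ b) (fromℕ-* K K))) ⟩
      fromℕ 2 ℚ.* fromℕ N ℚ.+ X ∎

mean-formula : ∀ n → (4≤n : 4 ℕ.≤ n) → 𝔼 ℚ-algebra n (λ T → fromℕ (𝒮 T)) ≡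
  ℚ._/_ (ℤ.+ (n ℕ.* (n ℕ.∸ 1))) (2 ℕ.* (2 ℕ.* n ℕ.∸ 5)) {{mean-denominator≢0 4≤n}}
mean-formula n 4≤n = at n (proj₂ (ℕ.m≤n⇒∃[o]m+o≡n 4≤n)) 4≤n
  where
  at : ∀ n {m} → 4 ℕ.+ m ≡ n → (4≤n : 4 ℕ.≤ n) → 𝔼 ℚ-algebra n (λ T → fromℕ (𝒮 T)) ≡
    ℚ._/_ (ℤ.+ (n ℕ.* (n ℕ.∸ 1))) (2 ℕ.* (2 ℕ.* n ℕ.∸ 5)) {{mean-denominator≢0 4≤n}}
  at _ {m} ≡.refl = mean m

variance-formula : ∀ n → (6≤n : 6 ℕ.≤ n) → Var ℚ-algebra n (λ T → fromℕ (𝒮 T)) ≡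
  ℚ._/_ (ℤ.+ (n ℕ.* (n ℕ.∸ 1) ℕ.* (n ℕ.∸ 4) ℕ.* (n ℕ.∸ 5)))
    (2 ℕ.* (2 ℕ.* n ℕ.∸ 5) ℕ.^ 2 ℕ.* (2 ℕ.* n ℕ.∸ 7)) {{variance-denominator≢0 6≤n}}
variance-formula n 6≤n = at n (proj₂ (ℕ.m≤n⇒∃[o]m+o≡n 6≤n)) 6≤n
  where
  at : ∀ n {k} → 6 ℕ.+ k ≡ n → (6≤n : 6 ℕ.≤ n) → Var ℚ-algebra n (λ T → fromℕ (𝒮 T)) ≡
    ℚ._/_ (ℤ.+ (n ℕ.* (n ℕ.∸ 1) ℕ.* (n ℕ.∸ 4) ℕ.* (n ℕ.∸ 5)))
      (2 ℕ.* (2 ℕ.* n ℕ.∸ 5) ℕ.^ 2 ℕ.* (2 ℕ.* n ℕ.∸ 7)) {{variance-denominator≢0 6≤n}}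
  at _ {k} ≡.refl = var k

open import Data.Nat using (ℕ; _+_; _*_; _∸_; _^_; _≤_)
open import Data.Nat.Combinatorics using (_C_)
open import Data.Integer using (+_)
open import Data.List using (map; upTo)
open import Data.Product using (_×_)
open import Data.Rational using (_/_; 1/_) renaming (_*_ to _*ℚ_)
open import Relation.Binary.PropositionalEquality using (_≡_)

lemma4 : ∀ {c ℓ} →
    ((A : ℚ-Algebra c ℓ) →
    let module A = ℚ-Algebra A in
    ∀ n → 4 ≤ n → (z : A.Carrier) →
    g A n z A.≈
    (A.1# A.+
    A.ι ((1/ catalan (n ∸ 2)) {{catalan≢0 (n ∸ 2)}}) A.*
    sum A (map (λ j →
    A.ι (catalan j *ℚ fromℕ (((j + 1) C (n ∸ 2 ∸ j)) + 2 * ((j + 1) C (n ∸ 3 ∸ j))))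
    A.* ((z A.- A.1#) A.^ (n ∸ 2 ∸ j)))
    (upTo (n ∸ 2)))))
    × (∀ n → (4≤n : 4 ≤ n) →
    𝔼 ℚ-algebra n (λ T → fromℕ (𝒮 T))
    ≡ _/_ (+ (n * (n ∸ 1))) (2 * (2 * n ∸ 5)) {{mean-denominator≢0 4≤n}})
    × (∀ n → (6≤n : 6 ≤ n) →
    Var ℚ-algebra n (λ T → fromℕ (𝒮 T))
    ≡ _/_ (+ (n * (n ∸ 1) * (n ∸ 4) * (n ∸ 5))) (2 * (2 * n ∸ 5) ^ 2 * (2 * n ∸ 7)) {{variance-denominator≢0 6≤n}})
lemma4 = (λ A n 4≤n z → g-formula A z n 4≤n) , mean-formula , variance-formula
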